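{- Let $r\geq 1$ be an integer and let $D=1$ or let $D\geq 2$ be a prime number. Then there exists a sequence of integers $\alpha_1<\alpha_2<\cdots<\alpha_{rD}$ with $\alpha_1\geq 2$ such that $\Delta_{r,D}(\underline{\alpha})\neq 0$. In particular, for every vector $\mathbf a=(a_1,\ldots,a_r)$ of positive integers such that $D$ is a common multiple of $a_1,\ldots,a_r$, the $rD$ numbers $d_{\mathbf a,m}(v)$ ($0\leq m\leq r-1$, $1\leq v\leq D$) are the unique solution of the linear system $$\sum_{m=0}^{r-1}\sum_{v=1}^{D} d_{\mathbf a,m}(v)\,\frac{D^{\alpha_j+m}B_{\alpha_j+m}(\frac{v}{D})}{\alpha_j+m}=\frac{(-1)^{r-1}(\alpha_j-1)!\,D}{(\alpha_j+r-1)!}B_{\alpha_j+r-1}(\mathbf a),\qquad 1\leq j\leq rD,$$ so that $p_{\mathbf a}(n)$ can be computed from values of Bernoulli polynomials and Bernoulli–Barnes numbers.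
   Context: The Bernoulli polynomials $B_n(x)$ are defined by $\frac{ze^{xz}}{e^z-1}=\sum_{n\geq 0}B_n(x)\frac{z^n}{n!}$. For integers $r\geq1$, $D\geq 1$ and a sequence of integers $\underline{\alpha}:\alpha_1<\cdots<\alpha_{rD}$ with $\alpha_1\geq 2$, $\Delta_{r,D}(\underline{\alpha})$ denotes the determinant of the $rD\times rD$ matrix whose rows are indexed by $j=1,\ldots,rD$ and whose columns are indexed by pairs $(m,v)$, $0\leq m\leq r-1$, $1\leq v\leq D$ (the pair $(m,v)$ being the $(mD+v)$-th column), with $(j,(m,v))$ entry $\frac{D^{\alpha_j+m}B_{\alpha_j+m}(v/D)}{\alpha_j+m}$. For $\mathbf a=(a_1,\ldots,a_r)$ positive integers, $p_{\mathbf a}(n)$ is the number of integer solutions $(x_1,\ldots,x_r)$ with all $x_i\geq 0$ of $a_1x_1+\cdots+a_rx_r=n$. If $D$ is a common multiple of the $a_i$, then $p_{\mathbf a}(n)=\sum_{m=0}^{r-1}d_{\mathbf a,m}(n)n^m$ for all $n\geq 0$, with uniquely determined functions $d_{\mathbf a,m}:\mathbb N\to\mathbb Q$ that are periodic with period $D$. The Bernoulli–Barnes numbers $B_j(\mathbf a)$ are defined by $\frac{z^r}{(e^{a_1z}-1)\cdots(e^{a_rz}-1)}=\sum_{j\geq0}B_j(\mathbf a)\frac{z^j}{j!}$. -}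

module Defs where

open import Data.Nat as ℕ using (ℕ; zero; suc; _!; _≡ᵇ_)
open import Data.Nat.Combinatorics using (_C_)
open import Data.Integer using (+_)
open import Data.Rational as ℚ using (ℚ; 0ℚ; 1ℚ; _+_; _*_; -_; 1/_; ≢-nonZero)
open import Data.Rational.Properties using (_≟_)
open import Data.Fin as Fin using (Fin; toℕ; remQuot; punchIn)
open import Data.Vec.Functional using (_∷_)
open import Data.List as List using (List; []; length; filterᵇ; cartesianProductWith; upTo)
open import Data.Product using (_,_; proj₁; proj₂)
open import Relation.Nullary using (yes; no)

ℕ→ℚ : ℕ → ℚ
ℕ→ℚ n = (+ n) ℚ./ 1

-- total division on ℚ (x / 0 := 0; only ever used with nonzero divisors)
_÷₀_ : ℚ → ℚ → ℚ
p ÷₀ q with q ≟ 0ℚ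
... | yes _ = 0ℚ
... | no q≢0 = p * (1/_ q {{≢-nonZero q≢0}})

_^_ : ℚ → ℕ → ℚ
x ^ zero = 1ℚ
x ^ suc n = x * (x ^ n)

Σ : ∀ n → (Fin n → ℚ) → ℚ
Σ zero f = 0ℚ
Σ (suc n) f = f Fin.zero + Σ n (λ i → f (Fin.suc i))

Σℕ : ∀ n → (Fin n → ℕ) → ℕ
Σℕ zero f = 0
Σℕ (suc n) f = f Fin.zero ℕ.+ Σℕ n (λ i → f (Fin.suc i))

-- Formal power series over ℚ (coefficient functions)

PS : Set
PS = ℕ → ℚ

_⊛_ : PS → PS → PS
(f ⊛ g) n = Σ (suc n) (λ k → f (toℕ k) * g (n ℕ.∸ toℕ k))

Π : ∀ r → (Fin r → PS) → PS
Π zero fs zero = 1ℚ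
Π zero fs (suc n) = 0ℚ
Π (suc r) fs = fs Fin.zero ⊛ Π r (λ i → fs (Fin.suc i))

-- Multiplicative inverse of a series f with f 0 ≠ 0.
-- invRev f n = [g n , g (n-1) , … , g 0], where g = f⁻¹ is given by
-- g 0 = 1 / f 0,  g n = -(1/f 0) · Σ_{k=1}^{n} f k · g (n-k).
private
  conv : PS → ℕ → List ℚ → ℚ
  conv f k [] = 0ℚ
  conv f k (g List.∷ gs) = f k * g + conv f (suc k) gs

invRev : PS → ℕ → List ℚ
invRev f zero = (1ℚ ÷₀ f 0) List.∷ []
invRev f (suc n) =
  let gs = invRev f n in
  (- ((1ℚ ÷₀ f 0) * conv f 1 gs)) List.∷ gs

inv : PS → PS
inv f n with invRev f n
... | [] = 0ℚ
... | g List.∷ _ = g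

expS : ℚ → PS
expS x n = (x ^ n) ÷₀ ℕ→ℚ (n !)

expm1OverZ : ℕ → PS
expm1OverZ a n = (ℕ→ℚ a ^ suc n) ÷₀ ℕ→ℚ (suc n !)

-- Bernoulli polynomials:  z e^{xz} / (e^z - 1) = Σ Bₙ(x) zⁿ / n!
bernoulliPoly : ℕ → ℚ → ℚ
bernoulliPoly n x = ℕ→ℚ (n !) * (inv (expm1OverZ 1) ⊛ expS x) n

-- Bernoulli–Barnes numbers:
--   z^r / ∏ (e^{aᵢ z} - 1) = Σ Bⱼ(a) zʲ / j!
bernoulliBarnes : ∀ {r} → (Fin r → ℕ) → ℕ → ℚ
bernoulliBarnes {r} a j =
  ℕ→ℚ (j !) * inv (Π r (λ i → expm1OverZ (a i))) j

det : ∀ n → (Fin n → Fin n → ℚ) → ℚ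
det zero M = 1ℚ
det (suc n) M =
  Σ (suc n) (λ j → ((- 1ℚ) ^ toℕ j) * M Fin.zero j
                    * det n (λ r c → M (Fin.suc r) (punchIn j c)))

entry : (D α m v : ℕ) → ℚ
entry D α m v =
  (ℕ→ℚ D ^ (α ℕ.+ m)) * bernoulliPoly (α ℕ.+ m) (ℕ→ℚ v ÷₀ ℕ→ℚ D)
    ÷₀ ℕ→ℚ (α ℕ.+ m)

-- column index c ∈ Fin (r * D) corresponds to the pair (m , v) with
-- c = m * D + (v - 1)  (0-based), i.e. (m , v) is the (mD+v)-th column.
Δ : (r D : ℕ) → (Fin (r ℕ.* D) → ℕ) → ℚ
Δ r D α = det (r ℕ.* D) (λ j c →
  entry D (α j) (toℕ (proj₁ (remQuot {r} D c)))
                (suc (toℕ (proj₂ (remQuot {r} D c)))))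

-- Restricted partition function p_a(n): number of (x₁,…,x_r) ∈ ℕ^r with
-- a₁x₁ + ⋯ + a_r x_r = n.  For positive aᵢ every solution has xᵢ ≤ n, so
-- we count within the box {0,…,n}^r.

box : ∀ r → ℕ → List (Fin r → ℕ)
box zero n = (λ ()) List.∷ []
box (suc r) n = cartesianProductWith _∷_ (upTo (suc n)) (box r n)

partitionCount : ∀ {r} → (Fin r → ℕ) → ℕ → ℕ
partitionCount {r} a n =
  length (filterᵇ (λ x → Σℕ r (λ i → a i ℕ.* x i) ≡ᵇ n) (box r n))

{-# OPTIONS --safe #-}

-- Put q = e^z. The entry in row α and column (m , v) is, up to the factor -D (α-1)!, the coefficient of
-- z^{α-1} in the Laurent series ∂ᵐ(e^{vz}/(1 - e^{Dz})), which is the image of the rational function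
-- ϑᵐ(q^v/(1 - q^D)) = Σ n^m q^n  (sum over n ≡ v mod D, n ≥ 1; ϑ = q d/dq).
--
-- A vanishing combination of the columns over all large α is thus a quasi-polynomial whose generating
-- function F(q) becomes, after a few derivations, a Laurent series in z without regular part. Clearing
-- denominators and comparing coefficients of the linearly independent zʲe^{kz} gives F = 0, so the
-- combination is trivial. Finitely many α, in a window of bounded length, suffice for this, and rows taken
-- from successive windows give a nonzero determinant.
--
-- For the linear system, Σ p_a(n) q^n = ∏ 1/(1 - q^{a_i}) is an identity of rational functions in q; its
-- right-hand side at q = e^z is (-1)^r z^{-r} Σ B_j(a) zʲ/j!.

module Submission where

open import Defs
open import Algebra using (CommutativeRing)
import Algebra.Solver.Ring
open import Algebra.Solver.Ring.AlmostCommutativeRing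
  using (fromCommutativeRing; _-Raw-AlmostCommutative⟶_)
open import Data.Bool using (Bool; true; false)
open import Data.Empty using (⊥-elim)
open import Data.Fin using (Fin; toℕ; _↑ˡ_; _↑ʳ_; combine; remQuot; punchIn; inject₁)
open import Data.Fin as Fin using ()
import Data.Fin.Properties as Finₚ
open import Data.Integer as ℤ using () renaming (+_ to pos)
import Data.Integer.Properties as ℤₚ
open import Data.List using (List; []; _∷_; _++_; map; length; filterᵇ; cartesianProductWith; applyUpTo)
open import Data.Maybe as Maybe using (Maybe)
open import Data.Nat as ℕ using (ℕ; zero; suc; _≤_; _<_; _!; _≡ᵇ_; z≤n; s≤s)
open import Data.Nat.DivMod using (_divMod_; result)
open import Data.Nat.Divisibility using (_∣_)
open import Data.Nat.Primality using (Prime; prime⇒nonZero)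
import Data.Nat.Properties as ℕₚ
open import Data.Product using (Σ-syntax; _×_; _,_; proj₁; proj₂)
open import Data.Rational as ℚ using (ℚ; 0ℚ; 1ℚ; _+_; _*_; -_; ≢-nonZero)
open import Data.Rational.Properties as ℚₚ using (_≟_)
open import Data.Rational.Solver using (module +-*-Solver)
import Data.Rational.Unnormalised as ℚᵘ
import Data.Rational.Unnormalised.Properties as ℚᵘₚ
open import Data.Sum using (_⊎_; inj₁; inj₂)
import Data.Vec.Functional as Vector
open import Level using (0ℓ)
open import Relation.Binary using (IsEquivalence)
open import Relation.Binary.PropositionalEquality
  using (_≡_; _≢_; refl; sym; trans; cong; cong₂; subst; module ≡-Reasoning)
open import Relation.Nullary using (yes; no)
open import Relation.Nullary.Decidable using (dec⇒maybe; ¬?; decidable-stable)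

open +-*-Solver using (_:+_; _:*_; :-_; _:=_; con; solve)

-- A power series in q cannot be evaluated at q = e^z; only polynomials can. Quotients are therefore
-- carried as numerator over denominator, `⟿` transports the polynomials, and denominators are
-- cancelled on either side, which works in z because 1 - e^{Dz} is -z times a unit. A Laurent
-- series is stored multiplied by a power of z that clears its pole. An entry depends on α and m
-- only through α + m. Ignoring the rows α ≤ A thus amounts to replacing m by m + A: the A extra
-- derivations kill the unknown coefficients of z^0, ..., z^(A-1), and in q they cost only a factor
-- n^A. The length of a window is known before the combination is: an exponential polynomial with N
-- frequencies and coefficients of degree at most M is zero once its first N (M + 1) Taylor
-- coefficients are. So a row that keeps the determinant nonzero is found by bounded search. The
-- columns v = 1, ..., D produce exponents n ≥ 1 only, and p_a(0) = 1 is left over. This 1 affects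
-- the coefficient of z^0 alone, that is α = 1, which α ≥ 2 avoids.

-- Division in ℚ, the embedding of ℕ, and powers

÷₀-cancel : ∀ p {q} → q ≢ 0ℚ → (p ÷₀ q) * q ≡ p
÷₀-cancel p {q} q≢0 with q ≟ 0ℚ
... | yes q≡0 = ⊥-elim (q≢0 q≡0)
... | no q≢0′ = trans (ℚₚ.*-assoc p _ q)
  (trans (cong (p *_) (ℚₚ.*-inverseˡ q {{≢-nonZero q≢0′}})) (ℚₚ.*-identityʳ p))

*-cancelˡ : ∀ {c p q} → c ≢ 0ℚ → c * p ≡ c * q → p ≡ q
*-cancelˡ {c} {p} {q} c≢0 eq = begin
  p                    ≡⟨ expand p ⟩
  (1ℚ ÷₀ c) * (c * p)  ≡⟨ cong ((1ℚ ÷₀ c) *_) eq ⟩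
  (1ℚ ÷₀ c) * (c * q)  ≡⟨ expand q ⟨
  q                    ∎
  where
  open ≡-Reasoning
  expand : ∀ x → x ≡ (1ℚ ÷₀ c) * (c * x)
  expand x = trans (sym (ℚₚ.*-identityˡ x))
    (trans (cong (_* x) (sym (÷₀-cancel 1ℚ c≢0))) (ℚₚ.*-assoc (1ℚ ÷₀ c) c x))

*-zero-cancelˡ : ∀ {c p} → c ≢ 0ℚ → c * p ≡ 0ℚ → p ≡ 0ℚ
*-zero-cancelˡ {c} c≢0 eq = *-cancelˡ c≢0 (trans eq (sym (ℚₚ.*-zeroʳ c)))

*-≢0 : ∀ {p q} → p ≢ 0ℚ → q ≢ 0ℚ → p * q ≢ 0ℚ
*-≢0 p≢0 q≢0 eq = q≢0 (*-zero-cancelˡ p≢0 eq)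

÷₀-unique : ∀ {p q x} → q ≢ 0ℚ → x * q ≡ p → x ≡ p ÷₀ q
÷₀-unique {p} {q} {x} q≢0 eq = *-cancelˡ q≢0
  (trans (ℚₚ.*-comm q x) (trans eq (trans (sym (÷₀-cancel p q≢0)) (ℚₚ.*-comm _ q))))

-- `ℕ→ℚ` normalises its fraction and is stuck on a variable; the identity is checked on unnormalised
-- rationals and reflected back.
ℕ→ℚ-+ : ∀ m n → ℕ→ℚ (m ℕ.+ n) ≡ ℕ→ℚ m + ℕ→ℚ n
ℕ→ℚ-+ m n = ℚₚ.toℚᵘ-injective (begin
  ℚ.toℚᵘ (ℕ→ℚ (m ℕ.+ n))                ≈⟨ ℚₚ.toℚᵘ-fromℚᵘ (ℚᵘ.mkℚᵘ (pos (m ℕ.+ n)) 0) ⟩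
  ℚᵘ.mkℚᵘ (pos (m ℕ.+ n)) 0               ≈⟨ ℚᵘ.*≡* (cong (ℤ._* pos 1) (sym (cong₂ ℤ._+_ (ℤₚ.*-identityʳ (pos m)) (ℤₚ.*-identityʳ (pos n))))) ⟩
  ℚᵘ.mkℚᵘ (pos m) 0 ℚᵘ.+ ℚᵘ.mkℚᵘ (pos n) 0  ≈⟨ ℚᵘₚ.+-cong (ℚₚ.toℚᵘ-fromℚᵘ (ℚᵘ.mkℚᵘ (pos m) 0)) (ℚₚ.toℚᵘ-fromℚᵘ (ℚᵘ.mkℚᵘ (pos n) 0)) ⟨
  ℚ.toℚᵘ (ℕ→ℚ m) ℚᵘ.+ ℚ.toℚᵘ (ℕ→ℚ n)    ≈⟨ ℚₚ.toℚᵘ-homo-+ (ℕ→ℚ m) (ℕ→ℚ n) ⟨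
  ℚ.toℚᵘ (ℕ→ℚ m + ℕ→ℚ n)                ∎)
  where open ℚᵘₚ.≃-Reasoning

ℕ→ℚ-suc : ∀ n → ℕ→ℚ (suc n) ≡ 1ℚ + ℕ→ℚ n
ℕ→ℚ-suc n = ℕ→ℚ-+ 1 n

ℕ→ℚ-* : ∀ m n → ℕ→ℚ (m ℕ.* n) ≡ ℕ→ℚ m * ℕ→ℚ n
ℕ→ℚ-* zero n = sym (ℚₚ.*-zeroˡ (ℕ→ℚ n))
ℕ→ℚ-* (suc m) n = begin
  ℕ→ℚ (n ℕ.+ m ℕ.* n)      ≡⟨ ℕ→ℚ-+ n (m ℕ.* n) ⟩
  ℕ→ℚ n + ℕ→ℚ (m ℕ.* n)    ≡⟨ cong (_+_ (ℕ→ℚ n)) (ℕ→ℚ-* m n) ⟩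
  ℕ→ℚ n + ℕ→ℚ m * ℕ→ℚ n    ≡⟨ solve 2 (λ a b → b :+ a :* b := (con 1ℚ :+ a) :* b) refl (ℕ→ℚ m) (ℕ→ℚ n) ⟩
  (1ℚ + ℕ→ℚ m) * ℕ→ℚ n     ≡⟨ cong (_* ℕ→ℚ n) (ℕ→ℚ-suc m) ⟨
  ℕ→ℚ (suc m) * ℕ→ℚ n      ∎
  where open ≡-Reasoning

ℕ→ℚ-injective : ∀ {m n} → ℕ→ℚ m ≡ ℕ→ℚ n → m ≡ n
ℕ→ℚ-injective {m} {n} eq = ℤₚ.+-injective (begin
  pos m                      ≡⟨ ℤₚ.*-identityʳ (pos m) ⟨
  pos m ℤ.* pos 1   ≡⟨ ℚᵘₚ.drop-*≡* (ℚₚ.fromℚᵘ-injective {ℚᵘ.mkℚᵘ (pos m) 0} {ℚᵘ.mkℚᵘ (pos n) 0} eq) ⟩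
  pos n ℤ.* pos 1   ≡⟨ ℤₚ.*-identityʳ (pos n) ⟩
  pos n                      ∎)
  where open ≡-Reasoning

ℕ→ℚ-suc≢0 : ∀ n → ℕ→ℚ (suc n) ≢ 0ℚ
ℕ→ℚ-suc≢0 n eq with ℕ→ℚ-injective {suc n} {0} eq
... | ()

ℕ→ℚ≢0 : ∀ {n} → 1 ≤ n → ℕ→ℚ n ≢ 0ℚ
ℕ→ℚ≢0 {suc n} _ = ℕ→ℚ-suc≢0 n

!≢0 : ∀ n → ℕ→ℚ (n !) ≢ 0ℚ
!≢0 n = ℕ→ℚ≢0 (ℕₚ.1≤n! n)

ℕ→ℚ-difference≢0 : ∀ {m n} → m ≢ n → ℕ→ℚ m + - ℕ→ℚ n ≢ 0ℚ
ℕ→ℚ-difference≢0 {m} {n} m≢n eq = m≢n (ℕ→ℚ-injective (begin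
  ℕ→ℚ m                      ≡⟨ solve 2 (λ a b → a := (a :+ :- b) :+ b) refl (ℕ→ℚ m) (ℕ→ℚ n) ⟩
  (ℕ→ℚ m + - ℕ→ℚ n) + ℕ→ℚ n  ≡⟨ cong (_+ ℕ→ℚ n) eq ⟩
  0ℚ + ℕ→ℚ n                 ≡⟨ ℚₚ.+-identityˡ _ ⟩
  ℕ→ℚ n                      ∎))
  where open ≡-Reasoning

^-+ : ∀ x m n → x ^ (m ℕ.+ n) ≡ (x ^ m) * (x ^ n)
^-+ x zero n = sym (ℚₚ.*-identityˡ _)
^-+ x (suc m) n = trans (cong (x *_) (^-+ x m n)) (sym (ℚₚ.*-assoc x _ _))

^-* : ∀ x y n → (x * y) ^ n ≡ (x ^ n) * (y ^ n)
^-* x y zero = refl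
^-* x y (suc n) = trans (cong (x * y *_) (^-* x y n))
  (solve 4 (λ a b c d → a :* b :* (c :* d) := a :* c :* (b :* d)) refl x y (x ^ n) (y ^ n))

^-≢0 : ∀ {x} n → x ≢ 0ℚ → x ^ n ≢ 0ℚ
^-≢0 zero x≢0 ()
^-≢0 (suc n) x≢0 = *-≢0 x≢0 (^-≢0 n x≢0)

-- Finite sums

Σ-cong : ∀ n {f g : Fin n → ℚ} → (∀ i → f i ≡ g i) → Σ n f ≡ Σ n g
Σ-cong zero eq = refl
Σ-cong (suc n) eq = cong₂ _+_ (eq Fin.zero) (Σ-cong n (λ i → eq (Fin.suc i)))

Σ-zero : ∀ n {f : Fin n → ℚ} → (∀ i → f i ≡ 0ℚ) → Σ n f ≡ 0ℚ
Σ-zero zero eq = refl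
Σ-zero (suc n) eq = cong₂ _+_ (eq Fin.zero) (Σ-zero n (λ i → eq (Fin.suc i)))

Σ-+ : ∀ n (f g : Fin n → ℚ) → Σ n (λ i → f i + g i) ≡ Σ n f + Σ n g
Σ-+ zero f g = refl
Σ-+ (suc n) f g = trans
  (cong (_+_ (f Fin.zero + g Fin.zero)) (Σ-+ n (λ i → f (Fin.suc i)) (λ i → g (Fin.suc i))))
  (solve 4 (λ a b c d → (a :+ b) :+ (c :+ d) := (a :+ c) :+ (b :+ d)) refl
    (f Fin.zero) (g Fin.zero) _ _)

Σ-*ˡ : ∀ n c (f : Fin n → ℚ) → Σ n (λ i → c * f i) ≡ c * Σ n f
Σ-*ˡ zero c f = sym (ℚₚ.*-zeroʳ c)
Σ-*ˡ (suc n) c f = trans (cong (_+_ (c * f Fin.zero)) (Σ-*ˡ n c (λ i → f (Fin.suc i))))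
  (sym (ℚₚ.*-distribˡ-+ c _ _))

-- The commutative ring of power series

infix 4 _≈_
infixl 6 _⊕_
infixr 8 _·_

_≈_ : PS → PS → Set
f ≈ g = ∀ n → f n ≡ g n

_⊕_ : PS → PS → PS
(f ⊕ g) n = f n + g n

⊖_ : PS → PS
(⊖ f) n = - f n

_·_ : ℚ → PS → PS
(c · f) n = c * f n

constant : ℚ → PS
constant c zero = c
constant c (suc n) = 0ℚ

0# 1# : PS
0# n = 0ℚ
1# = constant 1ℚ

-- By computation `(f ⊛ g) (suc n)` is `f 0 * g (suc n) + (tail f ⊛ g) n`. The inductions on
-- coefficients below rest on this unfolding and therefore let f vary.
tail : PS → PS
tail f n = f (suc n)

-- The n-th coefficient of a product sees only coefficients of index at most n. Truncated series and
-- finite boxes call for this bounded form.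
⊛-cong-≤ : ∀ {f f′ g g′} n → (∀ k → k ≤ n → f k ≡ f′ k) → (∀ k → k ≤ n → g k ≡ g′ k) →
  (f ⊛ g) n ≡ (f′ ⊛ g′) n
⊛-cong-≤ zero ef eg = cong₂ (λ a b → a * b + 0ℚ) (ef 0 z≤n) (eg 0 z≤n)
⊛-cong-≤ (suc n) ef eg = cong₂ _+_ (cong₂ _*_ (ef 0 z≤n) (eg (suc n) ℕₚ.≤-refl))
  (⊛-cong-≤ n (λ k k≤n → ef (suc k) (s≤s k≤n)) (λ k k≤n → eg k (ℕₚ.m≤n⇒m≤1+n k≤n)))

⊛-cong : ∀ {f f′ g g′} → f ≈ f′ → g ≈ g′ → f ⊛ g ≈ f′ ⊛ g′
⊛-cong ef eg n = ⊛-cong-≤ n (λ k _ → ef k) (λ k _ → eg k)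

⊛-congˡ : ∀ f {g g′} → g ≈ g′ → f ⊛ g ≈ f ⊛ g′
⊛-congˡ f = ⊛-cong {f} (λ _ → refl)

⊛-congʳ : ∀ g {f f′} → f ≈ f′ → f ⊛ g ≈ f′ ⊛ g
⊛-congʳ g eq = ⊛-cong {g = g} eq (λ _ → refl)

⊕-congˡ : ∀ f {g g′} → g ≈ g′ → f ⊕ g ≈ f ⊕ g′
⊕-congˡ f eq n = cong (f n +_) (eq n)

⊕-congʳ : ∀ g {f f′} → f ≈ f′ → f ⊕ g ≈ f′ ⊕ g
⊕-congʳ g eq n = cong (_+ g n) (eq n)

⊛-distribʳ-⊕ : ∀ h f g → (f ⊕ g) ⊛ h ≈ (f ⊛ h) ⊕ (g ⊛ h)
⊛-distribʳ-⊕ h f g zero = solve 3 (λ a b c → (a :+ b) :* c :+ con 0ℚ := (a :* c :+ con 0ℚ) :+ (b :* c :+ con 0ℚ)) refl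
  (f 0) (g 0) (h 0)
⊛-distribʳ-⊕ h f g (suc n) = trans
  (cong (_+_ ((f 0 + g 0) * h (suc n))) (⊛-distribʳ-⊕ h (tail f) (tail g) n))
  (solve 5 (λ a b c d e → (a :+ b) :* c :+ (d :+ e) := (a :* c :+ d) :+ (b :* c :+ e)) refl
    (f 0) (g 0) (h (suc n)) _ _)

·-⊛ : ∀ c f g → (c · f) ⊛ g ≈ c · (f ⊛ g)
·-⊛ c f g zero = solve 3 (λ a b c → a :* b :* c :+ con 0ℚ := a :* (b :* c :+ con 0ℚ)) refl c (f 0) (g 0)
·-⊛ c f g (suc n) = trans (cong (_+_ (c * f 0 * g (suc n))) (·-⊛ c (tail f) g n))
  (solve 4 (λ a b c d → a :* b :* c :+ a :* d := a :* (b :* c :+ d)) refl c (f 0) (g (suc n)) _)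

⊛-zeroˡ : ∀ f → 0# ⊛ f ≈ 0#
⊛-zeroˡ f n = Σ-zero (suc n) (λ i → ℚₚ.*-zeroˡ (f (n ℕ.∸ toℕ i)))

-- The same unfolding at the other factor; commutativity is the agreement of the two.
⊛-suc : ∀ f g n → (f ⊛ g) (suc n) ≡ f (suc n) * g 0 + (f ⊛ tail g) n
⊛-suc f g zero = solve 4 (λ a b c d → a :* d :+ (b :* c :+ con 0ℚ) := b :* c :+ (a :* d :+ con 0ℚ)) refl (f 0) (f 1) (g 0) (g 1)
⊛-suc f g (suc n) = trans (cong (_+_ (f 0 * g (suc (suc n)))) (⊛-suc (tail f) g n))
  (solve 3 (λ a b c → a :+ (b :+ c) := b :+ (a :+ c)) refl
    (f 0 * g (suc (suc n))) (f (suc (suc n)) * g 0) ((tail f ⊛ tail g) n))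

⊛-comm : ∀ f g → f ⊛ g ≈ g ⊛ f
⊛-comm f g zero = cong (_+ 0ℚ) (ℚₚ.*-comm (f 0) (g 0))
⊛-comm f g (suc n) = trans (cong₂ _+_ (ℚₚ.*-comm (f 0) (g (suc n))) (⊛-comm (tail f) g n))
  (sym (⊛-suc g f n))

⊛-zeroʳ : ∀ f → f ⊛ 0# ≈ 0#
⊛-zeroʳ f n = trans (⊛-comm f 0# n) (⊛-zeroˡ f n)

⊛-assoc : ∀ f g h → (f ⊛ g) ⊛ h ≈ f ⊛ (g ⊛ h)
⊛-assoc f g h zero = solve 3 (λ a b c → (a :* b :+ con 0ℚ) :* c :+ con 0ℚ := a :* (b :* c :+ con 0ℚ) :+ con 0ℚ) refl (f 0) (g 0) (h 0)
⊛-assoc f g h (suc n) = begin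
  -- `tail (f ⊛ g)` computes to `(f 0 · tail g) ⊕ (tail f ⊛ g)`.
  (f ⊛ g) 0 * h (suc n) + (((f 0 · tail g) ⊕ (tail f ⊛ g)) ⊛ h) n
    ≡⟨ cong (_+_ ((f ⊛ g) 0 * h (suc n))) (⊛-distribʳ-⊕ h (f 0 · tail g) (tail f ⊛ g) n) ⟩
  (f ⊛ g) 0 * h (suc n) + (((f 0 · tail g) ⊛ h) n + ((tail f ⊛ g) ⊛ h) n)
    ≡⟨ cong (_+_ ((f ⊛ g) 0 * h (suc n))) (cong₂ _+_ (·-⊛ (f 0) (tail g) h n) (⊛-assoc (tail f) g h n)) ⟩
  (f ⊛ g) 0 * h (suc n) + (f 0 * (tail g ⊛ h) n + (tail f ⊛ (g ⊛ h)) n)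
    ≡⟨ solve 5 (λ a b c d e → (a :* b :+ con 0ℚ) :* c :+ (a :* d :+ e) := a :* (b :* c :+ d) :+ e) refl
         (f 0) (g 0) (h (suc n)) _ _ ⟩
  f 0 * (g ⊛ h) (suc n) + (tail f ⊛ (g ⊛ h)) n ∎
  where open ≡-Reasoning

constant-⊛ : ∀ c f → constant c ⊛ f ≈ c · f
constant-⊛ c f zero = ℚₚ.+-identityʳ _
constant-⊛ c f (suc n) = trans (cong (_+_ (c * f (suc n))) (⊛-zeroˡ f n)) (ℚₚ.+-identityʳ _)

⊛-identityˡ : ∀ f → 1# ⊛ f ≈ f
⊛-identityˡ f n = trans (constant-⊛ 1ℚ f n) (ℚₚ.*-identityˡ _)

≈-isEquivalence : IsEquivalence _≈_
≈-isEquivalence = record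
  { refl = λ n → refl ; sym = λ e n → sym (e n) ; trans = λ e e′ n → trans (e n) (e′ n) }

PS-commutativeRing : CommutativeRing 0ℓ 0ℓ
PS-commutativeRing = record
  { Carrier = PS ; _≈_ = _≈_ ; _+_ = _⊕_ ; _*_ = _⊛_ ; -_ = ⊖_ ; 0# = 0# ; 1# = 1#
  ; isCommutativeRing = record
    { isRing = record
      { +-isAbelianGroup = record
        { isGroup = record
          { isMonoid = record
            { isSemigroup = record
              { isMagma = record
                { isEquivalence = ≈-isEquivalence
                ; ∙-cong = λ e e′ n → cong₂ _+_ (e n) (e′ n) }
              ; assoc = λ f g h n → ℚₚ.+-assoc (f n) (g n) (h n) }
            ; identity = (λ f n → ℚₚ.+-identityˡ (f n)) , (λ f n → ℚₚ.+-identityʳ (f n)) }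
          ; inverse = (λ f n → ℚₚ.+-inverseˡ (f n)) , (λ f n → ℚₚ.+-inverseʳ (f n))
          ; ⁻¹-cong = λ e n → cong -_ (e n) }
        ; comm = λ f g n → ℚₚ.+-comm (f n) (g n) }
      ; *-cong = ⊛-cong
      ; *-assoc = ⊛-assoc
      ; *-identity = ⊛-identityˡ , (λ f n → trans (⊛-comm f 1# n) (⊛-identityˡ f n))
      ; distrib = (λ f g h n → trans (⊛-comm f (g ⊕ h) n)
                    (trans (⊛-distribʳ-⊕ f g h n) (cong₂ _+_ (⊛-comm g f n) (⊛-comm h f n))))
                , ⊛-distribʳ-⊕ }
    ; *-comm = ⊛-comm } }

open CommutativeRing PS-commutativeRing
  using (setoid) renaming (refl to ≈-refl; sym to ≈-sym; trans to ≈-trans; +-cong to ⊕-cong; -‿cong to ⊖-cong)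

constant-⊛-constant : ∀ c d → constant (c * d) ≈ constant c ⊛ constant d
constant-⊛-constant c d zero = sym (ℚₚ.+-identityʳ _)
constant-⊛-constant c d (suc n) = sym (trans (constant-⊛ c (constant d) (suc n)) (ℚₚ.*-zeroʳ c))

constant-homomorphism : CommutativeRing.rawRing ℚₚ.+-*-commutativeRing
  -Raw-AlmostCommutative⟶ fromCommutativeRing PS-commutativeRing
constant-homomorphism = record
  { ⟦_⟧ = constant
  ; +-homo = λ { c d zero → refl ; c d (suc n) → refl }
  ; *-homo = constant-⊛-constant
  ; -‿homo = λ { c zero → refl ; c (suc n) → refl }
  ; 0-homo = λ { zero → refl ; (suc n) → refl }
  ; 1-homo = λ n → refl }

constant-cong : ∀ {c d} → c ≡ d → constant c ≈ constant d
constant-cong eq n = cong (λ c → constant c n) eq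

-- Equality of series is not decidable, but the solver only has to compare coefficients. Taking
-- these from ℚ makes rational literals available in ring equations.
constant-≟ : ∀ c d → Maybe (constant c ≈ constant d)
constant-≟ c d = Maybe.map constant-cong (dec⇒maybe (c ≟ d))

module PSSolver = Algebra.Solver.Ring (CommutativeRing.rawRing ℚₚ.+-*-commutativeRing)
  (fromCommutativeRing PS-commutativeRing) constant-homomorphism constant-≟

open PSSolver using () renaming (solve to solveₚ; _:=_ to _:=ₚ_; _:+_ to _:+ₚ_; _:*_ to _:*ₚ_; :-_ to :-ₚ_; con to conₚ)

-- The multiplicative inverse

convolution : PS → ℕ → List ℚ → ℚ
convolution f k [] = 0ℚ
convolution f k (g ∷ gs) = f k * g + convolution f (suc k) gs

-- The underscore is the function conv, which Defs keeps private: it is found by unification in inv-suc.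
conv≡convolution : ∀ f k gs → _ ≡ convolution f k gs
inv-suc : ∀ f n → inv f (suc n) ≡ - ((1ℚ ÷₀ f 0) * convolution f 1 (invRev f n))
inv-suc f n with 1ℚ ÷₀ f 0
... | c with 1 | invRev f n
... | k | gs = cong (λ t → - (c * t)) (conv≡convolution f k gs)
conv≡convolution f k [] = refl
conv≡convolution f k (g ∷ gs) = cong (_+_ (f k * g)) (conv≡convolution f (suc k) gs)

-- `invRev f n` lists the inverse backwards, so pairing it with f, shifted by k, is a Cauchy
-- product. The offset k varies because `convolution` raises it at each step.
convolution-invRev : ∀ f k n → convolution f k (invRev f n) ≡ ((λ i → f (k ℕ.+ i)) ⊛ inv f) n
convolution-invRev f k zero = cong (λ j → f j * inv f 0 + 0ℚ) (sym (ℕₚ.+-identityʳ k))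
convolution-invRev f k (suc n) = cong₂ _+_ (cong (λ j → f j * inv f (suc n)) (sym (ℕₚ.+-identityʳ k)))
  (trans (convolution-invRev f (suc k) n)
         (⊛-cong {g = inv f} (λ i → cong f (sym (ℕₚ.+-suc k i))) (λ i → refl) n))

⊛-inverseʳ : ∀ {f} → f 0 ≢ 0ℚ → f ⊛ inv f ≈ 1#
⊛-inverseʳ {f} f0≢0 zero = trans (ℚₚ.+-identityʳ _) (trans (ℚₚ.*-comm (f 0) _) (÷₀-cancel 1ℚ f0≢0))
⊛-inverseʳ {f} f0≢0 (suc n) = begin
  f 0 * inv f (suc n) + t            ≡⟨ cong (λ x → f 0 * x + t) (trans (inv-suc f n) (cong (λ x → - (c * x)) (convolution-invRev f 1 n))) ⟩
  f 0 * - (c * t) + t                ≡⟨ solve 3 (λ a c t → a :* (:- (c :* t)) :+ t := (:- (c :* a)) :* t :+ t) refl (f 0) c t ⟩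
  (- (c * f 0)) * t + t              ≡⟨ cong (λ x → (- x) * t + t) (÷₀-cancel 1ℚ f0≢0) ⟩
  (- 1ℚ) * t + t                     ≡⟨ solve 1 (λ t → (:- con 1ℚ) :* t :+ t := con 0ℚ) refl t ⟩
  0ℚ                                 ∎
  where
  open ≡-Reasoning
  c = 1ℚ ÷₀ f 0
  t = (tail f ⊛ inv f) n

-- Derivations

ϑ : PS → PS
ϑ f n = ℕ→ℚ n * f n

∂ : PS → PS
∂ f n = ℕ→ℚ (suc n) * f (suc n)

ϑ-cong : ∀ {f g} → f ≈ g → ϑ f ≈ ϑ g
ϑ-cong eq n = cong (ℕ→ℚ n *_) (eq n)

∂-cong : ∀ {f g} → f ≈ g → ∂ f ≈ ∂ g
∂-cong eq n = cong (ℕ→ℚ (suc n) *_) (eq (suc n))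

ϑ-⊕ : ∀ f g → ϑ (f ⊕ g) ≈ ϑ f ⊕ ϑ g
ϑ-⊕ f g n = ℚₚ.*-distribˡ-+ (ℕ→ℚ n) (f n) (g n)

∂-⊕ : ∀ f g → ∂ (f ⊕ g) ≈ ∂ f ⊕ ∂ g
∂-⊕ f g n = ℚₚ.*-distribˡ-+ (ℕ→ℚ (suc n)) (f (suc n)) (g (suc n))

tail-ϑ : ∀ f → tail (ϑ f) ≈ ϑ (tail f) ⊕ tail f
tail-ϑ f n = trans (cong (_* f (suc n)) (ℕ→ℚ-suc n))
  (solve 2 (λ a b → (con 1ℚ :+ a) :* b := a :* b :+ b) refl (ℕ→ℚ n) (f (suc n)))

ϑ-⊛ : ∀ f g → ϑ (f ⊛ g) ≈ (ϑ f ⊛ g) ⊕ (f ⊛ ϑ g)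
ϑ-⊛ f g zero = solve 2 (λ a b → con 0ℚ :* (a :* b :+ con 0ℚ) := (con 0ℚ :* a :* b :+ con 0ℚ) :+ (a :* (con 0ℚ :* b) :+ con 0ℚ)) refl (f 0) (g 0)
ϑ-⊛ f g (suc n) = begin
  N * (f 0 * g (suc n) + (tail f ⊛ g) n)
    ≡⟨ cong (_* (f 0 * g (suc n) + (tail f ⊛ g) n)) (ℕ→ℚ-suc n) ⟩
  (1ℚ + ℕ→ℚ n) * (f 0 * g (suc n) + (tail f ⊛ g) n)
    ≡⟨ solve 4 (λ k a b t → (con 1ℚ :+ k) :* (a :* b :+ t) := con 0ℚ :* a :* b :+ (t :+ (a :* ((con 1ℚ :+ k) :* b) :+ k :* t))) refl (ℕ→ℚ n) (f 0) (g (suc n)) _ ⟩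
  0ℚ * f 0 * g (suc n) + ((tail f ⊛ g) n + (f 0 * ((1ℚ + ℕ→ℚ n) * g (suc n)) + ℕ→ℚ n * (tail f ⊛ g) n))
    ≡⟨ cong₂ (λ x y → 0ℚ * f 0 * g (suc n) + ((tail f ⊛ g) n + (f 0 * (x * g (suc n)) + y))) (sym (ℕ→ℚ-suc n)) (ϑ-⊛ (tail f) g n) ⟩
  0ℚ * f 0 * g (suc n) + ((tail f ⊛ g) n + (f 0 * (N * g (suc n)) + ((ϑ (tail f) ⊛ g) n + (tail f ⊛ ϑ g) n)))
    ≡⟨ solve 5 (λ z t a u v → z :+ (t :+ (a :+ (u :+ v))) := (z :+ (u :+ t)) :+ (a :+ v)) refl
         (0ℚ * f 0 * g (suc n)) ((tail f ⊛ g) n) (f 0 * (N * g (suc n))) ((ϑ (tail f) ⊛ g) n) ((tail f ⊛ ϑ g) n) ⟩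
  0ℚ * f 0 * g (suc n) + ((ϑ (tail f) ⊛ g) n + (tail f ⊛ g) n) + (f ⊛ ϑ g) (suc n)
    ≡⟨ cong (λ x → 0ℚ * f 0 * g (suc n) + x + (f ⊛ ϑ g) (suc n))
         (trans (⊛-cong {g = g} (tail-ϑ f) (λ _ → refl) n) (⊛-distribʳ-⊕ g (ϑ (tail f)) (tail f) n)) ⟨
  (ϑ f ⊛ g) (suc n) + (f ⊛ ϑ g) (suc n) ∎
  where
  open ≡-Reasoning
  N = ℕ→ℚ (suc n)

ϑ-constant : ∀ c → ϑ (constant c) ≈ 0#
ϑ-constant c zero = ℚₚ.*-zeroˡ c
ϑ-constant c (suc n) = ℚₚ.*-zeroʳ (ℕ→ℚ (suc n))

X : PS
X zero = 0ℚ
X (suc n) = 1# n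

X-⊛-zero : ∀ f → (X ⊛ f) 0 ≡ 0ℚ
X-⊛-zero f = trans (ℚₚ.+-identityʳ _) (ℚₚ.*-zeroˡ (f 0))

X-⊛-suc : ∀ f n → (X ⊛ f) (suc n) ≡ f n
X-⊛-suc f n = trans (cong₂ _+_ (ℚₚ.*-zeroˡ (f (suc n))) (⊛-identityˡ f n)) (ℚₚ.+-identityˡ (f n))

X-⊛-cancel : ∀ {f g} → X ⊛ f ≈ X ⊛ g → f ≈ g
X-⊛-cancel {f} {g} eq n = trans (sym (X-⊛-suc f n)) (trans (eq (suc n)) (X-⊛-suc g n))

ϑX : ϑ X ≈ X
ϑX zero = refl
ϑX (suc zero) = refl
ϑX (suc (suc n)) = ℚₚ.*-zeroʳ (ℕ→ℚ (suc (suc n)))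

ϑ≈X⊛∂ : ∀ f → ϑ f ≈ X ⊛ ∂ f
ϑ≈X⊛∂ f zero = trans (ℚₚ.*-zeroˡ (f 0)) (sym (X-⊛-zero (∂ f)))
ϑ≈X⊛∂ f (suc n) = sym (X-⊛-suc (∂ f) n)

-- Transported from `ϑ-⊛` along ϑ = X ∂; since ϑ keeps the index of a coefficient, its Leibniz rule
-- is the one that suits the induction.
∂-⊛ : ∀ f g → ∂ (f ⊛ g) ≈ (∂ f ⊛ g) ⊕ (f ⊛ ∂ g)
∂-⊛ f g = X-⊛-cancel (begin
  X ⊛ ∂ (f ⊛ g)                         ≈⟨ ϑ≈X⊛∂ (f ⊛ g) ⟨
  ϑ (f ⊛ g)                             ≈⟨ ϑ-⊛ f g ⟩
  (ϑ f ⊛ g) ⊕ (f ⊛ ϑ g)                 ≈⟨ ⊕-cong (⊛-cong {g = g} (ϑ≈X⊛∂ f) (≈-refl {g})) (⊛-cong {f} (≈-refl {f}) (ϑ≈X⊛∂ g)) ⟩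
  ((X ⊛ ∂ f) ⊛ g) ⊕ (f ⊛ (X ⊛ ∂ g))     ≈⟨ solveₚ 5 (λ x f g a b → ((x :*ₚ a) :*ₚ g) :+ₚ (f :*ₚ (x :*ₚ b)) :=ₚ x :*ₚ ((a :*ₚ g) :+ₚ (f :*ₚ b))) (λ _ → refl) X f g (∂ f) (∂ g) ⟩
  X ⊛ ((∂ f ⊛ g) ⊕ (f ⊛ ∂ g))           ∎)
  where open import Relation.Binary.Reasoning.Setoid setoid

-- The exponential series

expS-suc : ∀ x n → ℕ→ℚ (suc n) * expS x (suc n) ≡ x * expS x n
expS-suc x n = *-cancelˡ (!≢0 n) (begin
  ℕ→ℚ (n !) * (ℕ→ℚ (suc n) * expS x (suc n))   ≡⟨ solve 3 (λ a b c → a :* (b :* c) := c :* (b :* a)) refl (ℕ→ℚ (n !)) (ℕ→ℚ (suc n)) (expS x (suc n)) ⟩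
  expS x (suc n) * (ℕ→ℚ (suc n) * ℕ→ℚ (n !))   ≡⟨ cong (expS x (suc n) *_) (ℕ→ℚ-* (suc n) (n !)) ⟨
  expS x (suc n) * ℕ→ℚ (suc n !)               ≡⟨ ÷₀-cancel (x ^ suc n) (!≢0 (suc n)) ⟩
  x * (x ^ n)                                  ≡⟨ cong (x *_) (÷₀-cancel (x ^ n) (!≢0 n)) ⟨
  x * (expS x n * ℕ→ℚ (n !))                   ≡⟨ solve 3 (λ x e a → x :* (e :* a) := a :* (x :* e)) refl x (expS x n) (ℕ→ℚ (n !)) ⟩
  ℕ→ℚ (n !) * (x * expS x n)                   ∎)
  where open ≡-Reasoning

∂-expS : ∀ x → ∂ (expS x) ≈ x · expS x
∂-expS x n = expS-suc x n

expS-unique : ∀ x f → f 0 ≡ 1ℚ → ∂ f ≈ x · f → f ≈ expS x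
expS-unique x f f0 ∂f zero = f0
expS-unique x f f0 ∂f (suc n) = *-cancelˡ (ℕ→ℚ-suc≢0 n)
  (trans (∂f n) (trans (cong (x *_) (expS-unique x f f0 ∂f n)) (sym (expS-suc x n))))

-- The product satisfies f′ = (x + y) f and has constant term 1; this takes the place of the
-- binomial theorem.
expS-+ : ∀ x y → expS x ⊛ expS y ≈ expS (x + y)
expS-+ x y = expS-unique (x + y) (expS x ⊛ expS y) refl (λ n → begin
  ∂ (e ⊛ e′) n                              ≡⟨ ∂-⊛ e e′ n ⟩
  (∂ e ⊛ e′) n + (e ⊛ ∂ e′) n               ≡⟨ cong₂ _+_ (⊛-cong {g = e′} (∂-expS x) (λ _ → refl) n) (⊛-congˡ e (∂-expS y) n) ⟩
  ((x · e) ⊛ e′) n + (e ⊛ (y · e′)) n       ≡⟨ cong₂ _+_ (·-⊛ x e e′ n) (trans (⊛-comm e (y · e′) n) (·-⊛ y e′ e n)) ⟩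
  x * (e ⊛ e′) n + y * (e′ ⊛ e) n           ≡⟨ cong (λ t → x * (e ⊛ e′) n + y * t) (⊛-comm e′ e n) ⟩
  x * (e ⊛ e′) n + y * (e ⊛ e′) n           ≡⟨ ℚₚ.*-distribʳ-+ ((e ⊛ e′) n) x y ⟨
  (x + y) * (e ⊛ e′) n                      ∎)
  where
  open ≡-Reasoning
  e = expS x
  e′ = expS y

expS-0 : expS 0ℚ ≈ 1#
expS-0 zero = refl
expS-0 (suc n) = sym (÷₀-unique (!≢0 (suc n)) (trans (ℚₚ.*-zeroˡ (ℕ→ℚ (suc n !))) (sym (ℚₚ.*-zeroˡ (0ℚ ^ n)))))

infixr 9 _^ₚ_

_^ₚ_ : PS → ℕ → PS
f ^ₚ zero = 1#
f ^ₚ suc n = f ⊛ (f ^ₚ n)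

^ₚ-+ : ∀ f m n → f ^ₚ (m ℕ.+ n) ≈ (f ^ₚ m) ⊛ (f ^ₚ n)
^ₚ-+ f zero n = ≈-sym (⊛-identityˡ (f ^ₚ n))
^ₚ-+ f (suc m) n = ≈-trans (⊛-congˡ f (^ₚ-+ f m n)) (≈-sym (⊛-assoc f (f ^ₚ m) (f ^ₚ n)))

E : PS
E = expS 1ℚ

expS-ℕ : ∀ k → expS (ℕ→ℚ k) ≈ E ^ₚ k
expS-ℕ zero = expS-0
expS-ℕ (suc k) n = begin
  expS (ℕ→ℚ (suc k)) n        ≡⟨ cong (λ x → expS x n) (ℕ→ℚ-suc k) ⟩
  expS (1ℚ + ℕ→ℚ k) n         ≡⟨ expS-+ 1ℚ (ℕ→ℚ k) n ⟨
  (E ⊛ expS (ℕ→ℚ k)) n        ≡⟨ ⊛-congˡ E (expS-ℕ k) n ⟩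
  (E ⊛ (E ^ₚ k)) n            ∎
  where open ≡-Reasoning

∂E : ∂ E ≈ E
∂E n = trans (∂-expS 1ℚ n) (ℚₚ.*-identityˡ (E n))

-- Exponential polynomials  Σ_{k<N} a_k(z) e^{kz}

expPoly : ℕ → (ℕ → PS) → PS
expPoly zero a = 0#
expPoly (suc N) a = a 0 ⊕ (E ⊛ expPoly N (λ k → a (suc k)))

-- d/dz (e^{cz} f) = e^{cz} (f′ + c f): the derivative as seen by the coefficient of e^{cz}.
∂+ : ℚ → PS → PS
∂+ c f = ∂ f ⊕ (c · f)

∂+^ : ℕ → ℚ → PS → PS
∂+^ zero c f = f
∂+^ (suc m) c f = ∂+ c (∂+^ m c f)

Vanishes : ℕ → PS → Set
Vanishes n f = ∀ i → i < n → f i ≡ 0ℚ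

Degree≤ : ℕ → PS → Set
Degree≤ d f = ∀ i → d < i → f i ≡ 0ℚ

expPoly-cong : ∀ N {a b} → (∀ k → k < N → a k ≈ b k) → expPoly N a ≈ expPoly N b
expPoly-cong zero eq = λ _ → refl
expPoly-cong (suc N) eq = ⊕-cong (eq 0 (s≤s z≤n))
  (⊛-congˡ E (expPoly-cong N (λ k k<N → eq (suc k) (s≤s k<N))))

expPoly-0 : ∀ N {a} → (∀ k → k < N → a k ≈ 0#) → expPoly N a ≈ 0#
expPoly-0 zero eq n = refl
expPoly-0 (suc N) {a} eq n = trans (cong₂ _+_ (eq 0 (s≤s z≤n) n)
  (trans (⊛-congˡ E (expPoly-0 N (λ k k<N → eq (suc k) (s≤s k<N))) n) (⊛-zeroʳ E n))) refl

expPoly-⊕ : ∀ N a b → expPoly N (λ k → a k ⊕ b k) ≈ expPoly N a ⊕ expPoly N b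
expPoly-⊕ zero a b n = refl
expPoly-⊕ (suc N) a b = ≈-trans
  (⊕-congˡ (a 0 ⊕ b 0) (⊛-congˡ E (expPoly-⊕ N (λ k → a (suc k)) (λ k → b (suc k)))))
  (solveₚ 5 (λ a b e u v → (a :+ₚ b) :+ₚ (e :*ₚ (u :+ₚ v)) :=ₚ (a :+ₚ (e :*ₚ u)) :+ₚ (b :+ₚ (e :*ₚ v))) (λ _ → refl)
    (a 0) (b 0) E (expPoly N (λ k → a (suc k))) (expPoly N (λ k → b (suc k))))

expPoly-⊛ : ∀ N p a → expPoly N (λ k → p ⊛ a k) ≈ p ⊛ expPoly N a
expPoly-⊛ zero p a = ≈-sym (⊛-zeroʳ p)
expPoly-⊛ (suc N) p a = ≈-trans
  (⊕-congˡ (p ⊛ a 0) (⊛-congˡ E (expPoly-⊛ N p (λ k → a (suc k)))))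
  (solveₚ 4 (λ p a e u → (p :*ₚ a) :+ₚ (e :*ₚ (p :*ₚ u)) :=ₚ p :*ₚ (a :+ₚ (e :*ₚ u))) (λ _ → refl)
    p (a 0) E (expPoly N (λ k → a (suc k))))

∂+-cong : ∀ {c d f g} → c ≡ d → f ≈ g → ∂+ c f ≈ ∂+ d g
∂+-cong {c} refl eq n = cong₂ _+_ (∂-cong eq n) (cong (c *_) (eq n))

·≈constant-⊛ : ∀ c f → c · f ≈ constant c ⊛ f
·≈constant-⊛ c f n = sym (constant-⊛ c f n)

-- The offset c is general because each factor `E` that is pulled out raises it by one; the
-- derivative itself is the case c = 0.
∂+-expPoly : ∀ N c a → ∂+ c (expPoly N a) ≈ expPoly N (λ k → ∂+ (c + ℕ→ℚ k) (a k))
∂+-expPoly zero c a n = solve 2 (λ k c → k :* con 0ℚ :+ c :* con 0ℚ := con 0ℚ) refl (ℕ→ℚ (suc n)) c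
∂+-expPoly (suc N) c a = begin
  ∂ (a 0 ⊕ (E ⊛ u)) ⊕ (c · (a 0 ⊕ (E ⊛ u)))
    ≈⟨ ⊕-cong (≈-trans (∂-⊕ (a 0) (E ⊛ u)) (⊕-congˡ (∂ (a 0)) (≈-trans (∂-⊛ E u) (⊕-congʳ (E ⊛ ∂ u) (⊛-congʳ u ∂E)))))
              (·≈constant-⊛ c _) ⟩
  (∂ (a 0) ⊕ ((E ⊛ u) ⊕ (E ⊛ ∂ u))) ⊕ (constant c ⊛ (a 0 ⊕ (E ⊛ u)))
    ≈⟨ solveₚ 6 (λ da a e u du c → (da :+ₚ ((e :*ₚ u) :+ₚ (e :*ₚ du))) :+ₚ (c :*ₚ (a :+ₚ (e :*ₚ u)))
         :=ₚ (da :+ₚ (c :*ₚ a)) :+ₚ (e :*ₚ (du :+ₚ ((c :+ₚ conₚ 1ℚ) :*ₚ u)))) (λ _ → refl) (∂ (a 0)) (a 0) E u (∂ u) (constant c) ⟩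
  (∂ (a 0) ⊕ (constant c ⊛ a 0)) ⊕ (E ⊛ (∂ u ⊕ ((constant c ⊕ constant 1ℚ) ⊛ u)))
    ≈⟨ ⊕-cong (⊕-congˡ (∂ (a 0)) (≈-trans (constant-⊛ c (a 0)) (λ n → cong (_* a 0 n) (sym (ℚₚ.+-identityʳ c)))))
         (⊛-congˡ E (⊕-congˡ (∂ u)
           (≈-trans (⊛-congʳ u {constant c ⊕ constant 1ℚ} {constant (c + 1ℚ)} (λ { zero → refl ; (suc n) → refl })) (constant-⊛ (c + 1ℚ) u)))) ⟩
  ∂+ (c + 0ℚ) (a 0) ⊕ (E ⊛ ∂+ (c + 1ℚ) u)
    ≈⟨ ⊕-congˡ (∂+ (c + 0ℚ) (a 0)) (⊛-congˡ E (≈-trans (∂+-expPoly N (c + 1ℚ) (λ k → a (suc k)))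
         (expPoly-cong N (λ k _ → ∂+-cong {c + 1ℚ + ℕ→ℚ k} {c + ℕ→ℚ (suc k)} {a (suc k)}
           (trans (ℚₚ.+-assoc c 1ℚ (ℕ→ℚ k)) (cong (c +_) (sym (ℕ→ℚ-suc k)))) (λ _ → refl))))) ⟩
  expPoly (suc N) (λ k → ∂+ (c + ℕ→ℚ k) (a k)) ∎
  where
  open import Relation.Binary.Reasoning.Setoid setoid
  u = expPoly N (λ k → a (suc k))

∂+^-expPoly : ∀ m N a → ∂+^ m 0ℚ (expPoly N a) ≈ expPoly N (λ k → ∂+^ m (ℕ→ℚ k) (a k))
∂+^-expPoly zero N a = λ _ → refl
∂+^-expPoly (suc m) N a = ≈-trans (∂+-cong {0ℚ} refl (∂+^-expPoly m N a))
  (≈-trans (∂+-expPoly N 0ℚ (λ k → ∂+^ m (ℕ→ℚ k) (a k)))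
    (expPoly-cong N (λ k _ → ∂+-cong {f = ∂+^ m (ℕ→ℚ k) (a k)} (ℚₚ.+-identityˡ (ℕ→ℚ k)) (λ _ → refl))))

∂+-Degree≤ : ∀ {d f} c → Degree≤ d f → Degree≤ d (∂+ c f)
∂+-Degree≤ c f≤d i d<i = trans
  (cong₂ (λ x y → ℕ→ℚ (suc i) * x + c * y) (f≤d (suc i) (ℕₚ.m<n⇒m<1+n d<i)) (f≤d i d<i))
  (solve 2 (λ k c → k :* con 0ℚ :+ c :* con 0ℚ := con 0ℚ) refl (ℕ→ℚ (suc i)) c)

∂+^-Degree≤ : ∀ m {d f} c → Degree≤ d f → Degree≤ d (∂+^ m c f)
∂+^-Degree≤ zero c f≤d = f≤d
∂+^-Degree≤ (suc m) c f≤d = ∂+-Degree≤ c (∂+^-Degree≤ m c f≤d)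

-- The equation reads c f_i = -(i + 1) f_(i+1), so zeros propagate downwards from the degree bound.
-- That bound excludes the solution exp(-cz).
∂+-injective : ∀ {d c f} → c ≢ 0ℚ → Degree≤ d f → ∂+ c f ≈ 0# → f ≈ 0#
∂+-injective {d} {c} {f} c≢0 f≤d eq n = descend (suc d) n (s≤s (ℕₚ.m≤m+n d n))
  where
  descend : ∀ t i → d < t ℕ.+ i → f i ≡ 0ℚ
  descend zero i d<i = f≤d i d<i
  descend (suc t) i d<i = *-zero-cancelˡ c≢0 (begin
    c * f i                              ≡⟨ solve 2 (λ k x → x := k :* con 0ℚ :+ x) refl (ℕ→ℚ (suc i)) (c * f i) ⟩
    ℕ→ℚ (suc i) * 0ℚ + c * f i           ≡⟨ cong (λ x → ℕ→ℚ (suc i) * x + c * f i) (descend t (suc i) (subst (d <_) (sym (ℕₚ.+-suc t i)) d<i)) ⟨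
    ℕ→ℚ (suc i) * f (suc i) + c * f i    ≡⟨ eq i ⟩
    0ℚ                                   ∎)
    where open ≡-Reasoning

∂+^-injective : ∀ m {d c f} → c ≢ 0ℚ → Degree≤ d f → ∂+^ m c f ≈ 0# → f ≈ 0#
∂+^-injective zero c≢0 f≤d eq = eq
∂+^-injective (suc m) {c = c} c≢0 f≤d eq =
  ∂+^-injective m c≢0 f≤d (∂+-injective c≢0 (∂+^-Degree≤ m c f≤d) eq)

∂+-Vanishes : ∀ {n f} c → Vanishes (suc n) f → Vanishes n (∂+ c f)
∂+-Vanishes c v i i<n = trans
  (cong₂ (λ x y → ℕ→ℚ (suc i) * x + c * y) (v (suc i) (s≤s i<n)) (v i (ℕₚ.m<n⇒m<1+n i<n)))
  (solve 2 (λ k c → k :* con 0ℚ :+ c :* con 0ℚ := con 0ℚ) refl (ℕ→ℚ (suc i)) c)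

∂+^-Vanishes : ∀ m {n f} c → Vanishes (m ℕ.+ n) f → Vanishes n (∂+^ m c f)
∂+^-Vanishes zero c v = v
∂+^-Vanishes (suc m) {n} {f} c v = ∂+-Vanishes c (∂+^-Vanishes m c (subst (λ j → Vanishes j f) (sym (ℕₚ.+-suc m n)) v))

∂^-polynomial : ∀ m {f} → (∀ i → m ≤ i → f i ≡ 0ℚ) → ∂+^ m 0ℚ f ≈ 0#
∂^-polynomial m {f} high n =
  go m 0 (subst (λ j → ∀ i → j ≤ i → f i ≡ 0ℚ) (sym (ℕₚ.+-identityʳ m)) high) n z≤n
  where
  go : ∀ m k → (∀ i → m ℕ.+ k ≤ i → f i ≡ 0ℚ) → ∀ i → k ≤ i → ∂+^ m 0ℚ f i ≡ 0ℚ
  go zero k h i k≤i = h i k≤i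
  go (suc m) k h i k≤i = trans
    (cong₂ (λ x y → ℕ→ℚ (suc i) * x + y)
      (go m (suc k) (λ j p → h j (subst (_≤ j) (ℕₚ.+-suc m k) p)) (suc i) (s≤s k≤i)) (ℚₚ.*-zeroˡ (∂+^ m 0ℚ f i)))
    (solve 1 (λ k → k :* con 0ℚ :+ con 0ℚ := con 0ℚ) refl (ℕ→ℚ (suc i)))

E-unit : expS (- 1ℚ) ⊛ E ≈ 1#
E-unit = ≈-trans (expS-+ (- 1ℚ) 1ℚ) expS-0

⊛-Vanishes : ∀ {n g} f → Vanishes n g → Vanishes n (f ⊛ g)
⊛-Vanishes {n} {g} f v i i<n = trans
  (⊛-cong-≤ {f} {f} {g} {0#} i (λ _ _ → refl) (λ k k≤i → v k (ℕₚ.≤-<-trans k≤i i<n)))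
  (⊛-zeroʳ f i)

-- ∂^{d+1} kills the coefficient of e^{0z} and acts injectively on the other ones;
-- dividing by e^z then lowers all frequencies by one.
expPoly-injective : ∀ N {d a} → (∀ k → Degree≤ d (a k)) → Vanishes (N ℕ.* suc d) (expPoly N a) →
  ∀ k → k < N → a k ≈ 0#
expPoly-injective (suc N) {d} {a} deg v = λ { zero _ → a₀≈0 ; (suc k) (s≤s k<N) → aₛ≈0 k k<N }
  where
  b : ℕ → PS
  b k = ∂+^ (suc d) (ℕ→ℚ (suc k)) (a (suc k))
  E⊛b : ∂+^ (suc d) 0ℚ (expPoly (suc N) a) ≈ E ⊛ expPoly N b
  E⊛b n = trans (∂+^-expPoly (suc d) (suc N) a n)
    (trans (cong (_+ (E ⊛ expPoly N b) n) (∂^-polynomial (suc d) (deg 0) n)) (ℚₚ.+-identityˡ _))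
  -- Removing one frequency takes d + 1 derivations, each of which uses up one known coefficient:
  -- hence the factor `suc d` in the bound.
  b-Vanishes : Vanishes (N ℕ.* suc d) (expPoly N b)
  b-Vanishes i i< = trans (sym (trans (sym (⊛-assoc (expS (- 1ℚ)) E (expPoly N b) i))
      (trans (⊛-congʳ (expPoly N b) E-unit i) (⊛-identityˡ (expPoly N b) i))))
    (⊛-Vanishes (expS (- 1ℚ)) (λ j j< → trans (sym (E⊛b j)) (∂+^-Vanishes (suc d) 0ℚ v j j<)) i i<)
  aₛ≈0 : ∀ k → k < N → a (suc k) ≈ 0#
  aₛ≈0 k k<N = ∂+^-injective (suc d) (ℕ→ℚ-suc≢0 k) (deg (suc k))
    (expPoly-injective N (λ k → ∂+^-Degree≤ (suc d) (ℕ→ℚ (suc k)) (deg (suc k))) b-Vanishes k k<N)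
  expPoly≈a₀ : expPoly (suc N) a ≈ a 0
  expPoly≈a₀ n = trans (cong (a 0 n +_) (trans
      (⊛-congˡ E (expPoly-0 N aₛ≈0) n) (⊛-zeroʳ E n)))
    (ℚₚ.+-identityʳ _)
  a₀≈0 : a 0 ≈ 0#
  a₀≈0 n with n ℕ.≤? d
  -- Indices up to d lie in the vanishing range, the others above the degree bound.
  ... | yes n≤d = trans (sym (expPoly≈a₀ n)) (v n (s≤s (ℕₚ.≤-trans n≤d (ℕₚ.m≤m+n d (N ℕ.* suc d)))))
  ... | no n≰d = deg 0 n (ℕₚ.≰⇒> n≰d)

-- Substitution of e^z for q in polynomials

-- f ⟿ g: there is a polynomial P with f = P(X) and g = P(E).
infix 4 _⟿_

data _⟿_ (f g : PS) : Set where
  nil  : f ≈ 0# → g ≈ 0# → f ⟿ g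
  cons : ∀ c f′ g′ → f′ ⟿ g′ → f ≈ constant c ⊕ (X ⊛ f′) → g ≈ constant c ⊕ (E ⊛ g′) → f ⟿ g

constant-0 : constant 0ℚ ≈ 0#
constant-0 zero = refl
constant-0 (suc n) = refl

⊕-identityˡ : ∀ f → 0# ⊕ f ≈ f
⊕-identityˡ f n = ℚₚ.+-identityˡ (f n)

⟿-cong : ∀ {f f′ g g′} → f ≈ f′ → g ≈ g′ → f ⟿ g → f′ ⟿ g′
⟿-cong ef eg (nil f≈0 g≈0) = nil (≈-trans (≈-sym ef) f≈0) (≈-trans (≈-sym eg) g≈0)
⟿-cong ef eg (cons c f₁ g₁ p f≈ g≈) = cons c f₁ g₁ p (≈-trans (≈-sym ef) f≈) (≈-trans (≈-sym eg) g≈)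

⟿-⊕ : ∀ {f g f′ g′} → f ⟿ g → f′ ⟿ g′ → (f ⊕ f′) ⟿ (g ⊕ g′)
⟿-⊕ {f} {g} {f′} {g′} (nil f≈0 g≈0) q = ⟿-cong
  (≈-sym (≈-trans (⊕-congʳ f′ f≈0) (⊕-identityˡ f′))) (≈-sym (≈-trans (⊕-congʳ g′ g≈0) (⊕-identityˡ g′))) q
⟿-⊕ {f} {g} {f′} {g′} p@(cons _ _ _ _ _ _) (nil f≈0 g≈0) = ⟿-cong
  (λ n → sym (trans (cong (f n +_) (f≈0 n)) (ℚₚ.+-identityʳ (f n))))
  (λ n → sym (trans (cong (g n +_) (g≈0 n)) (ℚₚ.+-identityʳ (g n)))) p
⟿-⊕ (cons c f₁ g₁ p f≈ g≈) (cons c′ f₂ g₂ q f′≈ g′≈) = cons (c + c′) (f₁ ⊕ f₂) (g₁ ⊕ g₂) (⟿-⊕ p q)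
  (≈-trans (⊕-cong f≈ f′≈) (merge X f₁ f₂)) (≈-trans (⊕-cong g≈ g′≈) (merge E g₁ g₂))
  where
  merge : ∀ x a b → (constant c ⊕ (x ⊛ a)) ⊕ (constant c′ ⊕ (x ⊛ b)) ≈ constant (c + c′) ⊕ (x ⊛ (a ⊕ b))
  merge x a b = ≈-trans
    (solveₚ 5 (λ c x a c′ b → (c :+ₚ (x :*ₚ a)) :+ₚ (c′ :+ₚ (x :*ₚ b)) :=ₚ (c :+ₚ c′) :+ₚ (x :*ₚ (a :+ₚ b))) (λ _ → refl)
      (constant c) x a (constant c′) b)
    (⊕-congʳ (x ⊛ (a ⊕ b)) {constant c ⊕ constant c′} {constant (c + c′)} (λ { zero → refl ; (suc n) → refl }))

⟿-constant : ∀ c → constant c ⟿ constant c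
⟿-constant c = cons c 0# 0# (nil (λ _ → refl) (λ _ → refl)) (strip X) (strip E)
  where
  strip : ∀ x → constant c ≈ constant c ⊕ (x ⊛ 0#)
  strip x n = sym (trans (cong (constant c n +_) (⊛-zeroʳ x n)) (ℚₚ.+-identityʳ (constant c n)))

⟿-shift : ∀ {f g} → f ⟿ g → (X ⊛ f) ⟿ (E ⊛ g)
⟿-shift {f} {g} p = cons 0ℚ f g p (pad X f) (pad E g)
  where
  pad : ∀ x f → x ⊛ f ≈ constant 0ℚ ⊕ (x ⊛ f)
  pad x f = ≈-sym (≈-trans (⊕-congʳ (x ⊛ f) constant-0) (⊕-identityˡ (x ⊛ f)))

⟿-· : ∀ c {f g} → f ⟿ g → (constant c ⊛ f) ⟿ (constant c ⊛ g)
⟿-· c (nil f≈0 g≈0) = nil (≈-trans (⊛-congˡ (constant c) f≈0) (⊛-zeroʳ (constant c))) (≈-trans (⊛-congˡ (constant c) g≈0) (⊛-zeroʳ (constant c)))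
⟿-· c (cons d f₁ g₁ p f≈ g≈) = cons (c * d) (constant c ⊛ f₁) (constant c ⊛ g₁) (⟿-· c p)
  (≈-trans (⊛-congˡ (constant c) f≈) (expand X f₁)) (≈-trans (⊛-congˡ (constant c) g≈) (expand E g₁))
  where
  expand : ∀ x a → constant c ⊛ (constant d ⊕ (x ⊛ a)) ≈ constant (c * d) ⊕ (x ⊛ (constant c ⊛ a))
  expand x a = ≈-trans
    (solveₚ 4 (λ c d x a → c :*ₚ (d :+ₚ (x :*ₚ a)) :=ₚ (c :*ₚ d) :+ₚ (x :*ₚ (c :*ₚ a))) (λ _ → refl) (constant c) (constant d) x a)
    (⊕-congʳ (x ⊛ (constant c ⊛ a)) (≈-sym (constant-⊛-constant c d)))

⟿-⊛ : ∀ {f g f′ g′} → f ⟿ g → f′ ⟿ g′ → (f ⊛ f′) ⟿ (g ⊛ g′)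
⟿-⊛ {f} {g} {f′} {g′} (nil f≈0 g≈0) q =
  nil (≈-trans (⊛-congʳ f′ f≈0) (⊛-zeroˡ f′)) (≈-trans (⊛-congʳ g′ g≈0) (⊛-zeroˡ g′))
⟿-⊛ {f} {g} {f′} {g′} (cons c f₁ g₁ p f≈ g≈) q = ⟿-cong
  (≈-sym (≈-trans (⊛-congʳ f′ f≈) (distrib X f₁ f′))) (≈-sym (≈-trans (⊛-congʳ g′ g≈) (distrib E g₁ g′)))
  (⟿-⊕ (⟿-· c q) (⟿-shift (⟿-⊛ p q)))
  where
  distrib : ∀ x a b → (constant c ⊕ (x ⊛ a)) ⊛ b ≈ (constant c ⊛ b) ⊕ (x ⊛ (a ⊛ b))
  distrib x a b = solveₚ 4 (λ c x a b → (c :+ₚ (x :*ₚ a)) :*ₚ b :=ₚ (c :*ₚ b) :+ₚ (x :*ₚ (a :*ₚ b))) (λ _ → refl) (constant c) x a b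

⟿-^ : ∀ {f g} n → f ⟿ g → (f ^ₚ n) ⟿ (g ^ₚ n)
⟿-^ zero p = ⟿-constant 1ℚ
⟿-^ (suc n) p = ⟿-⊛ p (⟿-^ n p)

⟿-X^ : ∀ n → (X ^ₚ n) ⟿ (E ^ₚ n)
⟿-X^ zero = ⟿-constant 1ℚ
⟿-X^ (suc n) = ⟿-shift (⟿-X^ n)

⟿-⊖ : ∀ {f g} → f ⟿ g → (⊖ f) ⟿ (⊖ g)
⟿-⊖ {f} {g} p = ⟿-cong (neg f) (neg g) (⟿-· (- 1ℚ) p)
  where
  neg : ∀ f → constant (- 1ℚ) ⊛ f ≈ ⊖ f
  neg f = solveₚ 1 (λ f → conₚ (- 1ℚ) :*ₚ f :=ₚ :-ₚ f) (λ _ → refl) f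

∂-constant : ∀ c → ∂ (constant c) ≈ 0#
∂-constant c n = ℚₚ.*-zeroʳ (ℕ→ℚ (suc n))

-- Chain rule: for q = e^z, q d/dq is d/dz. On the Horner form it comes down to the Leibniz rules
-- with `ϑX` and `∂E`.
⟿-ϑ : ∀ {f g} → f ⟿ g → ϑ f ⟿ ∂ g
⟿-ϑ (nil f≈0 g≈0) = nil (λ n → trans (cong (ℕ→ℚ n *_) (f≈0 n)) (ℚₚ.*-zeroʳ (ℕ→ℚ n)))
  (λ n → trans (cong (ℕ→ℚ (suc n) *_) (g≈0 (suc n))) (ℚₚ.*-zeroʳ (ℕ→ℚ (suc n))))
⟿-ϑ {f} {g} (cons c f₁ g₁ p f≈ g≈) = ⟿-cong ϑf ∂g (⟿-shift (⟿-⊕ p (⟿-ϑ p)))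
  where
  open import Relation.Binary.Reasoning.Setoid setoid
  ϑf : X ⊛ (f₁ ⊕ ϑ f₁) ≈ ϑ f
  ϑf = ≈-sym (begin
    ϑ f                                              ≈⟨ ϑ-cong f≈ ⟩
    ϑ (constant c ⊕ (X ⊛ f₁))                        ≈⟨ ϑ-⊕ (constant c) (X ⊛ f₁) ⟩
    ϑ (constant c) ⊕ ϑ (X ⊛ f₁)                      ≈⟨ ⊕-cong (ϑ-constant c) (ϑ-⊛ X f₁) ⟩
    0# ⊕ ((ϑ X ⊛ f₁) ⊕ (X ⊛ ϑ f₁))                   ≈⟨ ⊕-identityˡ _ ⟩
    (ϑ X ⊛ f₁) ⊕ (X ⊛ ϑ f₁)                          ≈⟨ ⊕-congʳ (X ⊛ ϑ f₁) (⊛-congʳ f₁ ϑX) ⟩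
    (X ⊛ f₁) ⊕ (X ⊛ ϑ f₁)                            ≈⟨ solveₚ 3 (λ x a b → (x :*ₚ a) :+ₚ (x :*ₚ b) :=ₚ x :*ₚ (a :+ₚ b)) (λ _ → refl) X f₁ (ϑ f₁) ⟩
    X ⊛ (f₁ ⊕ ϑ f₁)                                  ∎)
  ∂g : E ⊛ (g₁ ⊕ ∂ g₁) ≈ ∂ g
  ∂g = ≈-sym (begin
    ∂ g                                              ≈⟨ ∂-cong g≈ ⟩
    ∂ (constant c ⊕ (E ⊛ g₁))                        ≈⟨ ∂-⊕ (constant c) (E ⊛ g₁) ⟩
    ∂ (constant c) ⊕ ∂ (E ⊛ g₁)                      ≈⟨ ⊕-cong (∂-constant c) (∂-⊛ E g₁) ⟩
    0# ⊕ ((∂ E ⊛ g₁) ⊕ (E ⊛ ∂ g₁))                   ≈⟨ ⊕-identityˡ _ ⟩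
    (∂ E ⊛ g₁) ⊕ (E ⊛ ∂ g₁)                          ≈⟨ ⊕-congʳ (E ⊛ ∂ g₁) (⊛-congʳ g₁ ∂E) ⟩
    (E ⊛ g₁) ⊕ (E ⊛ ∂ g₁)                            ≈⟨ solveₚ 3 (λ x a b → (x :*ₚ a) :+ₚ (x :*ₚ b) :=ₚ x :*ₚ (a :+ₚ b)) (λ _ → refl) E g₁ (∂ g₁) ⟩
    E ⊛ (g₁ ⊕ ∂ g₁)                                  ∎)

cons-head : ∀ c f′ {f} → f ≈ constant c ⊕ (X ⊛ f′) → f 0 ≡ c
cons-head c f′ f≈ = trans (f≈ 0) (trans (cong (c +_) (X-⊛-zero f′)) (ℚₚ.+-identityʳ c))

cons-tail : ∀ c f′ {f} → f ≈ constant c ⊕ (X ⊛ f′) → tail f ≈ f′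
cons-tail c f′ f≈ n = trans (f≈ (suc n)) (trans (ℚₚ.+-identityˡ _) (X-⊛-suc f′ n))

⟿-zero : ∀ {f g} → f ⟿ g → f ≈ 0# → g ≈ 0#
⟿-zero (nil _ g≈0) _ = g≈0
⟿-zero {f} {g} (cons c f₁ g₁ p f≈ g≈) f≈0 n = begin
  g n                           ≡⟨ g≈ n ⟩
  constant c n + (E ⊛ g₁) n     ≡⟨ cong₂ _+_ (cong (λ c → constant c n) (trans (sym (cons-head c f₁ f≈)) (f≈0 0)))
                                     (trans (⊛-congˡ E g₁≈0 n) (⊛-zeroʳ E n)) ⟩
  constant 0ℚ n + 0ℚ            ≡⟨ cong (_+ 0ℚ) (constant-0 n) ⟩
  0ℚ                            ∎
  where
  open ≡-Reasoning
  g₁≈0 : g₁ ≈ 0#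
  g₁≈0 = ⟿-zero p (λ n → trans (sym (cons-tail c f₁ f≈ n)) (f≈0 (suc n)))

-- The substitution is well defined, so an identity between polynomials in q may be read at q = e^z.
⟿-functional : ∀ {f g f′ g′} → f ⟿ g → f′ ⟿ g′ → f ≈ f′ → g ≈ g′
⟿-functional {f} {g} {f′} {g′} p q f≈f′ n = begin
  g n                     ≡⟨ solve 2 (λ a b → a := (a :+ (:- b)) :+ b) refl (g n) (g′ n) ⟩
  (g n + - g′ n) + g′ n   ≡⟨ cong (_+ g′ n) (⟿-zero (⟿-⊕ p (⟿-⊖ q)) (λ k → trans (cong (_+ - f′ k) (f≈f′ k)) (ℚₚ.+-inverseʳ (f′ k))) n) ⟩
  0ℚ + g′ n               ≡⟨ ℚₚ.+-identityˡ (g′ n) ⟩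
  g′ n                    ∎
  where open ≡-Reasoning

-- A derivation of `f ⟿ g` is finite data, and its length bounds the degree.
⟿-support : ∀ {f g} → f ⟿ g → Σ[ N ∈ ℕ ] (∀ k → N ≤ k → f k ≡ 0ℚ)
⟿-support (nil f≈0 _) = 0 , λ k _ → f≈0 k
⟿-support {f} (cons c f₁ g₁ p f≈ g≈) with ⟿-support p
... | N , h = suc N , λ { (suc k) (s≤s N≤k) → trans (cons-tail c f₁ f≈ k) (h k N≤k) }

-- P(e^z) is an exponential polynomial whose coefficients are constants, namely those of P. This
-- brings numerators and denominators within reach of `expPoly-injective`.
⟿-expPoly : ∀ {f g} N → f ⟿ g → (∀ k → N ≤ k → f k ≡ 0ℚ) → g ≈ expPoly N (λ k → constant (f k))
⟿-expPoly zero p f≈0 = ⟿-zero p (λ k → f≈0 k z≤n)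
⟿-expPoly (suc N) (nil f≈0 g≈0) _ = ≈-trans g≈0
  (≈-sym (expPoly-0 (suc N) (λ k _ → ≈-trans (constant-cong (f≈0 k)) constant-0)))
⟿-expPoly (suc N) (cons c f₁ g₁ p f≈ g≈) h = ≈-trans g≈
  (⊕-cong (constant-cong (sym (cons-head c f₁ f≈)))
    (⊛-congˡ E (≈-trans (⟿-expPoly N p (λ k N≤k → trans (sym (cons-tail c f₁ f≈ k)) (h (suc k) (s≤s N≤k))))
      (expPoly-cong N (λ k _ → constant-cong (sym (cons-tail c f₁ f≈ k)))))))

-- The derivation of a quotient with denominator a power of Q

-- The power rule multiplied by f, which avoids the exponent n - 1.
⊛-ϑ-^ : ∀ f n → f ⊛ ϑ (f ^ₚ n) ≈ constant (ℕ→ℚ n) ⊛ (ϑ f ⊛ (f ^ₚ n))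
⊛-ϑ-^ f zero = begin
  f ⊛ ϑ 1#                          ≈⟨ ⊛-congˡ f (ϑ-constant 1ℚ) ⟩
  f ⊛ 0#                            ≈⟨ ⊛-zeroʳ f ⟩
  0#                                ≈⟨ ⊛-zeroˡ (ϑ f ⊛ 1#) ⟨
  0# ⊛ (ϑ f ⊛ 1#)                   ≈⟨ ⊛-congʳ (ϑ f ⊛ 1#) constant-0 ⟨
  constant 0ℚ ⊛ (ϑ f ⊛ 1#)          ∎
  where open import Relation.Binary.Reasoning.Setoid setoid
⊛-ϑ-^ f (suc n) = begin
  f ⊛ ϑ (f ⊛ fⁿ)
    ≈⟨ ⊛-congˡ f (ϑ-⊛ f fⁿ) ⟩
  f ⊛ ((ϑ f ⊛ fⁿ) ⊕ (f ⊛ ϑ fⁿ))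
    ≈⟨ ⊛-congˡ f (⊕-congˡ (ϑ f ⊛ fⁿ) (⊛-ϑ-^ f n)) ⟩
  f ⊛ ((ϑ f ⊛ fⁿ) ⊕ (constant (ℕ→ℚ n) ⊛ (ϑ f ⊛ fⁿ)))
    ≈⟨ solveₚ 4 (λ f d p c → f :*ₚ ((d :*ₚ p) :+ₚ (c :*ₚ (d :*ₚ p))) :=ₚ (conₚ 1ℚ :+ₚ c) :*ₚ (d :*ₚ (f :*ₚ p))) (λ _ → refl)
         f (ϑ f) fⁿ (constant (ℕ→ℚ n)) ⟩
  (constant 1ℚ ⊕ constant (ℕ→ℚ n)) ⊛ (ϑ f ⊛ (f ⊛ fⁿ))
    ≈⟨ ⊛-congʳ (ϑ f ⊛ (f ⊛ fⁿ)) {constant 1ℚ ⊕ constant (ℕ→ℚ n)} {constant (ℕ→ℚ (suc n))} (λ { zero → sym (ℕ→ℚ-suc n) ; (suc k) → refl }) ⟩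
  constant (ℕ→ℚ (suc n)) ⊛ (ϑ f ⊛ (f ⊛ fⁿ)) ∎
  where
  open import Relation.Binary.Reasoning.Setoid setoid
  fⁿ = f ^ₚ n

ϑ-X^ : ∀ n → ϑ (X ^ₚ n) ≈ constant (ℕ→ℚ n) ⊛ (X ^ₚ n)
ϑ-X^ n = X-⊛-cancel (≈-trans (⊛-ϑ-^ X n)
  (≈-trans (⊛-congˡ (constant (ℕ→ℚ n)) (⊛-congʳ (X ^ₚ n) ϑX))
    (solveₚ 3 (λ c x p → c :*ₚ (x :*ₚ p) :=ₚ x :*ₚ (c :*ₚ p)) (λ _ → refl) (constant (ℕ→ℚ n)) X (X ^ₚ n))))

-- With t = 1, κ = 0 this is the quotient rule for ϑ = q d/dq; with t = z, κ = n it is the quotient rule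
-- for d/dz, where w/(tT) stands for a Laurent series.
quotient-rule : ∀ {c κ Q Q′ t A T R R′ w} → A ⊛ w ≈ T ⊛ R → Q ⊛ ϑ A ≈ c ⊛ ((t ⊛ Q′) ⊛ A) → ϑ T ≈ κ ⊛ T → ϑ R ≈ t ⊛ R′ →
  (Q ⊛ A) ⊛ (ϑ w ⊕ (⊖ (κ ⊛ w))) ≈ (T ⊛ t) ⊛ ((Q ⊛ R′) ⊕ (⊖ (c ⊛ (Q′ ⊛ R))))
quotient-rule {c} {κ} {Q} {Q′} {t} {A} {T} {R} {R′} {w} Aw≈TR QϑA ϑT ϑR = begin
  (Q ⊛ A) ⊛ (ϑ w ⊕ (⊖ (κ ⊛ w)))
    ≈⟨ solveₚ 6 (λ q a dw k w da → (q :*ₚ a) :*ₚ (dw :+ₚ (:-ₚ (k :*ₚ w)))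
         :=ₚ (q :*ₚ ((da :*ₚ w) :+ₚ (a :*ₚ dw))) :+ₚ ((:-ₚ ((q :*ₚ da) :*ₚ w)) :+ₚ (:-ₚ ((k :*ₚ q) :*ₚ (a :*ₚ w))))) (λ _ → refl) Q A (ϑ w) κ w (ϑ A) ⟩
  (Q ⊛ ((ϑ A ⊛ w) ⊕ (A ⊛ ϑ w))) ⊕ ((⊖ ((Q ⊛ ϑ A) ⊛ w)) ⊕ (⊖ ((κ ⊛ Q) ⊛ (A ⊛ w))))
    ≈⟨ ⊕-cong (⊛-congˡ Q (≈-trans (≈-sym (ϑ-⊛ A w)) (≈-trans (ϑ-cong Aw≈TR) (≈-trans (ϑ-⊛ T R) (⊕-cong (⊛-congʳ R ϑT) (⊛-congˡ T ϑR))))))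
         (⊕-cong (⊖-cong (≈-trans (⊛-congʳ w QϑA) (solveₚ 5 (λ c t q a w → (c :*ₚ ((t :*ₚ q) :*ₚ a)) :*ₚ w :=ₚ (c :*ₚ (t :*ₚ q)) :*ₚ (a :*ₚ w)) (λ _ → refl) c t Q′ A w)))
           (≈-refl {⊖ ((κ ⊛ Q) ⊛ (A ⊛ w))})) ⟩
  (Q ⊛ (((κ ⊛ T) ⊛ R) ⊕ (T ⊛ (t ⊛ R′)))) ⊕ ((⊖ ((c ⊛ (t ⊛ Q′)) ⊛ (A ⊛ w))) ⊕ (⊖ ((κ ⊛ Q) ⊛ (A ⊛ w))))
    ≈⟨ ⊕-congˡ (Q ⊛ (((κ ⊛ T) ⊛ R) ⊕ (T ⊛ (t ⊛ R′)))) (⊕-cong (⊖-cong (⊛-congˡ (c ⊛ (t ⊛ Q′)) Aw≈TR)) (⊖-cong (⊛-congˡ (κ ⊛ Q) Aw≈TR))) ⟩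
  (Q ⊛ (((κ ⊛ T) ⊛ R) ⊕ (T ⊛ (t ⊛ R′)))) ⊕ ((⊖ ((c ⊛ (t ⊛ Q′)) ⊛ (T ⊛ R))) ⊕ (⊖ ((κ ⊛ Q) ⊛ (T ⊛ R))))
    ≈⟨ solveₚ 8 (λ q k t r u s c p → (q :*ₚ (((k :*ₚ t) :*ₚ r) :+ₚ (t :*ₚ (u :*ₚ s)))) :+ₚ ((:-ₚ ((c :*ₚ (u :*ₚ p)) :*ₚ (t :*ₚ r))) :+ₚ (:-ₚ ((k :*ₚ q) :*ₚ (t :*ₚ r))))
         :=ₚ (t :*ₚ u) :*ₚ ((q :*ₚ s) :+ₚ (:-ₚ (c :*ₚ (p :*ₚ r))))) (λ _ → refl) Q κ T R t R′ c Q′ ⟩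
  (T ⊛ t) ⊛ ((Q ⊛ R′) ⊕ (⊖ (c ⊛ (Q′ ⊛ R)))) ∎
  where open import Relation.Binary.Reasoning.Setoid setoid

-- The series ϑᵐ(q^v/(1 - q^D)) and the Laurent series ∂ᵐ(e^{vz}/(1 - e^{Dz}))

Q Qₑ : ℕ → PS
Q D = 1# ⊕ (⊖ (X ^ₚ D))
Qₑ D = 1# ⊕ (⊖ (E ^ₚ D))

Q⟿Qₑ : ∀ D → Q D ⟿ Qₑ D
Q⟿Qₑ D = ⟿-⊕ (⟿-constant 1ℚ) (⟿-⊖ (⟿-X^ D))

-- Exhibits the simple zero of 1 - e^{Dz} at z = 0; for D ≥ 1 the cofactor `expm1OverZ D` is a unit.
Qₑ≈expm1OverZ : ∀ D → Qₑ D ≈ ⊖ (X ⊛ expm1OverZ D)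
Qₑ≈expm1OverZ D zero = trans (cong (λ x → 1ℚ + - x) (sym (expS-ℕ D 0))) (cong -_ (sym (X-⊛-zero (expm1OverZ D))))
Qₑ≈expm1OverZ D (suc n) = trans (ℚₚ.+-identityˡ _)
  (cong -_ (trans (sym (expS-ℕ D (suc n))) (sym (X-⊛-suc (expm1OverZ D) n))))

expm1OverZ≢0 : ∀ {D} → 1 ≤ D → expm1OverZ D 0 ≢ 0ℚ
expm1OverZ≢0 {D} 1≤D eq = *-≢0 (ℕ→ℚ≢0 1≤D) ℚₚ.1≢0 (trans (sym (÷₀-cancel (ℕ→ℚ D ^ 1) (!≢0 1))) (trans (cong (_* ℕ→ℚ (1 !)) eq) (ℚₚ.*-zeroˡ (ℕ→ℚ (1 !)))))

X^-high : ∀ j f i → ((X ^ₚ j) ⊛ f) (j ℕ.+ i) ≡ f i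
X^-high zero f i = ⊛-identityˡ f i
X^-high (suc j) f i = trans (⊛-assoc X (X ^ₚ j) f (suc j ℕ.+ i)) (trans (X-⊛-suc ((X ^ₚ j) ⊛ f) (j ℕ.+ i)) (X^-high j f i))

X^-low : ∀ j f i → i < j → ((X ^ₚ j) ⊛ f) i ≡ 0ℚ
X^-low (suc j) f zero _ = trans (⊛-assoc X (X ^ₚ j) f 0) (X-⊛-zero ((X ^ₚ j) ⊛ f))
X^-low (suc j) f (suc i) (s≤s i<j) = trans (⊛-assoc X (X ^ₚ j) f (suc i)) (trans (X-⊛-suc ((X ^ₚ j) ⊛ f) i) (X^-low j f i i<j))

⊛-identityʳ : ∀ f → f ⊛ 1# ≈ f
⊛-identityʳ f = ≈-trans (⊛-comm f 1#) (⊛-identityˡ f)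

Q≢0 : ∀ {D} → 1 ≤ D → Q D 0 ≢ 0ℚ
Q≢0 {D} 1≤D eq = ℚₚ.1≢0 (trans (sym (trans (cong (λ x → 1ℚ + - x) (trans (sym (⊛-identityʳ (X ^ₚ D) 0)) (X^-low D 1# 0 1≤D))) refl)) eq)

-- The recursion of the numerators is the quotient rule over `Q D ^ₚ suc m` and `Qₑ D ^ₚ suc m`.
-- Running it alike in q and in z keeps them related by `⟿`.
num numₑ geo lau : (D v m : ℕ) → PS
num D v zero = X ^ₚ v
num D v (suc m) = (Q D ⊛ ϑ (num D v m)) ⊕ (⊖ (constant (ℕ→ℚ (suc m)) ⊛ (ϑ (Q D) ⊛ num D v m)))
numₑ D v zero = E ^ₚ v
numₑ D v (suc m) = (Qₑ D ⊛ ∂ (numₑ D v m)) ⊕ (⊖ (constant (ℕ→ℚ (suc m)) ⊛ (∂ (Qₑ D) ⊛ numₑ D v m)))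
geo D v zero = (X ^ₚ v) ⊛ inv (Q D)
geo D v (suc m) = ϑ (geo D v m)
-- lau D v m is z^{m+1} ∂ᵐ(e^{vz}/(1 - e^{Dz})).
lau D v zero = ⊖ (inv (expm1OverZ D) ⊛ expS (ℕ→ℚ v))
lau D v (suc m) = ϑ (lau D v m) ⊕ (⊖ (constant (ℕ→ℚ (suc m)) ⊛ lau D v m))

num⟿numₑ : ∀ D v m → num D v m ⟿ numₑ D v m
num⟿numₑ D v zero = ⟿-X^ v
num⟿numₑ D v (suc m) = ⟿-⊕ (⟿-⊛ (Q⟿Qₑ D) (⟿-ϑ (num⟿numₑ D v m)))
  (⟿-⊖ (⟿-· (ℕ→ℚ (suc m)) (⟿-⊛ (⟿-ϑ (Q⟿Qₑ D)) (num⟿numₑ D v m))))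

Q^⊛geo : ∀ {D} v m → 1 ≤ D → (Q D ^ₚ suc m) ⊛ geo D v m ≈ num D v m
Q^⊛geo {D} v zero 1≤D = begin
  (Q D ⊛ 1#) ⊛ ((X ^ₚ v) ⊛ inv (Q D))     ≈⟨ solveₚ 3 (λ q x i → (q :*ₚ conₚ 1ℚ) :*ₚ (x :*ₚ i) :=ₚ x :*ₚ (q :*ₚ i)) (λ _ → refl) (Q D) (X ^ₚ v) (inv (Q D)) ⟩
  (X ^ₚ v) ⊛ (Q D ⊛ inv (Q D))            ≈⟨ ⊛-congˡ (X ^ₚ v) (⊛-inverseʳ {Q D} (Q≢0 1≤D)) ⟩
  (X ^ₚ v) ⊛ 1#                           ≈⟨ ⊛-identityʳ (X ^ₚ v) ⟩
  X ^ₚ v                                  ∎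
  where open import Relation.Binary.Reasoning.Setoid setoid
Q^⊛geo {D} v (suc m) 1≤D = begin
  (Q D ⊛ A) ⊛ ϑ g
    ≈⟨ ⊛-congˡ (Q D ⊛ A) (λ n → trans (cong (λ x → ϑ g n + - x) (⊛-zeroˡ g n)) (ℚₚ.+-identityʳ (ϑ g n))) ⟨
  (Q D ⊛ A) ⊛ (ϑ g ⊕ (⊖ (0# ⊛ g)))
    ≈⟨ quotient-rule {constant (ℕ→ℚ (suc m))} {0#} {Q D} {ϑ (Q D)} {1#} {A} {1#} {R} {ϑ R} {g}
         (≈-trans (Q^⊛geo v m 1≤D) (≈-sym (⊛-identityˡ R)))
         (≈-trans (⊛-ϑ-^ (Q D) (suc m)) (⊛-congˡ (constant (ℕ→ℚ (suc m))) (⊛-congʳ A (≈-sym (⊛-identityˡ (ϑ (Q D)))))))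
         (≈-trans (ϑ-constant 1ℚ) (≈-sym (⊛-zeroˡ 1#)))
         (≈-sym (⊛-identityˡ (ϑ R))) ⟩
  (1# ⊛ 1#) ⊛ num D v (suc m)
    ≈⟨ ≈-trans (⊛-congʳ (num D v (suc m)) (⊛-identityˡ 1#)) (⊛-identityˡ (num D v (suc m))) ⟩
  num D v (suc m) ∎
  where
  open import Relation.Binary.Reasoning.Setoid setoid
  A = Q D ^ₚ suc m
  R = num D v m
  g = geo D v m

Qₑ^⊛lau : ∀ {D} v m → 1 ≤ D → (Qₑ D ^ₚ suc m) ⊛ lau D v m ≈ (X ^ₚ suc m) ⊛ numₑ D v m
Qₑ^⊛lau {D} v zero 1≤D = begin
  (Qₑ D ⊛ 1#) ⊛ (⊖ (inv x ⊛ e))             ≈⟨ ⊛-congʳ (⊖ (inv x ⊛ e)) (≈-trans (⊛-identityʳ (Qₑ D)) (Qₑ≈expm1OverZ D)) ⟩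
  (⊖ (X ⊛ x)) ⊛ (⊖ (inv x ⊛ e))             ≈⟨ solveₚ 4 (λ z x i e → (:-ₚ (z :*ₚ x)) :*ₚ (:-ₚ (i :*ₚ e)) :=ₚ ((x :*ₚ i) :*ₚ (z :*ₚ e))) (λ _ → refl) X x (inv x) e ⟩
  (x ⊛ inv x) ⊛ (X ⊛ e)                     ≈⟨ ⊛-cong (⊛-inverseʳ {x} (expm1OverZ≢0 1≤D)) (⊛-cong (≈-sym (⊛-identityʳ X)) (expS-ℕ v)) ⟩
  1# ⊛ ((X ⊛ 1#) ⊛ (E ^ₚ v))                ≈⟨ ⊛-identityˡ _ ⟩
  (X ⊛ 1#) ⊛ (E ^ₚ v)                       ∎
  where
  open import Relation.Binary.Reasoning.Setoid setoid
  x = expm1OverZ D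
  e = expS (ℕ→ℚ v)
Qₑ^⊛lau {D} v (suc m) 1≤D = begin
  (Qₑ D ⊛ A) ⊛ (ϑ w ⊕ (⊖ (c ⊛ w)))
    ≈⟨ quotient-rule {c} {c} {Qₑ D} {∂ (Qₑ D)} {X} {A} {X ^ₚ suc m} {R} {∂ R} {w}
         (Qₑ^⊛lau v m 1≤D)
         (≈-trans (⊛-ϑ-^ (Qₑ D) (suc m)) (⊛-congˡ c (⊛-congʳ A (ϑ≈X⊛∂ (Qₑ D)))))
         (ϑ-X^ (suc m))
         (ϑ≈X⊛∂ R) ⟩
  ((X ^ₚ suc m) ⊛ X) ⊛ numₑ D v (suc m)
    ≈⟨ ⊛-congʳ (numₑ D v (suc m)) (⊛-comm (X ^ₚ suc m) X) ⟩
  (X ⊛ (X ^ₚ suc m)) ⊛ numₑ D v (suc m) ∎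
  where
  open import Relation.Binary.Reasoning.Setoid setoid
  A = Qₑ D ^ₚ suc m
  R = numₑ D v m
  w = lau D v m
  c = constant (ℕ→ℚ (suc m))

-- k! times the coefficient of z^k in ∂f is (k + 1)! times that of z^(k+1) in f, so m derivations
-- only shift k by m. The index k + (m + 1) undoes the factor z^(m+1); the `suc` on the right comes
-- from the pole of 1/(1 - e^{Dz}).
lau-coefficient : ∀ D v m k →
  ℕ→ℚ (k !) * lau D v m (k ℕ.+ suc m) ≡ - (ℕ→ℚ ((k ℕ.+ m) !) * (inv (expm1OverZ D) ⊛ expS (ℕ→ℚ v)) (suc (k ℕ.+ m)))
lau-coefficient D v zero k = begin
  ℕ→ℚ (k !) * - H (k ℕ.+ 1)              ≡⟨ cong₂ (λ i j → ℕ→ℚ (i !) * - H j) (sym (ℕₚ.+-identityʳ k)) (trans (ℕₚ.+-suc k 0) refl) ⟩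
  ℕ→ℚ ((k ℕ.+ 0) !) * - H (suc (k ℕ.+ 0)) ≡⟨ ℚₚ.neg-distribʳ-* (ℕ→ℚ ((k ℕ.+ 0) !)) (H (suc (k ℕ.+ 0))) ⟨
  - (ℕ→ℚ ((k ℕ.+ 0) !) * H (suc (k ℕ.+ 0))) ∎
  where
  open ≡-Reasoning
  H = inv (expm1OverZ D) ⊛ expS (ℕ→ℚ v)
lau-coefficient D v (suc m) k = begin
  ℕ→ℚ (k !) * (ℕ→ℚ n * w n + - (constant M ⊛ w) n)
    ≡⟨ cong₂ (λ x y → ℕ→ℚ (k !) * (x * w n + - y)) (trans (cong ℕ→ℚ (ℕₚ.+-suc k (suc m))) (trans (ℕ→ℚ-+ (suc k) (suc m)) refl)) (constant-⊛ M w n) ⟩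
  ℕ→ℚ (k !) * ((ℕ→ℚ (suc k) + M) * w n + - (M * w n))
    ≡⟨ solve 4 (λ f k m w → f :* ((k :+ m) :* w :+ (:- (m :* w))) := (k :* f) :* w) refl (ℕ→ℚ (k !)) (ℕ→ℚ (suc k)) M (w n) ⟩
  (ℕ→ℚ (suc k) * ℕ→ℚ (k !)) * w n
    ≡⟨ cong₂ _*_ (sym (ℕ→ℚ-* (suc k) (k !))) (cong w (ℕₚ.+-suc k (suc m))) ⟩
  ℕ→ℚ (suc k !) * w (suc k ℕ.+ suc m)
    ≡⟨ lau-coefficient D v m (suc k) ⟩
  - (ℕ→ℚ ((suc k ℕ.+ m) !) * H (suc (suc k ℕ.+ m)))
    ≡⟨ cong (λ i → - (ℕ→ℚ (i !) * H (suc i))) (ℕₚ.+-suc k m) ⟨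
  - (ℕ→ℚ ((k ℕ.+ suc m) !) * H (suc (k ℕ.+ suc m))) ∎
  where
  open ≡-Reasoning
  H = inv (expm1OverZ D) ⊛ expS (ℕ→ℚ v)
  w = lau D v m
  n = k ℕ.+ suc (suc m)
  M = ℕ→ℚ (suc m)

-- Bernoulli polynomials in terms of  z e^{vz}/(e^{Dz} - 1)

scale : ℚ → PS → PS
scale x f n = (x ^ n) * f n

scale-⊛ : ∀ x f g → scale x (f ⊛ g) ≈ scale x f ⊛ scale x g
scale-⊛ x f g zero = solve 2 (λ a b → con 1ℚ :* (a :* b :+ con 0ℚ) := con 1ℚ :* a :* (con 1ℚ :* b) :+ con 0ℚ) refl (f 0) (g 0)
scale-⊛ x f g (suc n) = begin
  x * (x ^ n) * (f 0 * g (suc n) + (tail f ⊛ g) n)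
    ≡⟨ solve 5 (λ x p a b t → x :* p :* (a :* b :+ t) := con 1ℚ :* a :* (x :* p :* b) :+ x :* (p :* t)) refl x (x ^ n) (f 0) (g (suc n)) ((tail f ⊛ g) n) ⟩
  1ℚ * f 0 * (x * (x ^ n) * g (suc n)) + x * ((x ^ n) * (tail f ⊛ g) n)
    ≡⟨ cong (λ t → 1ℚ * f 0 * (x * (x ^ n) * g (suc n)) + x * t) (scale-⊛ x (tail f) g n) ⟩
  1ℚ * f 0 * (x * (x ^ n) * g (suc n)) + x * (scale x (tail f) ⊛ scale x g) n
    ≡⟨ cong (_+_ (1ℚ * f 0 * (x * (x ^ n) * g (suc n)))) (trans (sym (·-⊛ x (scale x (tail f)) (scale x g) n))
         (⊛-congʳ (scale x g) {x · scale x (tail f)} {tail (scale x f)} (λ k → sym (ℚₚ.*-assoc x (x ^ k) (f (suc k)))) n)) ⟩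
  (scale x f ⊛ scale x g) (suc n) ∎
  where open ≡-Reasoning

1^ : ∀ n → 1ℚ ^ n ≡ 1ℚ
1^ zero = refl
1^ (suc n) = trans (ℚₚ.*-identityˡ (1ℚ ^ n)) (1^ n)

*-÷₀-assoc : ∀ x p {q} → q ≢ 0ℚ → x * (p ÷₀ q) ≡ (x * p) ÷₀ q
*-÷₀-assoc x p {q} q≢0 = ÷₀-unique q≢0 (trans (ℚₚ.*-assoc x (p ÷₀ q) q) (cong (x *_) (÷₀-cancel p q≢0)))

scale-expS : ∀ x y → scale x (expS y) ≈ expS (x * y)
scale-expS x y n = trans (*-÷₀-assoc (x ^ n) (y ^ n) (!≢0 n)) (cong (_÷₀ ℕ→ℚ (n !)) (sym (^-* x y n)))

scale-expm1OverZ : ∀ D → ℕ→ℚ D · scale (ℕ→ℚ D) (expm1OverZ 1) ≈ expm1OverZ D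
scale-expm1OverZ D n = begin
  d * ((d ^ n) * ((1ℚ ^ suc n) ÷₀ ℕ→ℚ (suc n !)))  ≡⟨ ℚₚ.*-assoc d (d ^ n) _ ⟨
  (d ^ suc n) * ((1ℚ ^ suc n) ÷₀ ℕ→ℚ (suc n !))    ≡⟨ *-÷₀-assoc (d ^ suc n) (1ℚ ^ suc n) (!≢0 (suc n)) ⟩
  ((d ^ suc n) * (1ℚ ^ suc n)) ÷₀ ℕ→ℚ (suc n !)    ≡⟨ cong (λ t → t ÷₀ ℕ→ℚ (suc n !)) (trans (cong ((d ^ suc n) *_) (1^ (suc n))) (ℚₚ.*-identityʳ (d ^ suc n))) ⟩
  (d ^ suc n) ÷₀ ℕ→ℚ (suc n !)                     ∎
  where
  open ≡-Reasoning
  d = ℕ→ℚ D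

-- Substituting Dz turns z/(e^z - 1) into D times z/(e^{Dz} - 1). As `scale` is multiplicative, it
-- respects inverses.
scale-inv-expm1OverZ : ∀ {D} → 1 ≤ D → scale (ℕ→ℚ D) (inv (expm1OverZ 1)) ≈ constant (ℕ→ℚ D) ⊛ inv (expm1OverZ D)
scale-inv-expm1OverZ {D} 1≤D = begin
  s                                     ≈⟨ ⊛-identityʳ s ⟨
  s ⊛ 1#                                ≈⟨ ⊛-congˡ s (⊛-inverseʳ {expm1OverZ D} (expm1OverZ≢0 1≤D)) ⟨
  s ⊛ (expm1OverZ D ⊛ inv (expm1OverZ D))
    ≈⟨ ⊛-congˡ s (⊛-congʳ (inv (expm1OverZ D)) (≈-trans (≈-sym (scale-expm1OverZ D)) (·≈constant-⊛ d (scale d (expm1OverZ 1))))) ⟩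
  s ⊛ ((constant d ⊛ scale d (expm1OverZ 1)) ⊛ inv (expm1OverZ D))
    ≈⟨ solveₚ 4 (λ s c t i → s :*ₚ ((c :*ₚ t) :*ₚ i) :=ₚ (t :*ₚ s) :*ₚ (c :*ₚ i)) (λ _ → refl) s (constant d) (scale d (expm1OverZ 1)) (inv (expm1OverZ D)) ⟩
  (scale d (expm1OverZ 1) ⊛ s) ⊛ (constant d ⊛ inv (expm1OverZ D))
    ≈⟨ ⊛-congʳ (constant d ⊛ inv (expm1OverZ D)) (≈-trans (≈-sym (scale-⊛ d (expm1OverZ 1) (inv (expm1OverZ 1))))
         (≈-trans (λ n → cong ((d ^ n) *_) (⊛-inverseʳ {expm1OverZ 1} (expm1OverZ≢0 {1} (s≤s z≤n)) n)) scale-1#)) ⟩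
  1# ⊛ (constant d ⊛ inv (expm1OverZ D)) ≈⟨ ⊛-identityˡ _ ⟩
  constant d ⊛ inv (expm1OverZ D)        ∎
  where
  open import Relation.Binary.Reasoning.Setoid setoid
  d = ℕ→ℚ D
  s = scale d (inv (expm1OverZ 1))
  scale-1# : scale d 1# ≈ 1#
  scale-1# zero = refl
  scale-1# (suc n) = ℚₚ.*-zeroʳ (d ^ suc n)

-- By the substitution of Dz, D^n B_n(v/D)/n! is the coefficient of z^n in D z e^{vz}/(e^{Dz} - 1).
-- The division by n = α + m + 1 in the entry lowers n! to (α + m)!.
entry-suc : ∀ {D} α m v → 1 ≤ D →
  entry D (suc α) m v ≡ ℕ→ℚ D * (ℕ→ℚ ((α ℕ.+ m) !) * (inv (expm1OverZ D) ⊛ expS (ℕ→ℚ v)) (suc (α ℕ.+ m)))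
entry-suc {D} α m v 1≤D = begin
  (d ^ suc p) * ((ℕ→ℚ (suc p !) * (i₁ ⊛ expS x) (suc p)) ÷₀ ℕ→ℚ (suc p))
    ≡⟨ cong ((d ^ suc p) *_) (sym (÷₀-unique (ℕ→ℚ-suc≢0 p) (trans (solve 3 (λ a b c → (a :* b) :* c := (c :* a) :* b) refl (ℕ→ℚ (p !)) ((i₁ ⊛ expS x) (suc p)) (ℕ→ℚ (suc p)))
         (cong (_* (i₁ ⊛ expS x) (suc p)) (sym (ℕ→ℚ-* (suc p) (p !))))))) ⟩
  (d ^ suc p) * (ℕ→ℚ (p !) * (i₁ ⊛ expS x) (suc p))
    ≡⟨ solve 3 (λ a b c → a :* (b :* c) := b :* (a :* c)) refl (d ^ suc p) (ℕ→ℚ (p !)) ((i₁ ⊛ expS x) (suc p)) ⟩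
  ℕ→ℚ (p !) * scale d (i₁ ⊛ expS x) (suc p)
    ≡⟨ cong (ℕ→ℚ (p !) *_) (trans (scale-⊛ d i₁ (expS x) (suc p))
         (⊛-cong (scale-inv-expm1OverZ 1≤D) (λ n → trans (scale-expS d x n) (cong (λ y → expS y n) dx≡v)) (suc p))) ⟩
  ℕ→ℚ (p !) * ((constant d ⊛ i) ⊛ e) (suc p)
    ≡⟨ cong (ℕ→ℚ (p !) *_) (trans (⊛-assoc (constant d) i e (suc p)) (constant-⊛ d (i ⊛ e) (suc p))) ⟩
  ℕ→ℚ (p !) * (d * (i ⊛ e) (suc p))
    ≡⟨ solve 3 (λ a b c → a :* (b :* c) := b :* (a :* c)) refl (ℕ→ℚ (p !)) d ((i ⊛ e) (suc p)) ⟩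
  d * (ℕ→ℚ (p !) * (i ⊛ e) (suc p)) ∎
  where
  open ≡-Reasoning
  p = α ℕ.+ m
  d = ℕ→ℚ D
  x = ℕ→ℚ v ÷₀ d
  i₁ = inv (expm1OverZ 1)
  i = inv (expm1OverZ D)
  e = expS (ℕ→ℚ v)
  dx≡v : d * x ≡ ℕ→ℚ v
  dx≡v = trans (ℚₚ.*-comm d x) (÷₀-cancel (ℕ→ℚ v) (ℕ→ℚ≢0 1≤D))

entry-lau : ∀ {D} k m v → 1 ≤ D → entry D (suc k) m v ≡ - (ℕ→ℚ D * (ℕ→ℚ (k !) * lau D v m (k ℕ.+ suc m)))
entry-lau {D} k m v 1≤D = trans (entry-suc k m v 1≤D)
  (trans (solve 2 (λ d h → d :* h := :- (d :* (:- h))) refl (ℕ→ℚ D) _)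
    (cong (λ t → - (ℕ→ℚ D * t)) (sym (lau-coefficient D v m k))))

-- Polynomial functions

polynomial : ∀ r → (Fin r → ℚ) → ℚ → ℚ
polynomial r c x = Σ r (λ m → c m * (x ^ toℕ m))

polynomial-suc : ∀ r c x → polynomial (suc r) c x ≡ c Fin.zero + x * polynomial r (λ m → c (Fin.suc m)) x
polynomial-suc r c x = cong₂ _+_ (ℚₚ.*-identityʳ (c Fin.zero))
  (trans (Σ-cong r (λ m → solve 3 (λ c x p → c :* (x :* p) := x :* (c :* p)) refl (c (Fin.suc m)) x (x ^ toℕ m)))
    (Σ-*ˡ r x (λ m → c (Fin.suc m) * (x ^ toℕ m))))

-- Synthetic division: the coefficients of (p(x) - p(x₀))/(x - x₀).
quotient : ∀ r → (Fin (suc r) → ℚ) → ℚ → Fin r → ℚ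
quotient (suc r) c x₀ Fin.zero = polynomial (suc r) (λ m → c (Fin.suc m)) x₀
quotient (suc r) c x₀ (Fin.suc i) = quotient r (λ m → c (Fin.suc m)) x₀ i

quotient-correct : ∀ r c x₀ x →
  polynomial (suc r) c x ≡ polynomial (suc r) c x₀ + (x + - x₀) * polynomial r (quotient r c x₀) x
quotient-correct zero c x₀ x = solve 3 (λ c x y → c :* con 1ℚ :+ con 0ℚ := c :* con 1ℚ :+ con 0ℚ :+ (x :+ :- y) :* con 0ℚ) refl (c Fin.zero) x x₀
quotient-correct (suc r) c x₀ x = begin
  polynomial (suc (suc r)) c x
    ≡⟨ polynomial-suc (suc r) c x ⟩
  c₀ + x * polynomial (suc r) c′ x
    ≡⟨ cong (λ t → c₀ + x * t) (quotient-correct r c′ x₀ x) ⟩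
  c₀ + x * (p₀ + (x + - x₀) * q)
    ≡⟨ solve 5 (λ c x p y q → c :+ x :* (p :+ (x :+ :- y) :* q) := (c :+ y :* p) :+ (x :+ :- y) :* (p :+ x :* q)) refl c₀ x p₀ x₀ q ⟩
  (c₀ + x₀ * p₀) + (x + - x₀) * (p₀ + x * q)
    ≡⟨ cong₂ (λ s t → s + (x + - x₀) * t) (polynomial-suc (suc r) c x₀) (polynomial-suc r (quotient (suc r) c x₀) x) ⟨
  polynomial (suc (suc r)) c x₀ + (x + - x₀) * polynomial (suc r) (quotient (suc r) c x₀) x ∎
  where
  open ≡-Reasoning
  c₀ = c Fin.zero
  c′ = λ m → c (Fin.suc m)
  p₀ = polynomial (suc r) c′ x₀
  q = polynomial r (quotient r c′ x₀) x

polynomial-0 : ∀ r {c} x → (∀ m → c m ≡ 0ℚ) → polynomial r c x ≡ 0ℚ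
polynomial-0 r x eq = Σ-zero r (λ m → trans (cong (_* (x ^ toℕ m)) (eq m)) (ℚₚ.*-zeroˡ (x ^ toℕ m)))

polynomial-head : ∀ r {c} x → (∀ m → c (Fin.suc m) ≡ 0ℚ) → polynomial (suc r) c x ≡ c Fin.zero
polynomial-head r {c} x eq = begin
  polynomial (suc r) c x                                    ≡⟨ polynomial-suc r c x ⟩
  c Fin.zero + x * polynomial r (λ m → c (Fin.suc m)) x     ≡⟨ cong (λ t → c Fin.zero + x * t) (polynomial-0 r x eq) ⟩
  c Fin.zero + x * 0ℚ                                       ≡⟨ solve 2 (λ c x → c :+ x :* con 0ℚ := c) refl (c Fin.zero) x ⟩
  c Fin.zero                                                ∎
  where open ≡-Reasoning

-- The quotient depends on the higher coefficients of c through a triangular system with ones on the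
-- diagonal, solved from the top degree downwards.
quotient-0 : ∀ r c x₀ → (∀ i → quotient r c x₀ i ≡ 0ℚ) → ∀ m → c (Fin.suc m) ≡ 0ℚ
quotient-0 (suc r) c x₀ eq = λ { Fin.zero → trans (sym (polynomial-head r {λ m → c (Fin.suc m)} x₀ rest)) (eq Fin.zero) ; (Fin.suc m) → rest m }
  where
  rest : ∀ m → c (Fin.suc (Fin.suc m)) ≡ 0ℚ
  rest = quotient-0 r (λ m → c (Fin.suc m)) x₀ (λ i → eq (Fin.suc i))

-- The root x 0 is split off, and the remaining points are roots of the quotient. With a sequence of
-- distinct points no counting against the degree is involved.
polynomial-injective : ∀ r c (x : ℕ → ℚ) → (∀ s t → s ≢ t → x s + - x t ≢ 0ℚ) →
  (∀ t → polynomial r c (x t) ≡ 0ℚ) → ∀ m → c m ≡ 0ℚ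
polynomial-injective (suc r) c x distinct eq = λ { Fin.zero → trans (sym (polynomial-head r {c} (x 0) c′≡0)) (eq 0) ; (Fin.suc m) → c′≡0 m }
  where
  open ≡-Reasoning
  q = quotient r c (x 0)
  q-root : ∀ t → polynomial r q (x (suc t)) ≡ 0ℚ
  q-root t = *-zero-cancelˡ (distinct (suc t) 0 (λ ())) (begin
    y                                    ≡⟨ ℚₚ.+-identityˡ y ⟨
    0ℚ + y                               ≡⟨ cong (_+ y) (eq 0) ⟨
    polynomial (suc r) c (x 0) + y       ≡⟨ quotient-correct r c (x 0) (x (suc t)) ⟨
    polynomial (suc r) c (x (suc t))     ≡⟨ eq (suc t) ⟩
    0ℚ                                   ∎)
    where y = (x (suc t) + - x 0) * polynomial r q (x (suc t))
  c′≡0 : ∀ m → c (Fin.suc m) ≡ 0ℚ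
  c′≡0 = quotient-0 r c (x 0) (polynomial-injective r q (λ t → x (suc t))
    (λ s t s≢t → distinct (suc s) (suc t) (λ e → s≢t (ℕₚ.suc-injective e))) q-root)

-- The coefficients of q^v/(1 - q^D)

Σ-single : ∀ n {f : Fin n → ℚ} i → (∀ j → j ≢ i → f j ≡ 0ℚ) → Σ n f ≡ f i
Σ-single (suc n) {f} Fin.zero eq = trans (cong (f Fin.zero +_) (Σ-zero n (λ j → eq (Fin.suc j) (λ ())))) (ℚₚ.+-identityʳ (f Fin.zero))
Σ-single (suc n) {f} (Fin.suc i) eq = trans (cong₂ _+_ (eq Fin.zero (λ ())) (Σ-single n i (λ j j≢i → eq (Fin.suc j) (λ e → j≢i (Finₚ.suc-injective e)))))
  (ℚₚ.+-identityˡ (f (Fin.suc i)))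

X^-self : ∀ v → (X ^ₚ v) v ≡ 1ℚ
X^-self v = trans (sym (⊛-identityʳ (X ^ₚ v) v)) (trans (cong ((X ^ₚ v) ⊛ 1#) (sym (ℕₚ.+-identityʳ v))) (X^-high v 1# 0))

X^-other : ∀ v n → n ≢ v → (X ^ₚ v) n ≡ 0ℚ
X^-other zero zero n≢v = ⊥-elim (n≢v refl)
X^-other zero (suc n) _ = refl
X^-other (suc v) zero _ = X-⊛-zero (X ^ₚ v)
X^-other (suc v) (suc n) n≢v = trans (X-⊛-suc (X ^ₚ v) n) (X^-other v n (λ e → n≢v (cong suc e)))

geo-0 : ∀ {D} v n → 1 ≤ D → geo D v 0 n + - ((X ^ₚ D) ⊛ geo D v 0) n ≡ (X ^ₚ v) n
geo-0 {D} v n 1≤D = trans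
  (solveₚ 2 (λ g x → g :+ₚ (:-ₚ (x :*ₚ g)) :=ₚ ((conₚ 1ℚ :+ₚ (:-ₚ x)) :*ₚ conₚ 1ℚ) :*ₚ g) (λ _ → refl) (geo D v 0) (X ^ₚ D) n)
  (Q^⊛geo v 0 1≤D n)

geo-low : ∀ {D} v n → 1 ≤ D → n < D → geo D v 0 n ≡ (X ^ₚ v) n
geo-low {D} v n 1≤D n<D = trans (solve 1 (λ g → g := g :+ :- con 0ℚ) refl (geo D v 0 n))
  (trans (cong (λ t → geo D v 0 n + - t) (sym (X^-low D (geo D v 0) n n<D))) (geo-0 v n 1≤D))

geo-high : ∀ {D} v n → 1 ≤ D → geo D v 0 (D ℕ.+ n) ≡ geo D v 0 n + (X ^ₚ v) (D ℕ.+ n)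
geo-high {D} v n 1≤D = trans (solve 2 (λ a b → a := b :+ (a :+ :- b)) refl (g (D ℕ.+ n)) (g n))
  (cong (g n +_) (trans (cong (λ t → g (D ℕ.+ n) + - t) (sym (X^-high D g n))) (geo-0 v (D ℕ.+ n) 1≤D)))
  where g = geo D v 0

-- `1 ≤ n` matters for v = D: there the coefficient is 0 at n = 0 but 1 at n = D.
geo-period : ∀ {D} v n → 1 ≤ D → v ≤ D → 1 ≤ n → geo D v 0 (D ℕ.+ n) ≡ geo D v 0 n
geo-period {D} v n 1≤D v≤D 1≤n = trans (geo-high v n 1≤D)
  (trans (cong (geo D v 0 n +_) (X^-other v (D ℕ.+ n) (λ e → ℕₚ.<⇒≢ v<D+n (sym e)))) (ℚₚ.+-identityʳ _))
  where
  v<D+n : v < D ℕ.+ n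
  v<D+n = ℕₚ.≤-<-trans v≤D (ℕₚ.≤-trans (ℕₚ.≤-reflexive (ℕₚ.+-comm 1 D)) (ℕₚ.+-monoʳ-≤ D 1≤n))

geo-residue : ∀ {D} v n t → 1 ≤ D → 1 ≤ v → v ≤ D → 1 ≤ n → n ≤ D → geo D v 0 (t ℕ.* D ℕ.+ n) ≡ (X ^ₚ v) n
geo-residue {D} v n zero 1≤D 1≤v v≤D 1≤n n≤D with ℕₚ.m≤n⇒m<n∨m≡n n≤D
... | inj₁ n<D = geo-low v n 1≤D n<D
... | inj₂ refl = begin
  geo D v 0 D                         ≡⟨ cong (geo D v 0) (ℕₚ.+-identityʳ D) ⟨
  geo D v 0 (D ℕ.+ 0)                 ≡⟨ geo-high v 0 1≤D ⟩
  geo D v 0 0 + (X ^ₚ v) (D ℕ.+ 0)    ≡⟨ cong₂ _+_ (trans (geo-low v 0 1≤D 1≤D) (X^-other v 0 (ℕₚ.<⇒≢ 1≤v))) (cong (X ^ₚ v) (ℕₚ.+-identityʳ D)) ⟩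
  0ℚ + (X ^ₚ v) D                     ≡⟨ ℚₚ.+-identityˡ _ ⟩
  (X ^ₚ v) D                          ∎
  where open ≡-Reasoning
geo-residue {D} v n (suc t) 1≤D 1≤v v≤D 1≤n n≤D = begin
  geo D v 0 (D ℕ.+ t ℕ.* D ℕ.+ n)     ≡⟨ cong (geo D v 0) (ℕₚ.+-assoc D (t ℕ.* D) n) ⟩
  geo D v 0 (D ℕ.+ (t ℕ.* D ℕ.+ n))   ≡⟨ geo-period v (t ℕ.* D ℕ.+ n) 1≤D v≤D (ℕₚ.≤-trans 1≤n (ℕₚ.m≤n+m n (t ℕ.* D))) ⟩
  geo D v 0 (t ℕ.* D ℕ.+ n)           ≡⟨ geo-residue v n t 1≤D 1≤v v≤D 1≤n n≤D ⟩
  (X ^ₚ v) n                          ∎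
  where open ≡-Reasoning

geo-power : ∀ D v m n → geo D v m n ≡ (ℕ→ℚ n ^ m) * geo D v 0 n
geo-power D v zero n = sym (ℚₚ.*-identityˡ (geo D v 0 n))
geo-power D v (suc m) n = trans (cong (ℕ→ℚ n *_) (geo-power D v m n)) (sym (ℚₚ.*-assoc (ℕ→ℚ n) (ℕ→ℚ n ^ m) (geo D v 0 n)))

-- At an exponent n ≡ v₀ mod D only the column v₀ survives and contributes n^m, so combinations of
-- columns are quasi-polynomials in n.
Σ-geo : ∀ {D} (c : Fin D → ℚ) m t v₀ → 1 ≤ D →
  Σ D (λ v → c v * geo D (suc (toℕ v)) m (t ℕ.* D ℕ.+ suc (toℕ v₀))) ≡ c v₀ * (ℕ→ℚ (t ℕ.* D ℕ.+ suc (toℕ v₀)) ^ m)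
Σ-geo {D} c m t v₀ 1≤D = trans (Σ-single D v₀ off) (trans (cong (c v₀ *_) (value v₀))
    (cong (c v₀ *_) (trans (cong ((ℕ→ℚ n ^ m) *_) (X^-self (suc (toℕ v₀)))) (ℚₚ.*-identityʳ (ℕ→ℚ n ^ m)))))
  where
  n = t ℕ.* D ℕ.+ suc (toℕ v₀)
  value : ∀ v → geo D (suc (toℕ v)) m n ≡ (ℕ→ℚ n ^ m) * (X ^ₚ suc (toℕ v)) (suc (toℕ v₀))
  value v = trans (geo-power D (suc (toℕ v)) m n) (cong ((ℕ→ℚ n ^ m) *_)
    (geo-residue (suc (toℕ v)) (suc (toℕ v₀)) t 1≤D (s≤s z≤n) (Finₚ.toℕ<n v) (s≤s z≤n) (Finₚ.toℕ<n v₀)))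
  off : ∀ v → v ≢ v₀ → c v * geo D (suc (toℕ v)) m n ≡ 0ℚ
  off v v≢v₀ = trans (cong (c v *_) (trans (value v)
      (cong ((ℕ→ℚ n ^ m) *_) (X^-other (suc (toℕ v)) (suc (toℕ v₀)) (λ e → v≢v₀ (sym (Finₚ.toℕ-injective (ℕₚ.suc-injective e))))))))
    (solve 2 (λ a b → a :* (b :* con 0ℚ) := con 0ℚ) refl (c v) (ℕ→ℚ n ^ m))

-- Linear combinations of the basis series

Σₚ : ∀ n → (Fin n → PS) → PS
Σₚ n F k = Σ n (λ i → F i k)

⊛-Σₚ : ∀ n f F → f ⊛ Σₚ n F ≈ Σₚ n (λ i → f ⊛ F i)
⊛-Σₚ zero f F = ⊛-zeroʳ f
⊛-Σₚ (suc n) f F k = trans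
  (solveₚ 3 (λ f g s → f :*ₚ (g :+ₚ s) :=ₚ (f :*ₚ g) :+ₚ (f :*ₚ s)) (λ _ → refl) f (F Fin.zero) (Σₚ n (λ i → F (Fin.suc i))) k)
  (cong ((f ⊛ F Fin.zero) k +_) (⊛-Σₚ n f (λ i → F (Fin.suc i)) k))

⟿-Σₚ : ∀ n {F G} → (∀ i → F i ⟿ G i) → Σₚ n F ⟿ Σₚ n G
⟿-Σₚ zero p = nil (λ _ → refl) (λ _ → refl)
⟿-Σₚ (suc n) p = ⟿-⊕ (p Fin.zero) (⟿-Σₚ n (λ i → p (Fin.suc i)))

combination : ∀ r D → (Fin r → Fin D → ℚ) → (Fin r → Fin D → PS) → PS
combination r D c F = Σₚ r (λ m → Σₚ D (λ v → constant (c m v) ⊛ F m v))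

⊛-combination : ∀ r D c f F → f ⊛ combination r D c F ≈ combination r D c (λ m v → f ⊛ F m v)
⊛-combination r D c f F k = trans (⊛-Σₚ r f (λ m → Σₚ D (λ v → constant (c m v) ⊛ F m v)) k)
  (Σ-cong r (λ m → trans (⊛-Σₚ D f (λ v → constant (c m v) ⊛ F m v) k)
    (Σ-cong D (λ v → solveₚ 3 (λ f c g → f :*ₚ (c :*ₚ g) :=ₚ c :*ₚ (f :*ₚ g)) (λ _ → refl) f (constant (c m v)) (F m v) k))))

combination-cong : ∀ r D c {F G} → (∀ m v → F m v ≈ G m v) → combination r D c F ≈ combination r D c G
combination-cong r D c eq k = Σ-cong r (λ m → Σ-cong D (λ v → ⊛-congˡ (constant (c m v)) (eq m v) k))

combination-coefficient : ∀ r D c F k → combination r D c F k ≡ Σ r (λ m → Σ D (λ v → c m v * F m v k))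
combination-coefficient r D c F k = Σ-cong r (λ m → Σ-cong D (λ v → constant-⊛ (c m v) (F m v) k))

-- Everything is brought to the common denominator (1 - q^D)^{r+A}; the exponents m + A instead of m
-- allow for the restriction to large α.

numerator numeratorₑ geometric laurent : (r D A : ℕ) → Fin r → Fin D → PS
numerator r D A m v = (Q D ^ₚ (r ℕ.∸ suc (toℕ m))) ⊛ num D (suc (toℕ v)) (toℕ m ℕ.+ A)
numeratorₑ r D A m v = (Qₑ D ^ₚ (r ℕ.∸ suc (toℕ m))) ⊛ numₑ D (suc (toℕ v)) (toℕ m ℕ.+ A)
geometric r D A m v = geo D (suc (toℕ v)) (toℕ m ℕ.+ A)
laurent r D A m v = (X ^ₚ (r ℕ.∸ suc (toℕ m))) ⊛ lau D (suc (toℕ v)) (toℕ m ℕ.+ A)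

exponent-split : ∀ {r} A (m : Fin r) → r ℕ.+ A ≡ (r ℕ.∸ suc (toℕ m)) ℕ.+ suc (toℕ m ℕ.+ A)
exponent-split {r} A m = begin
  r ℕ.+ A                                              ≡⟨ cong (ℕ._+ A) (ℕₚ.m∸n+n≡m (Finₚ.toℕ<n m)) ⟨
  (r ℕ.∸ suc (toℕ m)) ℕ.+ suc (toℕ m) ℕ.+ A            ≡⟨ ℕₚ.+-assoc (r ℕ.∸ suc (toℕ m)) (suc (toℕ m)) A ⟩
  (r ℕ.∸ suc (toℕ m)) ℕ.+ suc (toℕ m ℕ.+ A)            ∎
  where open ≡-Reasoning

^ₚ-split : ∀ {r} f A (m : Fin r) → f ^ₚ (r ℕ.+ A) ≈ (f ^ₚ (r ℕ.∸ suc (toℕ m))) ⊛ (f ^ₚ suc (toℕ m ℕ.+ A))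
^ₚ-split {r} f A m n = trans (cong (λ j → (f ^ₚ j) n) (exponent-split A m)) (^ₚ-+ f (r ℕ.∸ suc (toℕ m)) (suc (toℕ m ℕ.+ A)) n)

Q^⊛geometric : ∀ r {D} A c → 1 ≤ D →
  (Q D ^ₚ (r ℕ.+ A)) ⊛ combination r D c (geometric r D A) ≈ combination r D c (numerator r D A)
Q^⊛geometric r {D} A c 1≤D = ≈-trans (⊛-combination r D c (Q D ^ₚ (r ℕ.+ A)) (geometric r D A)) (combination-cong r D c each)
  where
  open import Relation.Binary.Reasoning.Setoid setoid
  each : ∀ m v → (Q D ^ₚ (r ℕ.+ A)) ⊛ geometric r D A m v ≈ numerator r D A m v
  each m v = begin
    (Q D ^ₚ (r ℕ.+ A)) ⊛ g        ≈⟨ ⊛-congʳ g (^ₚ-split (Q D) A m) ⟩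
    (q₁ ⊛ q₂) ⊛ g                 ≈⟨ ⊛-assoc q₁ q₂ g ⟩
    q₁ ⊛ (q₂ ⊛ g)                 ≈⟨ ⊛-congˡ q₁ (Q^⊛geo (suc (toℕ v)) (toℕ m ℕ.+ A) 1≤D) ⟩
    numerator r D A m v           ∎
    where
    g = geometric r D A m v
    q₁ = Q D ^ₚ (r ℕ.∸ suc (toℕ m))
    q₂ = Q D ^ₚ suc (toℕ m ℕ.+ A)

Qₑ^⊛laurent : ∀ r {D} A c → 1 ≤ D →
  (Qₑ D ^ₚ (r ℕ.+ A)) ⊛ combination r D c (laurent r D A) ≈ (X ^ₚ (r ℕ.+ A)) ⊛ combination r D c (numeratorₑ r D A)
Qₑ^⊛laurent r {D} A c 1≤D = ≈-trans (⊛-combination r D c (Qₑ D ^ₚ (r ℕ.+ A)) (laurent r D A))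
  (≈-trans (combination-cong r D c each) (≈-sym (⊛-combination r D c (X ^ₚ (r ℕ.+ A)) (numeratorₑ r D A))))
  where
  open import Relation.Binary.Reasoning.Setoid setoid
  each : ∀ m v → (Qₑ D ^ₚ (r ℕ.+ A)) ⊛ laurent r D A m v ≈ (X ^ₚ (r ℕ.+ A)) ⊛ numeratorₑ r D A m v
  each m v = begin
    (Qₑ D ^ₚ (r ℕ.+ A)) ⊛ (x₁ ⊛ w)      ≈⟨ ⊛-congʳ (x₁ ⊛ w) (^ₚ-split (Qₑ D) A m) ⟩
    (q₁ ⊛ q₂) ⊛ (x₁ ⊛ w)                ≈⟨ solveₚ 4 (λ q p x w → (q :*ₚ p) :*ₚ (x :*ₚ w) :=ₚ (q :*ₚ x) :*ₚ (p :*ₚ w)) (λ _ → refl) q₁ q₂ x₁ w ⟩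
    (q₁ ⊛ x₁) ⊛ (q₂ ⊛ w)                ≈⟨ ⊛-congˡ (q₁ ⊛ x₁) (Qₑ^⊛lau (suc (toℕ v)) (toℕ m ℕ.+ A) 1≤D) ⟩
    (q₁ ⊛ x₁) ⊛ (x₂ ⊛ n)                ≈⟨ solveₚ 4 (λ q x y n → (q :*ₚ x) :*ₚ (y :*ₚ n) :=ₚ (x :*ₚ y) :*ₚ (q :*ₚ n)) (λ _ → refl) q₁ x₁ x₂ n ⟩
    (x₁ ⊛ x₂) ⊛ (q₁ ⊛ n)                ≈⟨ ⊛-congʳ (q₁ ⊛ n) (^ₚ-split X A m) ⟨
    (X ^ₚ (r ℕ.+ A)) ⊛ (q₁ ⊛ n)         ∎
    where
    w = lau D (suc (toℕ v)) (toℕ m ℕ.+ A)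
    n = numₑ D (suc (toℕ v)) (toℕ m ℕ.+ A)
    q₁ = Qₑ D ^ₚ (r ℕ.∸ suc (toℕ m))
    q₂ = Qₑ D ^ₚ suc (toℕ m ℕ.+ A)
    x₁ = X ^ₚ (r ℕ.∸ suc (toℕ m))
    x₂ = X ^ₚ suc (toℕ m ℕ.+ A)

numerator⟿numeratorₑ : ∀ r D A m v → numerator r D A m v ⟿ numeratorₑ r D A m v
numerator⟿numeratorₑ r D A m v = ⟿-⊛ (⟿-^ (r ℕ.∸ suc (toℕ m)) (Q⟿Qₑ D)) (num⟿numₑ D (suc (toℕ v)) (toℕ m ℕ.+ A))

combination-⟿ : ∀ r D c {F G} → (∀ m v → F m v ⟿ G m v) → combination r D c F ⟿ combination r D c G
combination-⟿ r D c p = ⟿-Σₚ r (λ m → ⟿-Σₚ D (λ v → ⟿-· (c m v) (p m v)))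

-- In `laurent` every column carries the same factor z^(r+A), so the coefficient of z^k sits at
-- index k + (r + A) for all m, and row `suc k` becomes a single coefficient of the combination.
laurent-coefficient : ∀ r {D} A c k → 1 ≤ D →
  Σ r (λ m → Σ D (λ v → c m v * entry D (suc k) (toℕ m ℕ.+ A) (suc (toℕ v))))
    ≡ - (ℕ→ℚ D * (ℕ→ℚ (k !) * combination r D c (laurent r D A) (k ℕ.+ (r ℕ.+ A))))
laurent-coefficient r {D} A c k 1≤D = begin
  Σ r (λ m → Σ D (λ v → c m v * entry D (suc k) (toℕ m ℕ.+ A) (suc (toℕ v))))
    ≡⟨ Σ-cong r (λ m → trans (Σ-cong D (λ v → each m v)) (Σ-*ˡ D s (λ v → c m v * laurent r D A m v M))) ⟩
  Σ r (λ m → s * Σ D (λ v → c m v * laurent r D A m v M))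
    ≡⟨ Σ-*ˡ r s (λ m → Σ D (λ v → c m v * laurent r D A m v M)) ⟩
  s * Σ r (λ m → Σ D (λ v → c m v * laurent r D A m v M))
    ≡⟨ cong (s *_) (combination-coefficient r D c (laurent r D A) M) ⟨
  s * W
    ≡⟨ solve 3 (λ d f w → (:- (d :* f)) :* w := :- (d :* (f :* w))) refl (ℕ→ℚ D) (ℕ→ℚ (k !)) W ⟩
  - (ℕ→ℚ D * (ℕ→ℚ (k !) * W)) ∎
  where
  open ≡-Reasoning
  M = k ℕ.+ (r ℕ.+ A)
  W = combination r D c (laurent r D A) M
  s = - (ℕ→ℚ D * ℕ→ℚ (k !))
  shift : ∀ m → M ≡ (r ℕ.∸ suc (toℕ m)) ℕ.+ (k ℕ.+ suc (toℕ m ℕ.+ A))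
  shift m = begin
    k ℕ.+ (r ℕ.+ A)                  ≡⟨ cong (k ℕ.+_) (exponent-split A m) ⟩
    k ℕ.+ (j ℕ.+ l)                  ≡⟨ ℕₚ.+-assoc k j l ⟨
    k ℕ.+ j ℕ.+ l                    ≡⟨ cong (ℕ._+ l) (ℕₚ.+-comm k j) ⟩
    j ℕ.+ k ℕ.+ l                    ≡⟨ ℕₚ.+-assoc j k l ⟩
    j ℕ.+ (k ℕ.+ l)                  ∎
    where
    j = r ℕ.∸ suc (toℕ m)
    l = suc (toℕ m ℕ.+ A)
  each : ∀ m v → c m v * entry D (suc k) (toℕ m ℕ.+ A) (suc (toℕ v)) ≡ s * (c m v * laurent r D A m v M)
  each m v = trans
    (cong (c m v *_) (trans (entry-lau k (toℕ m ℕ.+ A) (suc (toℕ v)) 1≤D)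
      (cong (λ t → - (ℕ→ℚ D * (ℕ→ℚ (k !) * t)))
        (sym (trans (cong (laurent r D A m v) (shift m)) (X^-high (r ℕ.∸ suc (toℕ m)) (lau D (suc (toℕ v)) (toℕ m ℕ.+ A)) (k ℕ.+ suc (toℕ m ℕ.+ A))))))))
    (solve 4 (λ c d f l → c :* (:- (d :* (f :* l))) := (:- (d :* f)) :* (c :* l)) refl (c m v) (ℕ→ℚ D) (ℕ→ℚ (k !)) (laurent r D A m v M))

-- Linear independence

common-support : ∀ n (F : Fin n → PS) → (∀ i → Σ[ N ∈ ℕ ] (∀ k → N ≤ k → F i k ≡ 0ℚ)) →
  Σ[ N ∈ ℕ ] (∀ i k → N ≤ k → F i k ≡ 0ℚ)
common-support zero F h = 0 , λ ()
common-support (suc n) F h with h Fin.zero | common-support n (λ i → F (Fin.suc i)) (λ i → h (Fin.suc i))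
... | N₁ , h₁ | N₂ , h₂ = N₁ ℕ.+ N₂ , λ
  { Fin.zero k p → h₁ k (ℕₚ.≤-trans (ℕₚ.m≤m+n N₁ N₂) p)
  ; (Fin.suc i) k p → h₂ i k (ℕₚ.≤-trans (ℕₚ.m≤n+m N₂ N₁) p) }

-- The support bound has to be uniform in the coefficients c.
combination-support : ∀ r D F → (∀ m v → Σ[ N ∈ ℕ ] (∀ k → N ≤ k → F m v k ≡ 0ℚ)) →
  Σ[ N ∈ ℕ ] (∀ c k → N ≤ k → combination r D c F k ≡ 0ℚ)
combination-support r D F h = N , λ c k N≤k → trans (combination-coefficient r D c F k)
  (Σ-zero r (λ m → Σ-zero D (λ v → trans (cong (c m v *_) (proj₂ (column m) v k (bound m k N≤k))) (ℚₚ.*-zeroʳ (c m v)))))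
  where
  column : ∀ m → Σ[ N ∈ ℕ ] (∀ v k → N ≤ k → F m v k ≡ 0ℚ)
  column m = common-support D (F m) (h m)
  maximum : ∀ n (f : Fin n → ℕ) → Σ[ N ∈ ℕ ] (∀ i → f i ≤ N)
  maximum zero f = 0 , λ ()
  maximum (suc n) f with maximum n (λ i → f (Fin.suc i))
  ... | N , b = f Fin.zero ℕ.+ N , λ { Fin.zero → ℕₚ.m≤m+n _ N ; (Fin.suc i) → ℕₚ.≤-trans (b i) (ℕₚ.m≤n+m N _) }
  N = proj₁ (maximum r (λ m → proj₁ (column m)))
  bound : ∀ m k → N ≤ k → proj₁ (column m) ≤ k
  bound m k = ℕₚ.≤-trans (proj₂ (maximum r (λ m → proj₁ (column m))) m)

⊛-zero-cancelˡ : ∀ f {g} → f 0 ≢ 0ℚ → f ⊛ g ≈ 0# → g ≈ 0#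
⊛-zero-cancelˡ f {g} f0≢0 eq = begin
  g                   ≈⟨ ⊛-identityˡ g ⟨
  1# ⊛ g              ≈⟨ ⊛-congʳ g (⊛-inverseʳ {f} f0≢0) ⟨
  (f ⊛ inv f) ⊛ g     ≈⟨ solveₚ 3 (λ f i g → (f :*ₚ i) :*ₚ g :=ₚ i :*ₚ (f :*ₚ g)) (λ _ → refl) f (inv f) g ⟩
  inv f ⊛ (f ⊛ g)     ≈⟨ ⊛-congˡ (inv f) eq ⟩
  inv f ⊛ 0#          ≈⟨ ⊛-zeroʳ (inv f) ⟩
  0#                  ∎
  where open import Relation.Binary.Reasoning.Setoid setoid

^ₚ-0 : ∀ f n → (f ^ₚ n) 0 ≡ f 0 ^ n
^ₚ-0 f zero = refl
^ₚ-0 f (suc n) = trans (ℚₚ.+-identityʳ _) (cong (f 0 *_) (^ₚ-0 f n))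

truncate : ℕ → PS → PS
truncate M f n with n ℕ.<? M
... | yes _ = f n
... | no _ = 0ℚ

truncate-≥ : ∀ M f n → M ≤ n → truncate M f n ≡ 0ℚ
truncate-≥ M f n M≤n with n ℕ.<? M
... | yes n<M = ⊥-elim (ℕₚ.<⇒≱ n<M M≤n)
... | no _ = refl

truncate-agrees : ∀ M f n → (M ≤ n → f n ≡ 0ℚ) → truncate M f n ≡ f n
truncate-agrees M f n h with n ℕ.<? M
... | yes _ = refl
... | no n≮M = sym (h (ℕₚ.≮⇒≥ n≮M))

-- A Laurent series equal to a rational function of e^z whose regular part vanishes to high order:
-- comparing the coefficients of zᴹ e^{kz} in  Qₑᴹ P - zᴹ Nₑ, where deg P < M, shows Nₑ = 0.
no-regular-part : ∀ M N {q qₑ n nₑ W} → q ⟿ qₑ → n ⟿ nₑ → (∀ k → N ≤ k → q k ≡ 0ℚ) → (∀ k → N ≤ k → n k ≡ 0ℚ) →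
  qₑ ⊛ W ≈ (X ^ₚ M) ⊛ nₑ → (∀ k → k < N ℕ.* suc M → W (k ℕ.+ M) ≡ 0ℚ) → n ≈ 0#
no-regular-part M N {q} {qₑ} {n} {nₑ} {W} q⟿ n⟿ q-supp n-supp eq W≡0 k with k ℕ.<? N
... | no k≮N = n-supp k (ℕₚ.≮⇒≥ k≮N)
... | yes k<N = begin
  -- As P has degree below M, the coefficient of z^M in `a k` is exactly -n k; `aₖM` says that it
  -- vanishes.
  n k                                                           ≡⟨ solve 2 (λ x y → x := y :+ :- (y :+ :- x)) refl (n k) (P M * q k) ⟩
  P M * q k + - (P M * q k + - n k)                             ≡⟨ cong₂ (λ x y → x * q k + - y) (truncate-≥ M W M ℕₚ.≤-refl) aₖM ⟩
  0ℚ * q k + - 0ℚ                                               ≡⟨ solve 1 (λ x → con 0ℚ :* x :+ :- con 0ℚ := con 0ℚ) refl (q k) ⟩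
  0ℚ                                                            ∎
  where
  open ≡-Reasoning
  -- P / z^M is the polar part of the Laurent series W / z^M.
  P = truncate M W
  a : ℕ → PS
  a k = (P ⊛ constant (q k)) ⊕ ((⊖ (X ^ₚ M)) ⊛ constant (n k))
  a-coefficient : ∀ k i → a k i ≡ q k * P i + n k * - (X ^ₚ M) i
  a-coefficient k i = cong₂ _+_ (trans (⊛-comm P (constant (q k)) i) (constant-⊛ (q k) P i))
    (trans (⊛-comm (⊖ (X ^ₚ M)) (constant (n k)) i) (constant-⊛ (n k) (⊖ (X ^ₚ M)) i))
  deg : ∀ k → Degree≤ M (a k)
  deg k i M<i = trans (a-coefficient k i) (trans
    (cong₂ (λ x y → q k * x + n k * - y) (truncate-≥ M W i (ℕₚ.<⇒≤ M<i)) (X^-other M i (λ e → ℕₚ.<⇒≢ M<i (sym e))))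
    (solve 2 (λ x y → x :* con 0ℚ :+ y :* (:- con 0ℚ) := con 0ℚ) refl (q k) (n k)))
  expPoly-a : expPoly N a ≈ (P ⊛ qₑ) ⊕ ((⊖ (X ^ₚ M)) ⊛ nₑ)
  expPoly-a = ≈-trans (expPoly-⊕ N (λ k → P ⊛ constant (q k)) (λ k → (⊖ (X ^ₚ M)) ⊛ constant (n k)))
    (⊕-cong (≈-trans (expPoly-⊛ N P (λ k → constant (q k))) (⊛-congˡ P (≈-sym (⟿-expPoly N q⟿ q-supp))))
            (≈-trans (expPoly-⊛ N (⊖ (X ^ₚ M)) (λ k → constant (n k))) (⊛-congˡ (⊖ (X ^ₚ M)) (≈-sym (⟿-expPoly N n⟿ n-supp)))))
  -- From index M up to the bound, W vanishes by hypothesis, so the truncation loses nothing there.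
  P≡W : ∀ i → i < N ℕ.* suc M → P i ≡ W i
  P≡W i i<B = truncate-agrees M W i (λ M≤i → trans (cong W (sym (ℕₚ.m∸n+n≡m M≤i))) (W≡0 (i ℕ.∸ M) (ℕₚ.≤-<-trans (ℕₚ.m∸n≤m i M) i<B)))
  vanishes : Vanishes (N ℕ.* suc M) (expPoly N a)
  vanishes i i<B = trans (expPoly-a i) (begin
    (P ⊛ qₑ) i + ((⊖ (X ^ₚ M)) ⊛ nₑ) i        ≡⟨ cong₂ _+_ (⊛-cong-≤ {P} {W} {qₑ} {qₑ} i (λ j j≤i → P≡W j (ℕₚ.≤-<-trans j≤i i<B)) (λ _ _ → refl))
                                                   (solveₚ 2 (λ x n → (:-ₚ x) :*ₚ n :=ₚ :-ₚ (x :*ₚ n)) (λ _ → refl) (X ^ₚ M) nₑ i) ⟩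
    (W ⊛ qₑ) i + - ((X ^ₚ M) ⊛ nₑ) i          ≡⟨ cong (_+ - ((X ^ₚ M) ⊛ nₑ) i) (trans (⊛-comm W qₑ i) (eq i)) ⟩
    ((X ^ₚ M) ⊛ nₑ) i + - ((X ^ₚ M) ⊛ nₑ) i   ≡⟨ ℚₚ.+-inverseʳ (((X ^ₚ M) ⊛ nₑ) i) ⟩
    0ℚ                                        ∎)
  aₖM : P M * q k + - n k ≡ 0ℚ
  aₖM = trans (trans (solve 3 (λ p q n → p :* q :+ :- n := q :* p :+ n :* (:- con 1ℚ)) refl (P M) (q k) (n k))
      (trans (cong (λ t → q k * P M + n k * - t) (sym (X^-self M))) (sym (a-coefficient k M))))
    (expPoly-injective N deg vanishes k k<N M)

-- Vanishing rows force `G c ≈ 0#`. On the residue class of v the coefficients of G are n^A times a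
-- polynomial in n, which thus has the infinitely many roots n = tD + v > 0; its coefficients are
-- the c m v.
independence : ∀ r D A → 1 ≤ D → Σ[ B ∈ ℕ ] (∀ (c : Fin r → Fin D → ℚ) →
  (∀ k → k < B → Σ r (λ m → Σ D (λ v → c m v * entry D (suc k) (toℕ m ℕ.+ A) (suc (toℕ v)))) ≡ 0ℚ) → ∀ m v → c m v ≡ 0ℚ)
independence r D A 1≤D = N ℕ.* suc M , λ c eq m v → c≡0 c (G≡0 c eq) m v
  where
  M = r ℕ.+ A
  supp-Q = ⟿-support (⟿-^ M (Q⟿Qₑ D))
  supp-N = combination-support r D (numerator r D A) (λ m v → ⟿-support (numerator⟿numeratorₑ r D A m v))
  N = proj₁ supp-Q ℕ.+ proj₁ supp-N
  G : (Fin r → Fin D → ℚ) → PS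
  G c = combination r D c (geometric r D A)
  G≡0 : ∀ c → (∀ k → k < N ℕ.* suc M → Σ r (λ m → Σ D (λ v → c m v * entry D (suc k) (toℕ m ℕ.+ A) (suc (toℕ v)))) ≡ 0ℚ) → G c ≈ 0#
  G≡0 c eq = ⊛-zero-cancelˡ (Q D ^ₚ M) (λ e → ^-≢0 M (Q≢0 1≤D) (trans (sym (^ₚ-0 (Q D) M)) e))
    (≈-trans (Q^⊛geometric r A c 1≤D)
      (no-regular-part M N (⟿-^ M (Q⟿Qₑ D)) (combination-⟿ r D c (numerator⟿numeratorₑ r D A))
        (λ k N≤k → proj₂ supp-Q k (ℕₚ.≤-trans (ℕₚ.m≤m+n _ (proj₁ supp-N)) N≤k))
        (λ k N≤k → proj₂ supp-N c k (ℕₚ.≤-trans (ℕₚ.m≤n+m _ (proj₁ supp-Q)) N≤k))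
        (Qₑ^⊛laurent r A c 1≤D)
        (λ k k<B → *-zero-cancelˡ (*-≢0 (ℕ→ℚ≢0 1≤D) (!≢0 k))
          (trans (solve 3 (λ d f w → d :* f :* w := :- (:- (d :* (f :* w)))) refl (ℕ→ℚ D) (ℕ→ℚ (k !)) (combination r D c (laurent r D A) (k ℕ.+ M)))
            (cong -_ (trans (sym (laurent-coefficient r A c k 1≤D)) (eq k k<B)))))))
  c≡0 : ∀ c → G c ≈ 0# → ∀ m v → c m v ≡ 0ℚ
  c≡0 c G≈0 m v = polynomial-injective r (λ m → c m v) x distinct root m
    where
    x : ℕ → ℚ
    x t = ℕ→ℚ (t ℕ.* D ℕ.+ suc (toℕ v))
    distinct : ∀ s t → s ≢ t → x s + - x t ≢ 0ℚ
    distinct s t s≢t = ℕ→ℚ-difference≢0 (λ e → s≢t (ℕₚ.*-cancelʳ-≡ s t D {{ℕ.>-nonZero 1≤D}} (ℕₚ.+-cancelʳ-≡ (suc (toℕ v)) (s ℕ.* D) (t ℕ.* D) e)))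
    root : ∀ t → polynomial r (λ m → c m v) (x t) ≡ 0ℚ
    root t = *-zero-cancelˡ (^-≢0 A (ℕ→ℚ≢0 (ℕₚ.≤-trans (s≤s z≤n) (ℕₚ.m≤n+m (suc (toℕ v)) (t ℕ.* D))))) (begin
      (x t ^ A) * polynomial r (λ m → c m v) (x t)
        ≡⟨ Σ-*ˡ r (x t ^ A) (λ m → c m v * (x t ^ toℕ m)) ⟨
      Σ r (λ m → (x t ^ A) * (c m v * (x t ^ toℕ m)))
        ≡⟨ Σ-cong r (λ m → trans (solve 3 (λ a c b → a :* (c :* b) := c :* (b :* a)) refl (x t ^ A) (c m v) (x t ^ toℕ m))
             (trans (cong (c m v *_) (sym (^-+ (x t) (toℕ m) A))) (sym (Σ-geo (c m) (toℕ m ℕ.+ A) t v 1≤D)))) ⟩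
      Σ r (λ m → Σ D (λ v′ → c m v′ * geometric r D A m v′ (t ℕ.* D ℕ.+ suc (toℕ v))))
        ≡⟨ combination-coefficient r D c (geometric r D A) (t ℕ.* D ℕ.+ suc (toℕ v)) ⟨
      G c (t ℕ.* D ℕ.+ suc (toℕ v))
        ≡⟨ G≈0 (t ℕ.* D ℕ.+ suc (toℕ v)) ⟩
      0ℚ ∎)
      where open ≡-Reasoning

-- Determinants

det-cong : ∀ n {M N : Fin n → Fin n → ℚ} → (∀ i j → M i j ≡ N i j) → det n M ≡ det n N
det-cong zero eq = refl
det-cong (suc n) eq = Σ-cong (suc n) (λ j → cong₂ (λ x y → ((- 1ℚ) ^ toℕ j) * x * y) (eq Fin.zero j)
  (det-cong n (λ i k → eq (Fin.suc i) (punchIn j k))))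

swap : ∀ {n} → Fin n → Fin (suc n) → Fin (suc n)
swap Fin.zero Fin.zero = Fin.suc Fin.zero
swap Fin.zero (Fin.suc Fin.zero) = Fin.zero
swap Fin.zero (Fin.suc (Fin.suc k)) = Fin.suc (Fin.suc k)
swap (Fin.suc j) Fin.zero = Fin.zero
swap (Fin.suc j) (Fin.suc k) = Fin.suc (swap j k)

Σ-swap : ∀ {n} (j : Fin n) (f : Fin (suc n) → ℚ) → Σ (suc n) (λ k → f (swap j k)) ≡ Σ (suc n) f
Σ-swap {suc n} Fin.zero f = solve 3 (λ a b c → b :+ (a :+ c) := a :+ (b :+ c)) refl
  (f Fin.zero) (f (Fin.suc Fin.zero)) (Σ n (λ k → f (Fin.suc (Fin.suc k))))
Σ-swap {suc n} (Fin.suc j) f = cong (f Fin.zero +_) (Σ-swap j (λ k → f (Fin.suc k)))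

-- Expansion along the first row under an adjacent transposition: if k is not one of the two
-- columns, the transposition passes to the minor; if it is, the minor stays and the sign changes.
data SwapMinor {n} (j : Fin (suc n)) (k : Fin (suc (suc n))) : Set where
  fixed : (j′ : Fin n) → swap j k ≡ k → (∀ l → swap j (punchIn k l) ≡ punchIn k (swap j′ l)) → SwapMinor j k
  moved : (- 1ℚ) ^ toℕ k ≡ - ((- 1ℚ) ^ toℕ (swap j k)) → (∀ l → swap j (punchIn k l) ≡ punchIn (swap j k) l) → SwapMinor j k

swapMinor : ∀ {n} (j : Fin (suc n)) k → SwapMinor j k
swapMinor Fin.zero Fin.zero = moved refl (λ { Fin.zero → refl ; (Fin.suc l) → refl })
swapMinor Fin.zero (Fin.suc Fin.zero) = moved refl (λ { Fin.zero → refl ; (Fin.suc l) → refl })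
swapMinor {suc n} Fin.zero (Fin.suc (Fin.suc k)) = fixed Fin.zero refl
  (λ { Fin.zero → refl ; (Fin.suc Fin.zero) → refl ; (Fin.suc (Fin.suc l)) → refl })
swapMinor (Fin.suc j) Fin.zero = fixed j refl (λ l → refl)
swapMinor {suc n} (Fin.suc j) (Fin.suc k) with swapMinor j k
... | fixed j′ e h = fixed (Fin.suc j′) (cong Fin.suc e) (λ { Fin.zero → refl ; (Fin.suc l) → cong Fin.suc (h l) })
... | moved e h = moved (trans (cong (- 1ℚ *_) e) (sym (ℚₚ.neg-distribʳ-* (- 1ℚ) ((- 1ℚ) ^ toℕ (swap j k)))))
  (λ { Fin.zero → refl ; (Fin.suc l) → cong Fin.suc (h l) })

det-swap : ∀ n (j : Fin n) (M : Fin (suc n) → Fin (suc n) → ℚ) → det (suc n) (λ i k → M i (swap j k)) ≡ - det (suc n) M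
det-swap (suc n) j M = begin
  Σ (suc (suc n)) (λ k → sgn k * M₀ (swap j k) * det (suc n) (λ i l → M (Fin.suc i) (swap j (punchIn k l))))
    ≡⟨ Σ-cong (suc (suc n)) each ⟩
  Σ (suc (suc n)) (λ k → - 1ℚ * f (swap j k))
    ≡⟨ Σ-*ˡ (suc (suc n)) (- 1ℚ) (λ k → f (swap j k)) ⟩
  - 1ℚ * Σ (suc (suc n)) (λ k → f (swap j k))
    ≡⟨ cong (- 1ℚ *_) (Σ-swap j f) ⟩
  - 1ℚ * Σ (suc (suc n)) f
    ≡⟨ solve 1 (λ x → (:- con 1ℚ) :* x := :- x) refl (Σ (suc (suc n)) f) ⟩
  - Σ (suc (suc n)) f ∎
  where
  open ≡-Reasoning
  sgn : Fin (suc (suc n)) → ℚ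
  sgn k = (- 1ℚ) ^ toℕ k
  M₀ = M Fin.zero
  minor : Fin (suc (suc n)) → ℚ
  minor k = det (suc n) (λ i l → M (Fin.suc i) (punchIn k l))
  f : Fin (suc (suc n)) → ℚ
  f k = sgn k * M₀ k * minor k
  each : ∀ k → sgn k * M₀ (swap j k) * det (suc n) (λ i l → M (Fin.suc i) (swap j (punchIn k l))) ≡ - 1ℚ * f (swap j k)
  each k with swapMinor j k
  ... | fixed j′ e h = trans
    (cong (sgn k * M₀ (swap j k) *_) (trans (det-cong (suc n) (λ i l → cong (M (Fin.suc i)) (h l)))
      (det-swap n j′ (λ i l → M (Fin.suc i) (punchIn k l)))))
    (trans (cong (λ t → sgn k * M₀ t * - minor k) e)
      (trans (solve 3 (λ s x d → s :* x :* (:- d) := (:- con 1ℚ) :* (s :* x :* d)) refl (sgn k) (M₀ k) (minor k))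
        (cong (λ t → - 1ℚ * f t) (sym e))))
  ... | moved e h = trans
    (cong₂ (λ s d → s * M₀ (swap j k) * d) e (det-cong (suc n) (λ i l → cong (M (Fin.suc i)) (h l))))
    (solve 3 (λ s x d → (:- s) :* x :* d := (:- con 1ℚ) :* (s :* x :* d)) refl (sgn (swap j k)) (M₀ (swap j k)) (minor (swap j k)))

self-negative : ∀ {x} → x ≡ - x → x ≡ 0ℚ
self-negative {x} eq = *-zero-cancelˡ {1ℚ + 1ℚ} (ℕ→ℚ-suc≢0 1) (trans (solve 1 (λ x → (con 1ℚ :+ con 1ℚ) :* x := x :+ x) refl x)
  (trans (cong (x +_) eq) (ℚₚ.+-inverseʳ x)))

swap-inject₁ : ∀ {n} (j : Fin n) → swap j (inject₁ j) ≡ Fin.suc j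
swap-inject₁ Fin.zero = refl
swap-inject₁ (Fin.suc j) = cong Fin.suc (swap-inject₁ j)

-- Adjacent transpositions move the equal column next to column 0, where antisymmetry applies. The
-- recursion runs on t because `inject₁ j` is not a subterm.
det-equal-columns : ∀ n t (j : Fin n) (M : Fin (suc n) → Fin (suc n) → ℚ) → toℕ j ≡ t →
  (∀ i → M i Fin.zero ≡ M i (Fin.suc j)) → det (suc n) M ≡ 0ℚ
det-equal-columns (suc n) zero Fin.zero M refl eq = self-negative (trans (sym (det-cong (suc (suc n)) same)) (det-swap (suc n) Fin.zero M))
  where
  same : ∀ i k → M i (swap Fin.zero k) ≡ M i k
  same i Fin.zero = sym (eq i)
  same i (Fin.suc Fin.zero) = eq i
  same i (Fin.suc (Fin.suc k)) = refl
det-equal-columns (suc n) (suc t) (Fin.suc j) M e eq = begin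
  det (suc (suc n)) M                                           ≡⟨ solve 1 (λ x → x := :- (:- x)) refl (det (suc (suc n)) M) ⟩
  - - det (suc (suc n)) M                                       ≡⟨ cong -_ (det-swap (suc n) (Fin.suc j) M) ⟨
  - det (suc (suc n)) (λ i k → M i (swap (Fin.suc j) k))        ≡⟨ cong -_ (det-equal-columns (suc n) t (inject₁ j) (λ i k → M i (swap (Fin.suc j) k))
                                                                     (trans (Finₚ.toℕ-inject₁ j) (ℕₚ.suc-injective e))
                                                                     (λ i → trans (eq i) (cong (λ k → M i (Fin.suc k)) (sym (swap-inject₁ j))))) ⟩
  0ℚ                                                            ∎
  where open ≡-Reasoning

-- In the first-row expansion the term of column 0 is linear at once; every other minor keeps column
-- 0 as its own first column, whence the recursion.
det-linear : ∀ n x (u u′ : Fin (suc n) → ℚ) (N : Fin (suc n) → Fin n → ℚ) →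
  det (suc n) (λ i → (x * u i + u′ i) Vector.∷ N i) ≡ x * det (suc n) (λ i → u i Vector.∷ N i) + det (suc n) (λ i → u′ i Vector.∷ N i)
det-linear n x u u′ N = begin
  1ℚ * (x * u₀ + u′₀) * d + Σ n (λ j → term j (λ i → x * u i + u′ i))
    ≡⟨ cong (1ℚ * (x * u₀ + u′₀) * d +_) (trans (Σ-cong n each) (trans (Σ-+ n (λ j → x * term j u) (λ j → term j u′))
         (cong (_+ Σ n (λ j → term j u′)) (Σ-*ˡ n x (λ j → term j u))))) ⟩
  1ℚ * (x * u₀ + u′₀) * d + (x * Σ n (λ j → term j u) + Σ n (λ j → term j u′))
    ≡⟨ solve 6 (λ x a b d s t → con 1ℚ :* (x :* a :+ b) :* d :+ (x :* s :+ t) := x :* (con 1ℚ :* a :* d :+ s) :+ (con 1ℚ :* b :* d :+ t)) refl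
         x u₀ u′₀ d (Σ n (λ j → term j u)) (Σ n (λ j → term j u′)) ⟩
  x * det (suc n) (λ i → u i Vector.∷ N i) + det (suc n) (λ i → u′ i Vector.∷ N i) ∎
  where
  open ≡-Reasoning
  u₀ = u Fin.zero
  u′₀ = u′ Fin.zero
  d = det n (λ i k → N (Fin.suc i) k)
  term : Fin n → (Fin (suc n) → ℚ) → ℚ
  term j w = ((- 1ℚ) ^ suc (toℕ j)) * N Fin.zero j * det n (λ i k → (w (Fin.suc i) Vector.∷ N (Fin.suc i)) (punchIn (Fin.suc j) k))
  minor-linear : ∀ n (j : Fin n) (u u′ : Fin n → ℚ) (N : Fin n → Fin n → ℚ) →
    det n (λ i k → ((x * u i + u′ i) Vector.∷ N i) (punchIn (Fin.suc j) k)) ≡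
      x * det n (λ i k → (u i Vector.∷ N i) (punchIn (Fin.suc j) k)) + det n (λ i k → (u′ i Vector.∷ N i) (punchIn (Fin.suc j) k))
  minor-linear (suc n) j u u′ N = trans (expand (λ i → x * u i + u′ i))
    (trans (det-linear n x u u′ (λ i k → N i (punchIn j k))) (cong₂ (λ s t → x * s + t) (sym (expand u)) (sym (expand u′))))
    where
    expand : ∀ (w : Fin (suc n) → ℚ) → det (suc n) (λ i k → (w i Vector.∷ N i) (punchIn (Fin.suc j) k)) ≡ det (suc n) (λ i → w i Vector.∷ (λ k → N i (punchIn j k)))
    expand w = det-cong (suc n) {λ i k → (w i Vector.∷ N i) (punchIn (Fin.suc j) k)} {λ i → w i Vector.∷ (λ k → N i (punchIn j k))} (λ { i Fin.zero → refl ; i (Fin.suc k) → refl })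
  each : ∀ j → term j (λ i → x * u i + u′ i) ≡ x * term j u + term j u′
  each j = trans (cong (s *_) (minor-linear n j (λ i → u (Fin.suc i)) (λ i → u′ (Fin.suc i)) (λ i → N (Fin.suc i))))
    (solve 4 (λ s x a b → s :* (x :* a :+ b) := x :* (s :* a) :+ s :* b) refl s x
      (det n (λ i k → (u (Fin.suc i) Vector.∷ N (Fin.suc i)) (punchIn (Fin.suc j) k)))
      (det n (λ i k → (u′ (Fin.suc i) Vector.∷ N (Fin.suc i)) (punchIn (Fin.suc j) k))))
    where s = ((- 1ℚ) ^ suc (toℕ j)) * N Fin.zero j

-- Linearity applied to 0 = (-1) · 0 + 0 writes the determinant d as -d + d.
det-zero-column : ∀ n (N : Fin (suc n) → Fin n → ℚ) → det (suc n) (λ i → 0ℚ Vector.∷ N i) ≡ 0ℚ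
det-zero-column n N = trans (det-cong (suc n) {λ i → 0ℚ Vector.∷ N i} {λ i → (- 1ℚ * 0ℚ + 0ℚ) Vector.∷ N i} (λ { i Fin.zero → refl ; i (Fin.suc k) → refl }))
  (trans (det-linear n (- 1ℚ) (λ _ → 0ℚ) (λ _ → 0ℚ) N) (solve 1 (λ d → (:- con 1ℚ) :* d :+ d := con 0ℚ) refl (det (suc n) (λ i → 0ℚ Vector.∷ N i))))

det-Σ : ∀ n k (x : Fin k → ℚ) (U : Fin (suc n) → Fin k → ℚ) (N : Fin (suc n) → Fin n → ℚ) →
  det (suc n) (λ i → Σ k (λ l → x l * U i l) Vector.∷ N i) ≡ Σ k (λ l → x l * det (suc n) (λ i → U i l Vector.∷ N i))
det-Σ n zero x U N = det-zero-column n N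
det-Σ n (suc k) x U N = trans
  (det-linear n (x Fin.zero) (λ i → U i Fin.zero) (λ i → Σ k (λ l → x (Fin.suc l) * U i (Fin.suc l))) N)
  (cong (x Fin.zero * det (suc n) (λ i → U i Fin.zero Vector.∷ N i) +_) (det-Σ n k (λ l → x (Fin.suc l)) (λ i l → U i (Fin.suc l)) N))

-- Cramer's rule: in det M replace column 0 by the vanishing combination of all columns.
kernel-head : ∀ n (M : Fin (suc n) → Fin (suc n) → ℚ) (x : Fin (suc n) → ℚ) → (∀ i → Σ (suc n) (λ j → x j * M i j) ≡ 0ℚ) →
  x Fin.zero * det (suc n) M ≡ 0ℚ
kernel-head n M x eq = begin
  x Fin.zero * det (suc n) M
    ≡⟨ cong (x Fin.zero *_) (det-cong (suc n) {M} {λ i → M i Fin.zero Vector.∷ N i} (λ { i Fin.zero → refl ; i (Fin.suc k) → refl })) ⟩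
  x Fin.zero * d Fin.zero
    ≡⟨ ℚₚ.+-identityʳ (x Fin.zero * d Fin.zero) ⟨
  x Fin.zero * d Fin.zero + 0ℚ
    ≡⟨ cong (x Fin.zero * d Fin.zero +_) (Σ-zero n (λ l → trans (cong (x (Fin.suc l) *_)
         (det-equal-columns n (toℕ l) l (λ i → M i (Fin.suc l) Vector.∷ N i) refl (λ i → refl))) (ℚₚ.*-zeroʳ (x (Fin.suc l))))) ⟨
  Σ (suc n) (λ l → x l * d l)
    ≡⟨ det-Σ n (suc n) x M N ⟨
  det (suc n) (λ i → Σ (suc n) (λ l → x l * M i l) Vector.∷ N i)
    ≡⟨ det-cong (suc n) {λ i → Σ (suc n) (λ l → x l * M i l) Vector.∷ N i} {λ i → 0ℚ Vector.∷ N i} (λ { i Fin.zero → eq i ; i (Fin.suc k) → refl }) ⟩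
  det (suc n) (λ i → 0ℚ Vector.∷ N i)
    ≡⟨ det-zero-column n N ⟩
  0ℚ ∎
  where
  open ≡-Reasoning
  N : Fin (suc n) → Fin n → ℚ
  N i k = M i (Fin.suc k)
  d : Fin (suc n) → ℚ
  d l = det (suc n) (λ i → M i l Vector.∷ N i)

-- Selection of rows

-- The length B is fixed before c, so a suitable row can be searched for among finitely many; the
-- quantifier over A places the window arbitrarily far out.
EffectivelyIndependent : ∀ n → (ℕ → Fin n → ℚ) → Set
EffectivelyIndependent n φ = ∀ A → Σ[ B ∈ ℕ ] (∀ (c : Fin n → ℚ) →
  (∀ k → k < B → Σ n (λ j → c j * φ (suc (A ℕ.+ k)) j) ≡ 0ℚ) → ∀ j → c j ≡ 0ℚ)

-- The top row is chosen last, below the others, so that the first-row expansion of det is the pairing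
-- of the new row with a vector of cofactors whose first entry is nonzero.
select-rows : ∀ n φ → EffectivelyIndependent n φ → ∀ A → Σ[ α ∈ (Fin n → ℕ) ]
  ((∀ i j → i Fin.< j → α i < α j) × (∀ i → A < α i) × det n (λ i → φ (α i)) ≢ 0ℚ ×
   (∀ (x : Fin n → ℚ) → (∀ i → Σ n (λ j → x j * φ (α i) j) ≡ 0ℚ) → ∀ j → x j ≡ 0ℚ))
select-rows zero φ ind A = (λ ()) , (λ ()) , (λ ()) , ℚₚ.1≢0 , (λ _ _ ())
select-rows (suc n) φ ind A = α , increasing , bound , det≢0 , kernel
  where
  B = proj₁ (ind A)
  φ′ : ℕ → Fin n → ℚ
  φ′ a j = φ a (Fin.suc j)
  ind′ : EffectivelyIndependent n φ′
  ind′ A′ = proj₁ (ind A′) , λ c eq j → proj₂ (ind A′) (0ℚ Vector.∷ c)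
    (λ k k<B → trans (cong₂ _+_ (ℚₚ.*-zeroˡ (φ (suc (A′ ℕ.+ k)) Fin.zero)) (eq k k<B)) refl) (Fin.suc j)
  -- The lower rows start beyond A + B, which leaves the window A + 1, ..., A + B to the top row.
  rest = select-rows n φ′ ind′ (A ℕ.+ B)
  α′ = proj₁ rest
  cofactor : Fin (suc n) → ℚ
  cofactor j = ((- 1ℚ) ^ toℕ j) * det n (λ i k → φ (α′ i) (punchIn j k))
  pairing : ℕ → ℚ
  pairing k = Σ (suc n) (λ j → cofactor j * φ (suc (A ℕ.+ k)) j)
  det′≢0 : det n (λ i → φ′ (α′ i)) ≢ 0ℚ
  det′≢0 = proj₁ (proj₂ (proj₂ (proj₂ rest)))
  top : Σ[ k ∈ ℕ ] (k < B × pairing k ≢ 0ℚ)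
  top with ℕₚ.anyUpTo? (λ k → ¬? (pairing k ≟ 0ℚ)) B
  ... | yes found = found
  -- If every pairing in the window were zero, all cofactors would be; but the first one is the
  -- determinant of the lower block.
  ... | no none = ⊥-elim (det′≢0 (trans (sym (ℚₚ.*-identityˡ (det n (λ i → φ′ (α′ i)))))
    (proj₂ (ind A) cofactor (λ k k<B → decidable-stable (pairing k ≟ 0ℚ) (λ ne → none (k , k<B , ne))) Fin.zero)))
  k₀ = proj₁ top
  α : Fin (suc n) → ℕ
  α = suc (A ℕ.+ k₀) Vector.∷ α′
  bound : ∀ i → A < α i
  bound Fin.zero = s≤s (ℕₚ.m≤m+n A k₀)
  bound (Fin.suc i) = ℕₚ.≤-<-trans (ℕₚ.m≤m+n A B) (proj₁ (proj₂ (proj₂ rest)) i)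
  increasing : ∀ i j → i Fin.< j → α i < α j
  increasing Fin.zero (Fin.suc j) _ = ℕₚ.≤-<-trans (ℕₚ.+-monoʳ-< A (proj₁ (proj₂ top))) (proj₁ (proj₂ (proj₂ rest)) j)
  increasing (Fin.suc i) (Fin.suc j) (s≤s i<j) = proj₁ (proj₂ rest) i j i<j
  det≢0 : det (suc n) (λ i → φ (α i)) ≢ 0ℚ
  det≢0 eq = proj₂ (proj₂ top) (trans (Σ-cong (suc n) (λ j →
    solve 3 (λ s d x → s :* d :* x := s :* x :* d) refl ((- 1ℚ) ^ toℕ j) (det n (λ i k → φ (α′ i) (punchIn j k))) (φ (suc (A ℕ.+ k₀)) j))) eq)
  -- Cramer's rule serves the first unknown only; once it is 0, the lower rows fall under the
  -- induction hypothesis.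
  kernel : ∀ (x : Fin (suc n) → ℚ) → (∀ i → Σ (suc n) (λ j → x j * φ (α i) j) ≡ 0ℚ) → ∀ j → x j ≡ 0ℚ
  kernel x eq = λ { Fin.zero → x₀≡0 ; (Fin.suc j) → proj₂ (proj₂ (proj₂ (proj₂ rest))) (λ j → x (Fin.suc j)) eq′ j }
    where
    x₀≡0 : x Fin.zero ≡ 0ℚ
    x₀≡0 = *-zero-cancelˡ det≢0 (trans (ℚₚ.*-comm (det (suc n) (λ i → φ (α i))) (x Fin.zero)) (kernel-head n (λ i → φ (α i)) x eq))
    eq′ : ∀ i → Σ n (λ j → x (Fin.suc j) * φ′ (α′ i) j) ≡ 0ℚ
    eq′ i = trans (sym (ℚₚ.+-identityˡ (Σ n (λ j → x (Fin.suc j) * φ′ (α′ i) j))))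
      (trans (cong (_+ Σ n (λ j → x (Fin.suc j) * φ′ (α′ i) j)) (sym (trans (cong (_* φ (α′ i) Fin.zero) x₀≡0) (ℚₚ.*-zeroˡ (φ (α′ i) Fin.zero))))) (eq (Fin.suc i)))

-- The double index (m , v)

Σ-++ : ∀ m n (f : Fin (m ℕ.+ n) → ℚ) → Σ (m ℕ.+ n) f ≡ Σ m (λ i → f (i ↑ˡ n)) + Σ n (λ i → f (m ↑ʳ i))
Σ-++ zero n f = sym (ℚₚ.+-identityˡ (Σ n f))
Σ-++ (suc m) n f = trans (cong (f Fin.zero +_) (Σ-++ m n (λ i → f (Fin.suc i)))) (sym (ℚₚ.+-assoc (f Fin.zero) _ _))

Σ-combine : ∀ r D (f : Fin (r ℕ.* D) → ℚ) → Σ (r ℕ.* D) f ≡ Σ r (λ m → Σ D (λ v → f (combine m v)))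
Σ-combine zero D f = refl
Σ-combine (suc r) D f = trans (Σ-++ D (r ℕ.* D) f) (cong (Σ D (λ v → f (v ↑ˡ (r ℕ.* D))) +_) (Σ-combine r D (λ i → f (D ↑ʳ i))))

row : (r D : ℕ) → ℕ → Fin (r ℕ.* D) → ℚ
row r D α c = entry D α (toℕ (proj₁ (remQuot {r} D c))) (suc (toℕ (proj₂ (remQuot {r} D c))))

Σ-row : ∀ r D α (x : Fin (r ℕ.* D) → ℚ) →
  Σ (r ℕ.* D) (λ c → x c * row r D α c) ≡ Σ r (λ m → Σ D (λ v → x (combine m v) * entry D α (toℕ m) (suc (toℕ v))))
Σ-row r D α x = trans (Σ-combine r D (λ c → x c * row r D α c)) (Σ-cong r (λ m → Σ-cong D (λ v →
  cong (λ p → x (combine m v) * entry D α (toℕ (proj₁ p)) (suc (toℕ (proj₂ p)))) (Finₚ.remQuot-combine {r} {D} m v))))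

entry-cong : ∀ D α α′ m m′ v → α ℕ.+ m ≡ α′ ℕ.+ m′ → entry D α m v ≡ entry D α′ m′ v
entry-cong D α α′ m m′ v = cong (λ n → (ℕ→ℚ D ^ n) * (bernoulliPoly n (ℕ→ℚ v ÷₀ ℕ→ℚ D) ÷₀ ℕ→ℚ n))

row-independent : ∀ r D → 1 ≤ D → EffectivelyIndependent (r ℕ.* D) (row r D)
row-independent r D 1≤D A = proj₁ ind , λ c eq j → trans (cong c (sym (Finₚ.combine-remQuot {r} D j)))
  (proj₂ ind (λ m v → c (combine m v)) (λ k k<B → trans (Σ-cong r (λ m → Σ-cong D (λ v → cong (c (combine m v) *_) (reindex k m v))))
    (trans (sym (Σ-row r D (suc (A ℕ.+ k)) c)) (eq k k<B))) (proj₁ (remQuot {r} D j)) (proj₂ (remQuot {r} D j)))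
  where
  ind = independence r D A 1≤D
  reindex : ∀ k m v → entry D (suc k) (toℕ {r} m ℕ.+ A) (suc (toℕ {D} v)) ≡ entry D (suc (A ℕ.+ k)) (toℕ m) (suc (toℕ v))
  reindex k m v = entry-cong D (suc k) (suc (A ℕ.+ k)) (toℕ m ℕ.+ A) (toℕ m) (suc (toℕ v)) (cong suc (begin
    k ℕ.+ (toℕ m ℕ.+ A)     ≡⟨ cong (k ℕ.+_) (ℕₚ.+-comm (toℕ m) A) ⟩
    k ℕ.+ (A ℕ.+ toℕ m)     ≡⟨ ℕₚ.+-assoc k A (toℕ m) ⟨
    k ℕ.+ A ℕ.+ toℕ m       ≡⟨ cong (ℕ._+ toℕ m) (ℕₚ.+-comm k A) ⟩
    A ℕ.+ k ℕ.+ toℕ m       ∎))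
    where open ≡-Reasoning

-- The generating function of the restricted partition function

count : ∀ {A : Set} → (A → Bool) → List A → ℕ
count p xs = length (filterᵇ p xs)

count-++ : ∀ {A : Set} (p : A → Bool) xs ys → count p (xs ++ ys) ≡ count p xs ℕ.+ count p ys
count-++ p [] ys = refl
count-++ p (x ∷ xs) ys with p x
... | true = cong suc (count-++ p xs ys)
... | false = count-++ p xs ys

count-map : ∀ {A B : Set} (p : B → Bool) (f : A → B) xs → count p (map f xs) ≡ count (λ x → p (f x)) xs
count-map p f [] = refl
count-map p f (x ∷ xs) with p (f x)
... | true = cong suc (count-map p f xs)
... | false = count-map p f xs

count-false : ∀ {A : Set} (xs : List A) → count (λ _ → false) xs ≡ 0
count-false [] = refl
count-false (x ∷ xs) = count-false xs

solutions : ∀ {A : Set} → (A → ℕ) → List A → PS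
solutions s xs n = ℕ→ℚ (count (λ x → s x ≡ᵇ n) xs)

solutions-shift : ∀ {A : Set} k (s : A → ℕ) xs → solutions (λ x → k ℕ.+ s x) xs ≈ (X ^ₚ k) ⊛ solutions s xs
solutions-shift zero s xs n = sym (⊛-identityˡ (solutions s xs) n)
solutions-shift (suc k) s xs zero = trans (cong ℕ→ℚ (count-false xs)) (sym (X^-low (suc k) (solutions s xs) 0 (s≤s z≤n)))
solutions-shift (suc k) s xs (suc n) = trans (solutions-shift k s xs n)
  (sym (trans (⊛-assoc X (X ^ₚ k) (solutions s xs) (suc n)) (X-⊛-suc ((X ^ₚ k) ⊛ solutions s xs) n)))

geometricSum : ℕ → PS → PS
geometricSum zero y = 0#
geometricSum (suc n) y = 1# ⊕ (y ⊛ geometricSum n y)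

geometricSum-correct : ∀ n y → (1# ⊕ (⊖ y)) ⊛ geometricSum n y ≈ 1# ⊕ (⊖ (y ^ₚ n))
geometricSum-correct zero y n = trans (⊛-zeroʳ (1# ⊕ (⊖ y)) n) (sym (ℚₚ.+-inverseʳ (1# n)))
geometricSum-correct (suc n) y = begin
  (1# ⊕ (⊖ y)) ⊛ (1# ⊕ (y ⊛ s))               ≈⟨ solveₚ 2 (λ y s → (conₚ 1ℚ :+ₚ (:-ₚ y)) :*ₚ (conₚ 1ℚ :+ₚ (y :*ₚ s)) :=ₚ (conₚ 1ℚ :+ₚ (:-ₚ y)) :+ₚ (y :*ₚ ((conₚ 1ℚ :+ₚ (:-ₚ y)) :*ₚ s))) (λ _ → refl) y s ⟩
  (1# ⊕ (⊖ y)) ⊕ (y ⊛ ((1# ⊕ (⊖ y)) ⊛ s))     ≈⟨ ⊕-congˡ (1# ⊕ (⊖ y)) (⊛-congˡ y (geometricSum-correct n y)) ⟩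
  (1# ⊕ (⊖ y)) ⊕ (y ⊛ (1# ⊕ (⊖ (y ^ₚ n))))    ≈⟨ solveₚ 2 (λ y p → (conₚ 1ℚ :+ₚ (:-ₚ y)) :+ₚ (y :*ₚ (conₚ 1ℚ :+ₚ (:-ₚ p))) :=ₚ conₚ 1ℚ :+ₚ (:-ₚ (y :*ₚ p))) (λ _ → refl) y (y ^ₚ n) ⟩
  1# ⊕ (⊖ (y ⊛ (y ^ₚ n)))                     ∎
  where
  open import Relation.Binary.Reasoning.Setoid setoid
  s = geometricSum n y

-- The first coordinate runs through c, ..., c + M - 1. `applyUpTo` composes its function with `suc`
-- at each step, so g is known only through `g t ≡ c + t`.
solutions-product : ∀ {r} b (s : (Fin r → ℕ) → ℕ) ys M g c → (∀ t → g t ≡ c ℕ.+ t) →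
  solutions (λ x → b ℕ.* x Fin.zero ℕ.+ s (λ i → x (Fin.suc i))) (cartesianProductWith Vector._∷_ (applyUpTo g M) ys)
    ≈ (X ^ₚ (b ℕ.* c)) ⊛ (geometricSum M (X ^ₚ b) ⊛ solutions s ys)
solutions-product b s ys zero g c g≡ n = sym (trans (⊛-congˡ (X ^ₚ (b ℕ.* c)) (⊛-zeroˡ (solutions s ys)) n) (⊛-zeroʳ (X ^ₚ (b ℕ.* c)) n))
solutions-product {r} b s ys (suc M) g c g≡ n = begin
  ℕ→ℚ (count p (map (g 0 Vector.∷_) ys ++ rest))
    ≡⟨ trans (cong ℕ→ℚ (count-++ p (map (g 0 Vector.∷_) ys) rest)) (ℕ→ℚ-+ (count p (map (g 0 Vector.∷_) ys)) (count p rest)) ⟩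
  ℕ→ℚ (count p (map (g 0 Vector.∷_) ys)) + ℕ→ℚ (count p rest)
    ≡⟨ cong₂ _+_ (trans (cong ℕ→ℚ (count-map p (g 0 Vector.∷_) ys)) (trans (solutions-shift (b ℕ.* g 0) s ys n)
         (cong (λ j → ((X ^ₚ (b ℕ.* j)) ⊛ G) n) (trans (g≡ 0) (ℕₚ.+-identityʳ c)))))
         (solutions-product b s ys M (λ t → g (suc t)) (suc c) (λ t → trans (g≡ (suc t)) (ℕₚ.+-suc c t)) n) ⟩
  ((X ^ₚ (b ℕ.* c)) ⊛ G) n + ((X ^ₚ (b ℕ.* suc c)) ⊛ (S ⊛ G)) n
    ≡⟨ cong (((X ^ₚ (b ℕ.* c)) ⊛ G) n +_) (⊛-congʳ (S ⊛ G) (λ k → trans (cong (λ j → (X ^ₚ j) k) (ℕₚ.*-suc b c)) (^ₚ-+ X b (b ℕ.* c) k)) n) ⟩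
  ((X ^ₚ (b ℕ.* c)) ⊛ G) n + (((X ^ₚ b) ⊛ (X ^ₚ (b ℕ.* c))) ⊛ (S ⊛ G)) n
    ≡⟨ solveₚ 4 (λ x y s g → (x :*ₚ g) :+ₚ ((y :*ₚ x) :*ₚ (s :*ₚ g)) :=ₚ x :*ₚ ((conₚ 1ℚ :+ₚ (y :*ₚ s)) :*ₚ g)) (λ _ → refl) (X ^ₚ (b ℕ.* c)) (X ^ₚ b) S G n ⟩
  ((X ^ₚ (b ℕ.* c)) ⊛ ((1# ⊕ ((X ^ₚ b) ⊛ S)) ⊛ G)) n ∎
  where
  open ≡-Reasoning
  G = solutions s ys
  S = geometricSum M (X ^ₚ b)
  rest = cartesianProductWith Vector._∷_ (applyUpTo (λ t → g (suc t)) M) ys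
  p : (Fin (suc r) → ℕ) → Bool
  p x = (b ℕ.* x Fin.zero ℕ.+ s (λ i → x (Fin.suc i))) ≡ᵇ n

^ₚ-Vanishes : ∀ M y → y 0 ≡ 0ℚ → Vanishes M (y ^ₚ M)
^ₚ-Vanishes (suc M) y y0 zero _ = trans (cong (λ t → t * (y ^ₚ M) 0 + 0ℚ) y0) (trans (ℚₚ.+-identityʳ _) (ℚₚ.*-zeroˡ ((y ^ₚ M) 0)))
^ₚ-Vanishes (suc M) y y0 (suc k) (s≤s k<M) = trans
  (cong₂ (λ s t → s * (y ^ₚ M) (suc k) + t) y0 (⊛-Vanishes (tail y) (^ₚ-Vanishes M y y0) k k<M))
  (trans (ℚₚ.+-identityʳ _) (ℚₚ.*-zeroˡ ((y ^ₚ M) (suc k))))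

Π-0 : ∀ r F → (∀ i → F i 0 ≢ 0ℚ) → Π r F 0 ≢ 0ℚ
Π-0 zero F F≢0 = ℚₚ.1≢0
Π-0 (suc r) F F≢0 eq = *-≢0 (F≢0 Fin.zero) (Π-0 r (λ i → F (Fin.suc i)) (λ i → F≢0 (Fin.suc i))) (trans (sym (ℚₚ.+-identityʳ _)) eq)

Π-1 : ∀ r F → (∀ i → F i 0 ≡ 1ℚ) → Π r F 0 ≡ 1ℚ
Π-1 zero F F≡1 = refl
Π-1 (suc r) F F≡1 = cong₂ (λ x y → x * y + 0ℚ) (F≡1 Fin.zero) (Π-1 r (λ i → F (Fin.suc i)) (λ i → F≡1 (Fin.suc i)))

Π-zero : ∀ F → Π zero F ≈ 1#
Π-zero F zero = refl
Π-zero F (suc n) = refl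

Q-0 : ∀ {b} → 1 ≤ b → Q b 0 ≡ 1ℚ
Q-0 {b} 1≤b = cong (λ x → 1ℚ + - x) (X^-other b 0 (ℕₚ.<⇒≢ 1≤b))

-- For N ≥ n, enlarging the box from n to N does not change the number of solutions; the proof works with N fixed.
Π-solutions : ∀ r (a : Fin r → ℕ) → (∀ i → 1 ≤ a i) → ∀ N n → n ≤ N →
  (Π r (λ i → Q (a i)) ⊛ solutions (λ x → Σℕ r (λ i → a i ℕ.* x i)) (box r N)) n ≡ 1# n
Π-solutions zero a 1≤a N n n≤N = trans (⊛-cong {Π zero (λ i → Q (a i))} {1#} {solutions (λ x → Σℕ zero (λ i → a i ℕ.* x i)) (box zero N)} {1#}
  (Π-zero (λ i → Q (a i))) (λ { zero → refl ; (suc k) → refl }) n) (⊛-identityˡ 1# n)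
Π-solutions (suc r) a 1≤a N n n≤N = begin
  ((Q b ⊛ P) ⊛ solutions (λ x → Σℕ (suc r) (λ i → a i ℕ.* x i)) (box (suc r) N)) n
    ≡⟨ ⊛-congˡ (Q b ⊛ P) (solutions-product b s (box r N) (suc N) (λ t → t) 0 (λ t → refl)) n ⟩
  ((Q b ⊛ P) ⊛ ((X ^ₚ (b ℕ.* 0)) ⊛ (S ⊛ G))) n
    ≡⟨ ⊛-congˡ (Q b ⊛ P) (≈-trans (⊛-congʳ (S ⊛ G) (λ k → cong (λ j → (X ^ₚ j) k) (ℕₚ.*-zeroʳ b))) (⊛-identityˡ (S ⊛ G))) n ⟩
  ((Q b ⊛ P) ⊛ (S ⊛ G)) n
    ≡⟨ solveₚ 4 (λ q p s g → (q :*ₚ p) :*ₚ (s :*ₚ g) :=ₚ (q :*ₚ s) :*ₚ (p :*ₚ g)) (λ _ → refl) (Q b) P S G n ⟩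
  ((Q b ⊛ S) ⊛ (P ⊛ G)) n
    -- `Q b ⊛ S` is 1 minus the (N+1)-st power of q^b, hence agrees with 1 up to degree N.
    ≡⟨ ⊛-cong-≤ {Q b ⊛ S} {1#} {P ⊛ G} {1#} n
         (λ k k≤n → trans (geometricSum-correct (suc N) (X ^ₚ b) k) (trans (cong (λ t → 1# k + - t) (^ₚ-Vanishes (suc N) (X ^ₚ b) (X^-other b 0 (ℕₚ.<⇒≢ (1≤a Fin.zero))) k (s≤s (ℕₚ.≤-trans k≤n n≤N)))) (ℚₚ.+-identityʳ (1# k))))
         (λ k k≤n → Π-solutions r (λ i → a (Fin.suc i)) (λ i → 1≤a (Fin.suc i)) N k (ℕₚ.≤-trans k≤n n≤N)) ⟩
  (1# ⊛ 1#) n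
    ≡⟨ ⊛-identityˡ 1# n ⟩
  1# n ∎
  where
  open ≡-Reasoning
  b = a Fin.zero
  s : (Fin r → ℕ) → ℕ
  s x = Σℕ r (λ i → a (Fin.suc i) ℕ.* x i)
  P = Π r (λ i → Q (a (Fin.suc i)))
  S = geometricSum (suc N) (X ^ₚ b)
  G = solutions s (box r N)

-- The hypothesis stops at n because the box of side n is only known to count correctly up to n.
inv-unique : ∀ f g n → f 0 ≢ 0ℚ → (∀ k → k ≤ n → (f ⊛ g) k ≡ 1# k) → g n ≡ inv f n
inv-unique f g n f0≢0 eq = begin
  g n                       ≡⟨ ⊛-identityˡ g n ⟨
  (1# ⊛ g) n                ≡⟨ ⊛-congʳ g (⊛-inverseʳ {f} f0≢0) n ⟨
  ((f ⊛ inv f) ⊛ g) n       ≡⟨ solveₚ 3 (λ f i g → (f :*ₚ i) :*ₚ g :=ₚ i :*ₚ (f :*ₚ g)) (λ _ → refl) f (inv f) g n ⟩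
  (inv f ⊛ (f ⊛ g)) n       ≡⟨ ⊛-cong-≤ {inv f} {inv f} {f ⊛ g} {1#} n (λ _ _ → refl) eq ⟩
  (inv f ⊛ 1#) n            ≡⟨ ⊛-identityʳ (inv f) n ⟩
  inv f n                   ∎
  where open ≡-Reasoning

partitionCount-inv : ∀ {r} (a : Fin r → ℕ) → (∀ i → 1 ≤ a i) → ∀ n → ℕ→ℚ (partitionCount a n) ≡ inv (Π r (λ i → Q (a i))) n
partitionCount-inv {r} a 1≤a n = inv-unique (Π r (λ i → Q (a i))) (solutions (λ x → Σℕ r (λ i → a i ℕ.* x i)) (box r n)) n
  (Π-0 r (λ i → Q (a i)) (λ i → Q≢0 (1≤a i))) (Π-solutions r a 1≤a n)

-- The partial-fraction identity

Π-⟿ : ∀ r {F G} → (∀ i → F i ⟿ G i) → Π r F ⟿ Π r G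
Π-⟿ zero {F} {G} p = ⟿-cong (≈-sym (Π-zero F)) (≈-sym (Π-zero G)) (⟿-constant 1ℚ)
Π-⟿ (suc r) p = ⟿-⊛ (p Fin.zero) (Π-⟿ r (λ i → p (Fin.suc i)))

X^-⊛-cancel : ∀ M {f g} → (X ^ₚ M) ⊛ f ≈ (X ^ₚ M) ⊛ g → f ≈ g
X^-⊛-cancel M {f} {g} eq n = trans (sym (X^-high M f n)) (trans (eq (M ℕ.+ n)) (X^-high M g n))

⊖-injective : ∀ {f g} → ⊖ f ≈ ⊖ g → f ≈ g
⊖-injective eq n = ℚₚ.neg-injective (eq n)

unit-cancel : ∀ u {f g} → u 0 ≢ 0ℚ → u ⊛ f ≈ u ⊛ g → f ≈ g
unit-cancel u {f} {g} u≢0 eq = begin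
  f                     ≈⟨ expand f ⟩
  inv u ⊛ (u ⊛ f)       ≈⟨ ⊛-congˡ (inv u) eq ⟩
  inv u ⊛ (u ⊛ g)       ≈⟨ expand g ⟨
  g                     ∎
  where
  open import Relation.Binary.Reasoning.Setoid setoid
  expand : ∀ f → f ≈ inv u ⊛ (u ⊛ f)
  expand f = ≈-trans (≈-sym (≈-trans (⊛-congʳ f (⊛-inverseʳ {u} u≢0)) (⊛-identityˡ f)))
    (solveₚ 3 (λ u i f → (u :*ₚ i) :*ₚ f :=ₚ i :*ₚ (u :*ₚ f)) (λ _ → refl) u (inv u) f)

-- `Qₑ D` has constant term 0 and is no unit: its sign and its factor z are cancelled first, then
-- the remaining unit.
Qₑ-cancel : ∀ {D f g} → 1 ≤ D → Qₑ D ⊛ f ≈ Qₑ D ⊛ g → f ≈ g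
Qₑ-cancel {D} {f} {g} 1≤D eq = unit-cancel (expm1OverZ D) (expm1OverZ≢0 1≤D) (X-⊛-cancel (⊖-injective
  (≈-trans (≈-sym (expand f)) (≈-trans eq (expand g)))))
  where
  expand : ∀ f → Qₑ D ⊛ f ≈ ⊖ (X ⊛ (expm1OverZ D ⊛ f))
  expand f = ≈-trans (⊛-congʳ f (Qₑ≈expm1OverZ D))
    (solveₚ 3 (λ x e f → (:-ₚ (x :*ₚ e)) :*ₚ f :=ₚ :-ₚ (x :*ₚ (e :*ₚ f))) (λ _ → refl) X (expm1OverZ D) f)

Qₑ^-cancel : ∀ M {D f g} → 1 ≤ D → (Qₑ D ^ₚ M) ⊛ f ≈ (Qₑ D ^ₚ M) ⊛ g → f ≈ g
Qₑ^-cancel zero {D} {f} {g} 1≤D eq = ≈-trans (≈-sym (⊛-identityˡ f)) (≈-trans eq (⊛-identityˡ g))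
Qₑ^-cancel (suc M) {D} {f} {g} 1≤D eq = Qₑ^-cancel M 1≤D (Qₑ-cancel 1≤D
  (≈-trans (≈-sym (⊛-assoc (Qₑ D) (Qₑ D ^ₚ M) f)) (≈-trans eq (⊛-assoc (Qₑ D) (Qₑ D ^ₚ M) g))))

-- Each factor 1 - e^{bz} contributes a sign, a z and the series (e^{bz} - 1)/z; these signs are the
-- source of the one in the linear system.
Π-Qₑ : ∀ r (a : Fin r → ℕ) → Π r (λ i → Qₑ (a i)) ≈ (X ^ₚ r) ⊛ (constant ((- 1ℚ) ^ r) ⊛ Π r (λ i → expm1OverZ (a i)))
Π-Qₑ zero a = ≈-trans (Π-zero (λ i → Qₑ (a i))) (≈-sym (≈-trans (⊛-identityˡ (1# ⊛ P)) (≈-trans (⊛-identityˡ P) (Π-zero (λ i → expm1OverZ (a i))))))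
  where P = Π zero (λ i → expm1OverZ (a i))
Π-Qₑ (suc r) a = begin
  Qₑ b ⊛ Π r (λ i → Qₑ (a (Fin.suc i)))
    ≈⟨ ⊛-cong (Qₑ≈expm1OverZ b) (Π-Qₑ r (λ i → a (Fin.suc i))) ⟩
  (⊖ (X ⊛ expm1OverZ b)) ⊛ ((X ^ₚ r) ⊛ (constant s ⊛ P))
    ≈⟨ solveₚ 5 (λ x e p s y → (:-ₚ (x :*ₚ e)) :*ₚ (p :*ₚ (s :*ₚ y)) :=ₚ (x :*ₚ p) :*ₚ ((conₚ (- 1ℚ) :*ₚ s) :*ₚ (e :*ₚ y))) (λ _ → refl)
         X (expm1OverZ b) (X ^ₚ r) (constant s) P ⟩
  (X ⊛ (X ^ₚ r)) ⊛ ((constant (- 1ℚ) ⊛ constant s) ⊛ (expm1OverZ b ⊛ P))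
    ≈⟨ ⊛-congˡ (X ⊛ (X ^ₚ r)) (⊛-congʳ (expm1OverZ b ⊛ P) (≈-sym (constant-⊛-constant (- 1ℚ) s))) ⟩
  (X ⊛ (X ^ₚ r)) ⊛ (constant (- 1ℚ * s) ⊛ (expm1OverZ b ⊛ P)) ∎
  where
  open import Relation.Binary.Reasoning.Setoid setoid
  b = a Fin.zero
  s = (- 1ℚ) ^ r
  P = Π r (λ i → expm1OverZ (a (Fin.suc i)))

sign-square : ∀ r → ((- 1ℚ) ^ r) * ((- 1ℚ) ^ r) ≡ 1ℚ
sign-square zero = refl
sign-square (suc r) = trans (solve 1 (λ s → (:- con 1ℚ) :* s :* ((:- con 1ℚ) :* s) := s :* s) refl ((- 1ℚ) ^ r)) (sign-square r)

module _ {r D : ℕ} (1≤D : 1 ≤ D) (a : Fin r → ℕ) (1≤a : ∀ i → 1 ≤ a i) (d : Fin r → ℕ → ℚ)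
  (d-periodic : ∀ m n → d m (n ℕ.+ D) ≡ d m n)
  (d-partition : ∀ n → ℕ→ℚ (partitionCount a n) ≡ Σ r (λ m → d m n * (ℕ→ℚ n ^ toℕ m))) where

  private
    c : Fin r → Fin D → ℚ
    c m v = d m (suc (toℕ v))

    P Pₑ Y G W : PS
    P = Π r (λ i → Q (a i))
    Pₑ = Π r (λ i → Qₑ (a i))
    Y = Π r (λ i → expm1OverZ (a i))
    G = combination r D c (geometric r D 0)
    W = combination r D c (laurent r D 0)

    Y≢0 : Y 0 ≢ 0ℚ
    Y≢0 = Π-0 r (λ i → expm1OverZ (a i)) (λ i → expm1OverZ≢0 (1≤a i))

  d-periodic-* : ∀ m t n → d m (t ℕ.* D ℕ.+ n) ≡ d m n
  d-periodic-* m zero n = refl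
  d-periodic-* m (suc t) n = trans (cong (d m) (trans (ℕₚ.+-assoc D (t ℕ.* D) n) (ℕₚ.+-comm D (t ℕ.* D ℕ.+ n))))
    (trans (d-periodic m (t ℕ.* D ℕ.+ n)) (d-periodic-* m t n))

  partition-geometric : ∀ t (v : Fin D) → inv P (t ℕ.* D ℕ.+ suc (toℕ v)) ≡ G (t ℕ.* D ℕ.+ suc (toℕ v))
  partition-geometric t v = begin
    inv P n                                                     ≡⟨ partitionCount-inv a 1≤a n ⟨
    ℕ→ℚ (partitionCount a n)                                    ≡⟨ d-partition n ⟩
    Σ r (λ m → d m n * (ℕ→ℚ n ^ toℕ m))                         ≡⟨ Σ-cong r (λ m → trans (cong₂ (λ x j → x * (ℕ→ℚ n ^ j)) (d-periodic-* m t (suc (toℕ v))) (sym (ℕₚ.+-identityʳ (toℕ m))))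
                                                                     (sym (Σ-geo (c m) (toℕ m ℕ.+ 0) t v 1≤D))) ⟩
    Σ r (λ m → Σ D (λ v′ → c m v′ * geometric r D 0 m v′ n))    ≡⟨ combination-coefficient r D c (geometric r D 0) n ⟨
    G n                                                         ∎
    where
    open ≡-Reasoning
    n = t ℕ.* D ℕ.+ suc (toℕ v)

  inv-P : inv P ≈ 1# ⊕ G
  inv-P zero = begin
    1ℚ ÷₀ P 0      ≡⟨ cong (1ℚ ÷₀_) (Π-1 r (λ i → Q (a i)) (λ i → Q-0 (1≤a i))) ⟩
    1ℚ + 0ℚ        ≡⟨ cong (1ℚ +_) (trans (combination-coefficient r D c (geometric r D 0) 0) (Σ-zero r (λ m → Σ-zero D (λ v →
                        trans (cong (c m v *_) (trans (geo-power D (suc (toℕ v)) (toℕ m ℕ.+ 0) 0)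
                          (trans (cong ((ℕ→ℚ 0 ^ (toℕ m ℕ.+ 0)) *_) (trans (geo-low (suc (toℕ v)) 0 1≤D 1≤D) (X^-other (suc (toℕ v)) 0 (λ ()))))
                            (ℚₚ.*-zeroʳ (ℕ→ℚ 0 ^ (toℕ m ℕ.+ 0))))))
                          (ℚₚ.*-zeroʳ (c m v)))))) ⟨
    1ℚ + G 0       ∎
    where open ≡-Reasoning
  -- Dividing n instead of n + 1 yields a representative of n + 1 among 1, ..., D.
  inv-P (suc n) with (n divMod D) {{ℕ.>-nonZero 1≤D}}
  ... | result t v n≡ = trans (trans (cong (inv P) suc-n≡) (trans (partition-geometric t v) (cong G (sym suc-n≡)))) (sym (ℚₚ.+-identityˡ (G (suc n))))
    where
    suc-n≡ : suc n ≡ t ℕ.* D ℕ.+ suc (toℕ v)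
    suc-n≡ = trans (cong suc (trans n≡ (ℕₚ.+-comm (toℕ v) (t ℕ.* D)))) (sym (ℕₚ.+-suc (t ℕ.* D) (toℕ v)))

  -- In q, P (1 + G) = 1, that is P G = 1 - P. Multiplied by the common denominator this is an
  -- identity of polynomials; it passes to z by `⟿-functional`, and the denominator is cancelled
  -- again.
  laurent-product : Pₑ ⊛ W ≈ (X ^ₚ (r ℕ.+ 0)) ⊛ (1# ⊕ (⊖ Pₑ))
  laurent-product = Qₑ^-cancel M 1≤D (begin
    qₑ ⊛ (Pₑ ⊛ W)                    ≈⟨ solveₚ 3 (λ q p w → q :*ₚ (p :*ₚ w) :=ₚ p :*ₚ (q :*ₚ w)) (λ _ → refl) qₑ Pₑ W ⟩
    Pₑ ⊛ (qₑ ⊛ W)                    ≈⟨ ⊛-congˡ Pₑ (Qₑ^⊛laurent r 0 c 1≤D) ⟩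
    Pₑ ⊛ (x ⊛ nₑ)                    ≈⟨ solveₚ 3 (λ p x n → p :*ₚ (x :*ₚ n) :=ₚ x :*ₚ (p :*ₚ n)) (λ _ → refl) Pₑ x nₑ ⟩
    x ⊛ (Pₑ ⊛ nₑ)                    ≈⟨ ⊛-congˡ x (⟿-functional
                                          (⟿-⊛ (Π-⟿ r (λ i → Q⟿Qₑ (a i))) (combination-⟿ r D c (numerator⟿numeratorₑ r D 0)))
                                          (⟿-⊛ (⟿-^ M (Q⟿Qₑ D)) (⟿-⊕ (⟿-constant 1ℚ) (⟿-⊖ (Π-⟿ r (λ i → Q⟿Qₑ (a i))))))
                                          rational) ⟩
    x ⊛ (qₑ ⊛ (1# ⊕ (⊖ Pₑ)))         ≈⟨ solveₚ 3 (λ x q p → x :*ₚ (q :*ₚ p) :=ₚ q :*ₚ (x :*ₚ p)) (λ _ → refl) x qₑ (1# ⊕ (⊖ Pₑ)) ⟩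
    qₑ ⊛ (x ⊛ (1# ⊕ (⊖ Pₑ)))         ∎)
    where
    open import Relation.Binary.Reasoning.Setoid setoid
    M = r ℕ.+ 0
    q = Q D ^ₚ M
    qₑ = Qₑ D ^ₚ M
    x = X ^ₚ M
    nₑ = combination r D c (numeratorₑ r D 0)
    rational : P ⊛ combination r D c (numerator r D 0) ≈ q ⊛ (1# ⊕ (⊖ P))
    rational = begin
      P ⊛ combination r D c (numerator r D 0)        ≈⟨ ⊛-congˡ P (Q^⊛geometric r 0 c 1≤D) ⟨
      P ⊛ (q ⊛ G)                                    ≈⟨ solveₚ 3 (λ p q g → p :*ₚ (q :*ₚ g) :=ₚ q :*ₚ ((p :*ₚ (conₚ 1ℚ :+ₚ g)) :+ₚ (:-ₚ p))) (λ _ → refl) P q G ⟩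
      q ⊛ ((P ⊛ (1# ⊕ G)) ⊕ (⊖ P))                   ≈⟨ ⊛-congˡ q (⊕-congʳ (⊖ P) (≈-trans (⊛-congˡ P (≈-sym inv-P)) (⊛-inverseʳ {P} (Π-0 r (λ i → Q (a i)) (λ i → Q≢0 (1≤a i)))))) ⟩
      q ⊛ (1# ⊕ (⊖ P))                               ∎

  -- The summand -z^r is what remains of the 1 in `inv-P`; the sign changes sides because it is its
  -- own inverse.
  laurent-Barnes : W ≈ (constant ((- 1ℚ) ^ r) ⊛ inv Y) ⊕ (⊖ (X ^ₚ r))
  laurent-Barnes = unit-cancel Y Y≢0 (begin
    Y ⊛ W                                            ≈⟨ ≈-trans (⊛-congʳ (Y ⊛ W) s²) (⊛-identityˡ (Y ⊛ W)) ⟨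
    (s ⊛ s) ⊛ (Y ⊛ W)                                ≈⟨ solveₚ 3 (λ s y w → (s :*ₚ s) :*ₚ (y :*ₚ w) :=ₚ s :*ₚ ((s :*ₚ y) :*ₚ w)) (λ _ → refl) s Y W ⟩
    s ⊛ ((s ⊛ Y) ⊛ W)                                ≈⟨ ⊛-congˡ s sYW ⟩
    s ⊛ (1# ⊕ (⊖ (x ⊛ (s ⊛ Y))))                     ≈⟨ solveₚ 3 (λ s x y → s :*ₚ (conₚ 1ℚ :+ₚ (:-ₚ (x :*ₚ (s :*ₚ y)))) :=ₚ s :+ₚ (:-ₚ ((s :*ₚ s) :*ₚ (y :*ₚ x)))) (λ _ → refl) s x Y ⟩
    s ⊕ (⊖ ((s ⊛ s) ⊛ (Y ⊛ x)))                      ≈⟨ ⊕-cong (≈-sym (≈-trans (⊛-congˡ s (⊛-inverseʳ {Y} Y≢0)) (⊛-identityʳ s)))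
                                                          (⊖-cong (≈-trans (⊛-congʳ (Y ⊛ x) s²) (⊛-identityˡ (Y ⊛ x)))) ⟩
    (s ⊛ (Y ⊛ inv Y)) ⊕ (⊖ (Y ⊛ x))                  ≈⟨ solveₚ 4 (λ s y i x → (s :*ₚ (y :*ₚ i)) :+ₚ (:-ₚ (y :*ₚ x)) :=ₚ y :*ₚ ((s :*ₚ i) :+ₚ (:-ₚ x))) (λ _ → refl) s Y (inv Y) x ⟩
    Y ⊛ ((s ⊛ inv Y) ⊕ (⊖ x))                        ∎)
    where
    open import Relation.Binary.Reasoning.Setoid setoid
    s = constant ((- 1ℚ) ^ r)
    x = X ^ₚ r
    s² : s ⊛ s ≈ 1#
    s² = ≈-trans (≈-sym (constant-⊛-constant ((- 1ℚ) ^ r) ((- 1ℚ) ^ r))) (constant-cong (sign-square r))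
    sYW : (s ⊛ Y) ⊛ W ≈ 1# ⊕ (⊖ (x ⊛ (s ⊛ Y)))
    sYW = X^-⊛-cancel r (begin
      x ⊛ ((s ⊛ Y) ⊛ W)                              ≈⟨ ⊛-assoc x (s ⊛ Y) W ⟨
      (x ⊛ (s ⊛ Y)) ⊛ W                              ≈⟨ ⊛-congʳ W (Π-Qₑ r a) ⟨
      Pₑ ⊛ W                                         ≈⟨ laurent-product ⟩
      (X ^ₚ (r ℕ.+ 0)) ⊛ (1# ⊕ (⊖ Pₑ))               ≈⟨ ⊛-cong (λ n → cong (λ j → (X ^ₚ j) n) (ℕₚ.+-identityʳ r)) (⊕-congˡ 1# (⊖-cong (Π-Qₑ r a))) ⟩
      x ⊛ (1# ⊕ (⊖ (x ⊛ (s ⊛ Y))))                   ∎)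

  -- `1 ≤ k` keeps out the summand -z^r of `laurent-Barnes`, which is felt at k = 0 only.
  system-solution : ∀ k → 1 ≤ k → Σ r (λ m → Σ D (λ v → c m v * entry D (suc k) (toℕ m) (suc (toℕ v))))
    ≡ - (ℕ→ℚ D * (ℕ→ℚ (k !) * (((- 1ℚ) ^ r) * inv Y (k ℕ.+ r))))
  system-solution k 1≤k = begin
    Σ r (λ m → Σ D (λ v → c m v * entry D (suc k) (toℕ m) (suc (toℕ v))))
      ≡⟨ Σ-cong r (λ m → Σ-cong D (λ v → cong (c m v *_) (entry-cong D (suc k) (suc k) (toℕ m) (toℕ m ℕ.+ 0) (suc (toℕ v)) (cong (λ j → suc (k ℕ.+ j)) (sym (ℕₚ.+-identityʳ (toℕ m))))))) ⟩
    Σ r (λ m → Σ D (λ v → c m v * entry D (suc k) (toℕ m ℕ.+ 0) (suc (toℕ v))))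
      ≡⟨ laurent-coefficient r 0 c k 1≤D ⟩
    - (ℕ→ℚ D * (ℕ→ℚ (k !) * W (k ℕ.+ (r ℕ.+ 0))))
      ≡⟨ cong (λ w → - (ℕ→ℚ D * (ℕ→ℚ (k !) * w))) coefficient ⟩
    - (ℕ→ℚ D * (ℕ→ℚ (k !) * (((- 1ℚ) ^ r) * inv Y (k ℕ.+ r)))) ∎
    where
    open ≡-Reasoning
    coefficient : W (k ℕ.+ (r ℕ.+ 0)) ≡ ((- 1ℚ) ^ r) * inv Y (k ℕ.+ r)
    coefficient = trans (cong (λ j → W (k ℕ.+ j)) (ℕₚ.+-identityʳ r)) (trans (laurent-Barnes (k ℕ.+ r))
      (trans (cong₂ (λ x y → x + - y) (constant-⊛ ((- 1ℚ) ^ r) (inv Y) (k ℕ.+ r))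
          (X^-other r (k ℕ.+ r) (λ e → ℕₚ.<⇒≢ (ℕₚ.+-monoˡ-≤ r 1≤k) (sym e))))
        (ℚₚ.+-identityʳ _)))

-- The linear system and its unique solvability

-- The leading minus sign and (-1)^r combine to (-1)^(r-1); the factorial (α + r - 1)! cancels
-- against the one inside `bernoulliBarnes`.
right-hand-side : ∀ r D α (a : Fin r → ℕ) → 1 ≤ r → 2 ≤ α →
  - (ℕ→ℚ D * (ℕ→ℚ ((α ℕ.∸ 1) !) * (((- 1ℚ) ^ r) * inv (Π r (λ i → expm1OverZ (a i))) (α ℕ.∸ 1 ℕ.+ r)))) ≡
  ((((- 1ℚ) ^ (r ℕ.∸ 1)) * ℕ→ℚ ((α ℕ.∸ 1) !) * ℕ→ℚ D) ÷₀ ℕ→ℚ ((α ℕ.+ (r ℕ.∸ 1)) !)) * bernoulliBarnes a (α ℕ.+ (r ℕ.∸ 1))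
right-hand-side (suc r) D (suc k) a _ _ = begin
  - (d * (f * (- 1ℚ * s * I (k ℕ.+ suc r))))      ≡⟨ cong (λ j → - (d * (f * (- 1ℚ * s * I j)))) (ℕₚ.+-suc k r) ⟩
  - (d * (f * (- 1ℚ * s * I n)))                  ≡⟨ solve 4 (λ d f s i → :- (d :* (f :* ((:- con 1ℚ) :* s :* i))) := (s :* f :* d) :* i) refl d f s (I n) ⟩
  (s * f * d) * I n                               ≡⟨ cong (_* I n) (÷₀-cancel (s * f * d) (!≢0 n)) ⟨
  ((s * f * d) ÷₀ ℕ→ℚ (n !)) * ℕ→ℚ (n !) * I n    ≡⟨ ℚₚ.*-assoc ((s * f * d) ÷₀ ℕ→ℚ (n !)) (ℕ→ℚ (n !)) (I n) ⟩
  ((s * f * d) ÷₀ ℕ→ℚ (n !)) * (ℕ→ℚ (n !) * I n)  ∎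
  where
  open ≡-Reasoning
  d = ℕ→ℚ D
  f = ℕ→ℚ (k !)
  s = (- 1ℚ) ^ r
  n = suc k ℕ.+ r
  I = inv (Π (suc r) (λ i → expm1OverZ (a i)))

-- The difference of two solutions, re-indexed from pairs to columns, lies in the kernel.
system-unique : ∀ r D (α : Fin (r ℕ.* D) → ℕ) →
  (∀ (x : Fin (r ℕ.* D) → ℚ) → (∀ j → Σ (r ℕ.* D) (λ c → x c * row r D (α j) c) ≡ 0ℚ) → ∀ c → x c ≡ 0ℚ) →
  ∀ (x y : Fin r → Fin D → ℚ) →
  (∀ j → Σ r (λ m → Σ D (λ v → x m v * entry D (α j) (toℕ m) (suc (toℕ v)))) ≡
         Σ r (λ m → Σ D (λ v → y m v * entry D (α j) (toℕ m) (suc (toℕ v))))) →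
  ∀ m v → x m v ≡ y m v
system-unique r D α kernel x y eq m v = begin
  x m v                       ≡⟨ solve 2 (λ x y → x := (x :+ (:- con 1ℚ) :* y) :+ y) refl (x m v) (y m v) ⟩
  z m v + y m v               ≡⟨ cong (_+ y m v) (trans (cong (λ p → z (proj₁ p) (proj₂ p)) (sym (Finₚ.remQuot-combine {r} {D} m v))) (kernel ẑ vanishes (combine m v))) ⟩
  0ℚ + y m v                  ≡⟨ ℚₚ.+-identityˡ (y m v) ⟩
  y m v                       ∎
  where
  open ≡-Reasoning
  z : Fin r → Fin D → ℚ
  z m v = x m v + - 1ℚ * y m v
  ẑ : Fin (r ℕ.* D) → ℚ
  ẑ c = z (proj₁ (remQuot {r} D c)) (proj₂ (remQuot {r} D c))
  lhs : (Fin r → Fin D → ℚ) → Fin (r ℕ.* D) → ℚ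
  lhs x j = Σ r (λ m → Σ D (λ v → x m v * entry D (α j) (toℕ m) (suc (toℕ v))))
  vanishes : ∀ j → Σ (r ℕ.* D) (λ c → ẑ c * row r D (α j) c) ≡ 0ℚ
  vanishes j = begin
    Σ (r ℕ.* D) (λ c → ẑ c * row r D (α j) c)
      ≡⟨ Σ-row r D (α j) ẑ ⟩
    Σ r (λ m → Σ D (λ v → ẑ (combine m v) * e m v))
      ≡⟨ Σ-cong r (λ m → trans (Σ-cong D (λ v → trans (cong (λ p → z (proj₁ p) (proj₂ p) * e m v) (Finₚ.remQuot-combine {r} {D} m v))
           (solve 3 (λ x y e → (x :+ (:- con 1ℚ) :* y) :* e := x :* e :+ (:- con 1ℚ) :* (y :* e)) refl (x m v) (y m v) (e m v))))
           (trans (Σ-+ D (λ v → x m v * e m v) (λ v → - 1ℚ * (y m v * e m v)))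
             (cong (Σ D (λ v → x m v * e m v) +_) (Σ-*ˡ D (- 1ℚ) (λ v → y m v * e m v))))) ⟩
    Σ r (λ m → Σ D (λ v → x m v * e m v) + - 1ℚ * Σ D (λ v → y m v * e m v))
      ≡⟨ trans (Σ-+ r (λ m → Σ D (λ v → x m v * e m v)) (λ m → - 1ℚ * Σ D (λ v → y m v * e m v)))
           (cong (lhs x j +_) (Σ-*ˡ r (- 1ℚ) (λ m → Σ D (λ v → y m v * e m v)))) ⟩
    lhs x j + - 1ℚ * lhs y j
      ≡⟨ cong (_+ - 1ℚ * lhs y j) (eq j) ⟩
    lhs y j + - 1ℚ * lhs y j
      ≡⟨ solve 1 (λ y → y :+ (:- con 1ℚ) :* y := con 0ℚ) refl (lhs y j) ⟩
    0ℚ ∎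
    where
    e : Fin r → Fin D → ℚ
    e m v = entry D (α j) (toℕ m) (suc (toℕ v))

one-or-prime-positive : ∀ {D} → D ≡ 1 ⊎ Prime D → 1 ≤ D
one-or-prime-positive (inj₁ refl) = s≤s z≤n
one-or-prime-positive {D} (inj₂ D-prime) = ℕ.>-nonZero⁻¹ D {{prime⇒nonZero D-prime}}

theorem1p2 : (r D : ℕ) → 1 ≤ r → D ≡ 1 ⊎ Prime D →
  Σ[ α ∈ (Fin (r ℕ.* D) → ℕ) ]
    ((∀ i j → i Fin.< j → α i < α j)
    × (∀ i → 2 ≤ α i)
    × Δ r D α ≢ 0ℚ
    × ((a : Fin r → ℕ) → (∀ i → 1 ≤ a i) → (∀ i → a i ∣ D) →
       (d : Fin r → ℕ → ℚ) →
       (∀ m n → d m (n ℕ.+ D) ≡ d m n) →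
       (∀ n → ℕ→ℚ (partitionCount a n)
                ≡ Σ r (λ m → d m n * (ℕ→ℚ n ^ toℕ m))) →
       let rhs : Fin (r ℕ.* D) → ℚ
           rhs j = ((((- 1ℚ) ^ (r ℕ.∸ 1)) * ℕ→ℚ ((α j ℕ.∸ 1) !) * ℕ→ℚ D)
                     ÷₀ ℕ→ℚ ((α j ℕ.+ (r ℕ.∸ 1)) !))
                   * bernoulliBarnes a (α j ℕ.+ (r ℕ.∸ 1))
           lhs : (Fin r → Fin D → ℚ) → Fin (r ℕ.* D) → ℚ
           lhs x j = Σ r (λ m → Σ D (λ v →
                       x m v * entry D (α j) (toℕ m) (suc (toℕ v))))
       in (∀ j → lhs (λ m v → d m (suc (toℕ v))) j ≡ rhs j)
        × ((x : Fin r → Fin D → ℚ) → (∀ j → lhs x j ≡ rhs j) →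
           ∀ m v → x m v ≡ d m (suc (toℕ v)))))
theorem1p2 r D 1≤r D-prime = α , proj₁ (proj₂ selected) , proj₁ (proj₂ (proj₂ selected)) , proj₁ (proj₂ (proj₂ (proj₂ selected))) ,
  λ a 1≤a _ d d-periodic d-partition →
    let solves j = trans
          -- `system-solution` is stated for a row `suc k`; here k is α j - 1.
          (subst (λ β → Σ r (λ m → Σ D (λ v → d m (suc (toℕ v)) * entry D β (toℕ m) (suc (toℕ v)))) ≡
              - (ℕ→ℚ D * (ℕ→ℚ ((α j ℕ.∸ 1) !) * (((- 1ℚ) ^ r) * inv (Π r (λ i → expm1OverZ (a i))) (α j ℕ.∸ 1 ℕ.+ r)))))
            (ℕₚ.m+[n∸m]≡n (ℕₚ.≤-trans (s≤s z≤n) (2≤α j)))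
            (system-solution 1≤D a 1≤a d d-periodic d-partition (α j ℕ.∸ 1) (ℕₚ.∸-monoˡ-≤ 1 (2≤α j))))
          (right-hand-side r D (α j) a 1≤r (2≤α j))
    in solves , λ x eq → system-unique r D α kernel x (λ m v → d m (suc (toℕ v))) (λ j → trans (eq j) (sym (solves j)))
  where
  1≤D = one-or-prime-positive D-prime
  -- Selecting rows beyond 1 yields 2 ≤ α.
  selected = select-rows (r ℕ.* D) (row r D) (row-independent r D 1≤D) 1
  α = proj₁ selected
  2≤α = proj₁ (proj₂ (proj₂ selected))
  kernel = proj₂ (proj₂ (proj₂ (proj₂ selected)))
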